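{- Let $k \geq 3$ be an integer and let $p = p(n)$ satisfy $p = \omega(1/n^{k-1})$, i.e. $p\, n^{k-1} \to \infty$. Let $\mathcal{H} \sim \mathcal{H}_k(n,p)$ and $M = M(\mathcal{H})$. Then asymptotically almost surely (i.e. with probability tending to $1$ as $n \to \infty$) the abelian group $\operatorname{coker}(M) = \mathbb{Z}^n / \operatorname{Im}(M)$ is torsion-free.
   Context: For a $k$-uniform hypergraph $\mathcal{H}$ on vertex set $[n]=\{1,\dots,n\}$, $M(\mathcal{H})$ is the integer matrix with rows indexed by the vertices and columns indexed by the hyperedges of $\mathcal{H}$, defined as follows: for a hyperedge $e=\{v_1,\dots,v_k\}$ with $v_1<v_2<\cdots<v_k$, $M(v_i,e) = (-1)^{i+1}$ for $1\le i\le k$, and $M(v,e)=0$ for $v\notin e$. $\mathcal{H}_k(n,p)$ denotes the Erdős–Rényi random $k$-uniform hypergraph on $[n]$ in which each $k$-subset of $[n]$ is included as a hyperedge independently with probability $p$.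
   Formalization: The edge probabilities p(n) are taken to be rational numbers rather than real numbers. -}

module Defs where

open import Data.Bool using (Bool; true; false; if_then_else_; _∧_)
open import Data.Nat as ℕ using (ℕ; zero; suc; _<ᵇ_)
open import Data.Nat.Properties using (_≟_)
open import Data.Fin using (Fin; toℕ)
open import Data.Fin.Subset using (Subset; ∣_∣)
open import Data.Vec using (Vec; []; _∷_; lookup)
open import Data.List using (List; []; _∷_; map; filter; length; _++_; allFin)
open import Data.Integer as ℤ using (ℤ; +_; -_)
open import Data.Rational as ℚ using (ℚ; 0ℚ; 1ℚ)
open import Data.Product using (∃)
open import Relation.Binary.PropositionalEquality using (_≡_)

allVecs : (n : ℕ) → List (Vec Bool n)
allVecs zero = [] ∷ []
allVecs (suc n) = map (true ∷_) (allVecs n) ++ map (false ∷_) (allVecs n)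

kSubsets : (n k : ℕ) → List (Subset n)
kSubsets n k = filter (λ s → ∣ s ∣ ≟ k) (allVecs n)

-- a k-uniform hypergraph on [n]: for each k-subset, whether it is a hyperedge
Hypergraph : (n k : ℕ) → Set
Hypergraph n k = Vec Bool (length (kSubsets n k))

select : ∀ {A : Set} (l : List A) → Vec Bool (length l) → List A
select [] [] = []
select (x ∷ l) (true ∷ bs) = x ∷ select l bs
select (x ∷ l) (false ∷ bs) = select l bs

edges : ∀ {n k} → Hypergraph n k → List (Subset n)
edges {n} {k} H = select (kSubsets n k) H

even : ℕ → Bool
even zero = true
even (suc m) with even m
... | true = false
... | false = true

countBelow : ∀ {n} → Subset n → Fin n → ℕ
countBelow {n} e v = length (filter (λ u → Data.Bool._≟_ (lookup e u ∧ (toℕ u <ᵇ toℕ v)) true) (allFin n))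
  where import Data.Bool

-- column of M indexed by hyperedge e: if v = v_i (i-th smallest element
-- of e) then (-1)^(i+1), where i - 1 = countBelow e v; else 0.
column : ∀ {n} → Subset n → Fin n → ℤ
column e v = if lookup e v
             then (if even (countBelow e v) then + 1 else - (+ 1))
             else + 0

M : ∀ {n k} → Hypergraph n k → List (Fin n → ℤ)
M H = map column (edges H)

-- v ∈ Im(M) for the matrix with given columns: v = Σ a_j c_j for some a_j ∈ ℤ
InImage : ∀ {n} → List (Fin n → ℤ) → (Fin n → ℤ) → Set
InImage [] v = ∀ i → v i ≡ + 0
InImage (c ∷ cs) v = ∃ λ (a : ℤ) → InImage cs (λ i → v i ℤ.- a ℤ.* c i)

CokerTorsionFree : ∀ {n} → List (Fin n → ℤ) → Set
CokerTorsionFree {n} cs =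
  (v : Fin n → ℤ) (d : ℕ) → InImage cs (λ i → + (suc d) ℤ.* v i) → InImage cs v

weight : ℚ → ∀ {N} → Vec Bool N → ℚ
weight p [] = 1ℚ
weight p (true ∷ bs) = p ℚ.* weight p bs
weight p (false ∷ bs) = (1ℚ ℚ.- p) ℚ.* weight p bs

prob : (n k : ℕ) → ℚ → (Hypergraph n k → Bool) → ℚ
prob n k p f = go (allVecs (length (kSubsets n k)))
  where
  go : List (Hypergraph n k) → ℚ
  go [] = 0ℚ
  go (H ∷ Hs) = (if f H then weight p H else 0ℚ) ℚ.+ go Hs

toℚ : ℕ → ℚ
toℚ m = + m ℚ./ 1

{-# OPTIONS --safe #-}

-- Write x_v for the class of the vertex v in the cokernel and let μ be a small constant times n.
--
-- Almost all x_v agree up to a subset of size O(μ).  Choose greedily a set F of edges of H none of which is a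
-- combination of the others chosen before it with coefficients in {-1, 0, 1}.  All 2^|F| subset sums of columns of F are
-- distinct lattice points of ℓ¹-norm at most k |F|, whence |F| = O(n).  All edges of H lie in the set of k-sets
-- spanned by F, so a union bound over F shows that with high probability F leaves only few k-sets unspanned.  Averaging
-- gives a (k-1)-set S of high vertices such that a ∪ S is spanned for most low vertices a, and then these x_a agree;
-- for odd k they vanish, since some spanned k-set contains only such vertices.
--
-- If v is the only vertex of an edge whose class is not yet known, then x_v is determined as well.  After closing up,
-- every edge meets the remaining vertex set B in 0 or at least 2 points.  A second union bound, over the vertex sets U
-- that no edge meets in exactly one point although Σ_e (|e ∩ U| - 1)⁺ ≥ |U|, shows that the edges meeting B
-- can be removed one by one at a vertex of degree one, and such a removal creates no torsion.
--
-- Both union bounds are expectations of explicit nonnegative functions Z₁ and Z₂, and the event is Z₁ + Z₂ < 1.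

module Submission where

open import Defs
open import Data.Bool using (Bool; true)
open import Data.Nat using (ℕ; _≥_; _∸_; _^_)
open import Data.Rational using (ℚ; 0ℚ; 1ℚ; _≤_; _<_; _*_; _-_)
open import Data.Product using (∃; _×_)
open import Relation.Binary.PropositionalEquality using (_≡_)

open import Algebra.Bundles using (AbelianGroup)
open import Data.Bool using (false; if_then_else_; not; _∧_; _∨_)
import Data.Bool
open import Data.Empty using (⊥; ⊥-elim)
open import Data.Fin using (Fin; zero; suc; toℕ; _↑ˡ_; _↑ʳ_)
open import Data.Fin.Properties using (any?)
open import Data.Fin.Subset using (Subset; ∣_∣)
open import Data.Integer as ℤ using (ℤ; -[1+_])
import Data.Integer.Properties as ℤₚ
import Data.Integer.Tactic.RingSolver as ℤ-Ring
open import Data.List using (List; []; _∷_; map; _++_; length; filter; tabulate; concatMap; downFrom)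
open import Data.List.Membership.Propositional using (_∈_; find)
open import Data.List.Membership.Propositional.Properties using (∈-++⁻; ∈-++⁺ˡ; ∈-++⁺ʳ; ∈-map⁻; ∈-map⁺; ∈-∃++; ∈-concatMap⁺; ∈-filter⁻; ∈-filter⁺; ∈-downFrom⁺; ∈-downFrom⁻)
open import Data.List.Properties using (map-++; length-++; length-map; filter-++)
open import Data.List.Relation.Unary.All as All using (All; []; _∷_)
import Data.List.Relation.Unary.All.Properties as Allₚ
open import Data.List.Relation.Unary.AllPairs using ([]; _∷_)
open import Data.List.Relation.Unary.Any as Any using (here; there)
open import Data.List.Relation.Unary.Unique.Propositional using (Unique)
import Data.List.Relation.Unary.Unique.Propositional.Properties as Unique
open import Data.Maybe using (just; nothing)
open import Data.Nat as ℕ using (zero; suc; _<ᵇ_; _!; ⌊_/2⌋; ⌈_/2⌉)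
open import Data.Nat.DivMod using (_/_; m≡m%n+[m/n]*n; m%n<n; m/n*n≤m)
import Data.Nat.Properties as ℕₚ
import Data.Nat.Tactic.RingSolver as ℕ-Ring
open import Data.Product using (_,_; proj₁; proj₂)
open import Data.Rational as ℚ using (_+_; -_)
import Data.Rational.Properties as ℚₚ
import Data.Rational.Unnormalised as ℚᵘ
import Data.Rational.Unnormalised.Properties as ℚᵘₚ
open import Data.Sum using (_⊎_; inj₁; inj₂)
open import Data.Unit using (⊤; tt)
open import Data.Vec as Vec using (Vec; []; _∷_; lookup; zipWith; replicate)
import Data.Vec.Properties as Vecₚ
open import Function using (_∘_; id)
open import Level using (0ℓ)
open import Relation.Binary.PropositionalEquality using (refl; sym; trans; cong; cong₂; subst; subst₂; module ≡-Reasoning)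
open import Relation.Nullary using (¬_; Dec; yes; no; does)
open import Relation.Nullary.Decidable using (_⊎-dec_; _×-dec_)
open import Tactic.RingSolver using (solve-∀)
open import Tactic.RingSolver.Core.AlmostCommutativeRing using (AlmostCommutativeRing; fromCommutativeRing)

-- The product `p n^(k-1)` may grow more slowly than log n. Isolated vertices and vertices of small
-- degree then occur, so the classes of all vertices cannot be determined: a remainder B survives
-- and has to be shown harmless rather than empty. Moreover, torsion can sit at any prime, and an
-- estimate made prime by prime would have to be summed over all primes; signed spanning is a
-- statement over the integers and treats them together. The family F serves as a certificate: what
-- H spans depends on all of H, but once F is fixed the spanned sets are fixed too, and H must
-- contain F and avoid every unspanned set, which costs `p ^ |F|` and one factor `1 - p` for each
-- unspanned set. As F has only O(n) members while p times the number of unspanned sets is of larger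
-- order than n, the sum over F stays small. All estimates remain in ℚ: exponentials are replaced by
-- inequalities of Bernoulli type, whose decay like 1/(1 + n x) is enough because no rate of
-- convergence is asked for.

private variable
  A A′ : Set
  n l m : ℕ

-- Ordered field lemmas for ℚ

ringℚ : AlmostCommutativeRing 0ℓ 0ℓ
ringℚ = fromCommutativeRing ℚₚ.+-*-commutativeRing isZero?
  where
  isZero? : ∀ x → _
  isZero? x with 0ℚ ℚ.≟ x
  ... | yes e = just e
  ... | no _ = nothing

*-mono-≤ : ∀ {a b c d} → 0ℚ ≤ a → 0ℚ ≤ c → a ≤ b → c ≤ d → a * c ≤ b * d
*-mono-≤ {a} {b} {c} {d} 0≤a 0≤c a≤b c≤d = ℚₚ.≤-trans
  (ℚₚ.*-monoʳ-≤-nonNeg c {{ℚ.nonNegative 0≤c}} a≤b)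
  (ℚₚ.*-monoˡ-≤-nonNeg b {{ℚ.nonNegative (ℚₚ.≤-trans 0≤a a≤b)}} c≤d)

*-monoˡ-≤ : ∀ {a b c} → 0ℚ ≤ c → a ≤ b → c * a ≤ c * b
*-monoˡ-≤ {c = c} 0≤c = ℚₚ.*-monoˡ-≤-nonNeg c {{ℚ.nonNegative 0≤c}}

*-monoʳ-≤ : ∀ {a b c} → 0ℚ ≤ c → a ≤ b → a * c ≤ b * c
*-monoʳ-≤ {c = c} 0≤c = ℚₚ.*-monoʳ-≤-nonNeg c {{ℚ.nonNegative 0≤c}}

0≤* : ∀ {a b} → 0ℚ ≤ a → 0ℚ ≤ b → 0ℚ ≤ a * b
0≤* {a} {b} 0≤a 0≤b = subst (_≤ a * b) (ℚₚ.*-zeroʳ a) (*-monoˡ-≤ 0≤a 0≤b)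

0≤+ : ∀ {a b} → 0ℚ ≤ a → 0ℚ ≤ b → 0ℚ ≤ a + b
0≤+ {a} {b} 0≤a 0≤b = subst (_≤ a + b) (ℚₚ.+-identityʳ 0ℚ) (ℚₚ.+-mono-≤ 0≤a 0≤b)

0≤1 : 0ℚ ≤ 1ℚ
0≤1 = ℚₚ.nonNegative⁻¹ 1ℚ

≤-fromDiff : ∀ {a b} → 0ℚ ≤ b - a → a ≤ b
≤-fromDiff {a} {b} h = subst₂ _≤_ (ℚₚ.+-identityˡ a) (lemma a b) (ℚₚ.+-monoˡ-≤ a h)
  where
  lemma : ∀ a b → b - a + a ≡ b
  lemma = solve-∀ ringℚ

≤-toDiff : ∀ {a b} → a ≤ b → 0ℚ ≤ b - a
≤-toDiff {a} {b} h = subst (_≤ b - a) (ℚₚ.+-inverseʳ a) (ℚₚ.+-monoˡ-≤ (- a) h)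

a≤a+b : ∀ {a b} → 0ℚ ≤ b → a ≤ a + b
a≤a+b {a} {b} h = subst (_≤ a + b) (ℚₚ.+-identityʳ a) (ℚₚ.+-monoʳ-≤ a h)

a≤b+a : ∀ {a b} → 0ℚ ≤ b → a ≤ b + a
a≤b+a {a} {b} h = subst (_≤ b + a) (ℚₚ.+-identityˡ a) (ℚₚ.+-monoˡ-≤ a h)

a-b≤a : ∀ {a b} → 0ℚ ≤ b → a - b ≤ a
a-b≤a {a} {b} h = ≤-fromDiff (subst (0ℚ ≤_) (lemma a b) h)
  where
  lemma : ∀ a b → b ≡ a - (a - b)
  lemma = solve-∀ ringℚ

*≤1 : ∀ {a b} → 0ℚ ≤ a → 0ℚ ≤ b → a ≤ 1ℚ → b ≤ 1ℚ → a * b ≤ 1ℚ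
*≤1 0≤a 0≤b a≤1 b≤1 = *-mono-≤ 0≤a 0≤b a≤1 b≤1

1≤* : ∀ {a b} → 1ℚ ≤ a → 1ℚ ≤ b → 1ℚ ≤ a * b
1≤* 1≤a 1≤b = *-mono-≤ 0≤1 0≤1 1≤a 1≤b

≤1*⇒≤ : ∀ {a b} → 0ℚ ≤ b → a ≤ 1ℚ → a * b ≤ b
≤1*⇒≤ {a} {b} 0≤b a≤1 = subst (a * b ≤_) (ℚₚ.*-identityˡ b) (*-monoʳ-≤ 0≤b a≤1)

toℚᵘ-toℚ : ∀ m → ℚ.toℚᵘ (toℚ m) ℚᵘ.≃ ℚᵘ.mkℚᵘ (ℤ.+ m) 0
toℚᵘ-toℚ m = ℚₚ.toℚᵘ-fromℚᵘ (ℚᵘ.mkℚᵘ (ℤ.+ m) 0)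

toℚ-+ : ∀ m n → toℚ (m ℕ.+ n) ≡ toℚ m + toℚ n
toℚ-+ m n = ℚₚ.toℚᵘ-injective (ℚᵘₚ.≃-trans (toℚᵘ-toℚ (m ℕ.+ n)) (ℚᵘₚ.≃-sym
  (ℚᵘₚ.≃-trans (ℚₚ.toℚᵘ-homo-+ (toℚ m) (toℚ n))
  (ℚᵘₚ.≃-trans (ℚᵘₚ.+-cong (toℚᵘ-toℚ m) (toℚᵘ-toℚ n))
  (ℚᵘ.*≡* (cong (ℤ._* ℤ.1ℤ) (cong₂ ℤ._+_ (ℤₚ.*-identityʳ (ℤ.+ m)) (ℤₚ.*-identityʳ (ℤ.+ n)))))))))

toℚ-* : ∀ m n → toℚ (m ℕ.* n) ≡ toℚ m * toℚ n
toℚ-* m n = ℚₚ.toℚᵘ-injective (ℚᵘₚ.≃-trans (toℚᵘ-toℚ (m ℕ.* n)) (ℚᵘₚ.≃-sym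
  (ℚᵘₚ.≃-trans (ℚₚ.toℚᵘ-homo-* (toℚ m) (toℚ n))
  (ℚᵘₚ.≃-trans (ℚᵘₚ.*-cong (toℚᵘ-toℚ m) (toℚᵘ-toℚ n))
  (ℚᵘ.*≡* (cong (ℤ._* ℤ.1ℤ) (sym (ℤₚ.pos-* m n))))))))

toℚ-mono : ∀ {m n} → m ℕ.≤ n → toℚ m ≤ toℚ n
toℚ-mono {m} {n} m≤n = ℚₚ.toℚᵘ-cancel-≤
  (ℚᵘₚ.≤-respˡ-≃ (ℚᵘₚ.≃-sym (toℚᵘ-toℚ m)) (ℚᵘₚ.≤-respʳ-≃ (ℚᵘₚ.≃-sym (toℚᵘ-toℚ n))
  (ℚᵘ.*≤* (subst₂ ℤ._≤_ (sym (ℤₚ.*-identityʳ (ℤ.+ m))) (sym (ℤₚ.*-identityʳ (ℤ.+ n))) (ℤ.+≤+ m≤n)))))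

0≤toℚ : ∀ m → 0ℚ ≤ toℚ m
0≤toℚ m = toℚ-mono {0} {m} ℕ.z≤n

1≤toℚ : ∀ {m} → 1 ℕ.≤ m → 1ℚ ≤ toℚ m
1≤toℚ = toℚ-mono {1}

toℚ-suc : ∀ m → toℚ (suc m) ≡ 1ℚ + toℚ m
toℚ-suc = toℚ-+ 1

-- Powers of rationals and inequalities of Bernoulli type.

infixr 8 _↑_

_↑_ : ℚ → ℕ → ℚ
x ↑ zero = 1ℚ
x ↑ suc n = x * x ↑ n

0≤↑ : ∀ {x} → 0ℚ ≤ x → ∀ n → 0ℚ ≤ x ↑ n
0≤↑ 0≤x zero = 0≤1
0≤↑ 0≤x (suc n) = 0≤* 0≤x (0≤↑ 0≤x n)

↑-mono : ∀ {x y} → 0ℚ ≤ x → x ≤ y → ∀ n → x ↑ n ≤ y ↑ n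
↑-mono 0≤x x≤y zero = ℚₚ.≤-refl
↑-mono 0≤x x≤y (suc n) = *-mono-≤ 0≤x (0≤↑ 0≤x n) x≤y (↑-mono 0≤x x≤y n)

1↑ : ∀ n → 1ℚ ↑ n ≡ 1ℚ
1↑ zero = refl
1↑ (suc n) = trans (ℚₚ.*-identityˡ _) (1↑ n)

↑≤1 : ∀ {x} → 0ℚ ≤ x → x ≤ 1ℚ → ∀ n → x ↑ n ≤ 1ℚ
↑≤1 {x} 0≤x x≤1 n = subst (x ↑ n ≤_) (1↑ n) (↑-mono 0≤x x≤1 n)

1≤↑ : ∀ {x} → 1ℚ ≤ x → ∀ n → 1ℚ ≤ x ↑ n
1≤↑ {x} 1≤x n = subst (_≤ x ↑ n) (1↑ n) (↑-mono 0≤1 1≤x n)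

↑-+ : ∀ x m n → x ↑ (m ℕ.+ n) ≡ x ↑ m * x ↑ n
↑-+ x zero n = sym (ℚₚ.*-identityˡ _)
↑-+ x (suc m) n = trans (cong (x *_) (↑-+ x m n)) (sym (ℚₚ.*-assoc x (x ↑ m) (x ↑ n)))

*-↑ : ∀ x y n → (x * y) ↑ n ≡ x ↑ n * y ↑ n
*-↑ x y zero = refl
*-↑ x y (suc n) = trans (cong (x * y *_) (*-↑ x y n)) (lemma x y (x ↑ n) (y ↑ n))
  where
  lemma : ∀ x y u v → x * y * (u * v) ≡ x * u * (y * v)
  lemma = solve-∀ ringℚ

↑-* : ∀ x m n → x ↑ (m ℕ.* n) ≡ (x ↑ m) ↑ n
↑-* x zero n = sym (1↑ n)
↑-* x (suc m) n = begin
  x ↑ (n ℕ.+ m ℕ.* n)      ≡⟨ ↑-+ x n (m ℕ.* n) ⟩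
  x ↑ n * x ↑ (m ℕ.* n)    ≡⟨ cong (x ↑ n *_) (↑-* x m n) ⟩
  x ↑ n * (x ↑ m) ↑ n      ≡⟨ *-↑ x (x ↑ m) n ⟨
  (x * x ↑ m) ↑ n          ∎
  where open ≡-Reasoning

↑-antimono : ∀ {x} → 0ℚ ≤ x → x ≤ 1ℚ → ∀ {m n} → m ℕ.≤ n → x ↑ n ≤ x ↑ m
↑-antimono 0≤x x≤1 {n = n} ℕ.z≤n = ↑≤1 0≤x x≤1 n
↑-antimono 0≤x x≤1 (ℕ.s≤s m≤n) = *-monoˡ-≤ 0≤x (↑-antimono 0≤x x≤1 m≤n)

↑-monoʳ : ∀ {x} → 1ℚ ≤ x → ∀ {m n} → m ℕ.≤ n → x ↑ m ≤ x ↑ n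
↑-monoʳ 1≤x {n = n} ℕ.z≤n = 1≤↑ 1≤x n
↑-monoʳ 1≤x (ℕ.s≤s m≤n) = *-monoˡ-≤ (ℚₚ.≤-trans 0≤1 1≤x) (↑-monoʳ 1≤x m≤n)

toℚ-^ : ∀ m n → toℚ (m ^ n) ≡ toℚ m ↑ n
toℚ-^ m zero = refl
toℚ-^ m (suc n) = trans (toℚ-* m (m ^ n)) (cong (toℚ m *_) (toℚ-^ m n))

bernoulli⁺ : ∀ {x} → 0ℚ ≤ x → ∀ n → 1ℚ + toℚ n * x ≤ (1ℚ + x) ↑ n
bernoulli⁺ {x} 0≤x zero = ℚₚ.≤-reflexive (lemma x)
  where
  lemma : ∀ x → 1ℚ + 0ℚ * x ≡ 1ℚ
  lemma = solve-∀ ringℚ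
bernoulli⁺ {x} 0≤x (suc n) = begin
  1ℚ + toℚ (suc n) * x                            ≡⟨ cong (λ t → 1ℚ + t * x) (toℚ-suc n) ⟩
  1ℚ + (1ℚ + toℚ n) * x                           ≤⟨ a≤a+b (0≤* (0≤toℚ n) (0≤* 0≤x 0≤x)) ⟩
  1ℚ + (1ℚ + toℚ n) * x + toℚ n * (x * x)         ≡⟨ lemma x (toℚ n) ⟩
  (1ℚ + x) * (1ℚ + toℚ n * x)                     ≤⟨ *-monoˡ-≤ (0≤+ 0≤1 0≤x) (bernoulli⁺ 0≤x n) ⟩
  (1ℚ + x) * (1ℚ + x) ↑ n                         ∎
  where
  open ℚₚ.≤-Reasoning
  lemma : ∀ x t → 1ℚ + (1ℚ + t) * x + t * (x * x) ≡ (1ℚ + x) * (1ℚ + t * x)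
  lemma = solve-∀ ringℚ

bernoulli⁻ : ∀ {x} → 0ℚ ≤ x → x ≤ 1ℚ → ∀ n → 1ℚ - toℚ n * x ≤ (1ℚ - x) ↑ n
bernoulli⁻ {x} 0≤x x≤1 zero = ℚₚ.≤-reflexive (lemma x)
  where
  lemma : ∀ x → 1ℚ - 0ℚ * x ≡ 1ℚ
  lemma = solve-∀ ringℚ
bernoulli⁻ {x} 0≤x x≤1 (suc n) = begin
  1ℚ - toℚ (suc n) * x                            ≡⟨ cong (λ t → 1ℚ - t * x) (toℚ-suc n) ⟩
  1ℚ - (1ℚ + toℚ n) * x                           ≤⟨ a≤a+b (0≤* (0≤toℚ n) (0≤* 0≤x 0≤x)) ⟩
  1ℚ - (1ℚ + toℚ n) * x + toℚ n * (x * x)         ≡⟨ lemma x (toℚ n) ⟩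
  (1ℚ - x) * (1ℚ - toℚ n * x)                     ≤⟨ *-monoˡ-≤ (≤-toDiff x≤1) (bernoulli⁻ 0≤x x≤1 n) ⟩
  (1ℚ - x) * (1ℚ - x) ↑ n                         ∎
  where
  open ℚₚ.≤-Reasoning
  lemma : ∀ x t → 1ℚ - (1ℚ + t) * x + t * (x * x) ≡ (1ℚ - x) * (1ℚ - t * x)
  lemma = solve-∀ ringℚ

[1+x][1-x]≤1 : ∀ x → (1ℚ + x) * (1ℚ - x) ≤ 1ℚ
[1+x][1-x]≤1 x = subst (_≤ 1ℚ) (lemma x) (a-b≤a (0≤square x))
  where
  lemma : ∀ x → 1ℚ - x * x ≡ (1ℚ + x) * (1ℚ - x)
  lemma = solve-∀ ringℚ
  0≤square : ∀ x → 0ℚ ≤ x * x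
  0≤square x with ℚₚ.≤-total 0ℚ x
  ... | inj₁ 0≤x = 0≤* 0≤x 0≤x
  ... | inj₂ x≤0 = subst (0ℚ ≤_) (square x) (0≤* 0≤-x 0≤-x)
    where
    0≤-x = ℚₚ.neg-antimono-≤ x≤0
    square : ∀ x → (- x) * (- x) ≡ x * x
    square = solve-∀ ringℚ

-- Rational substitute for `(1 - x)^n ≤ e^(-n x)`, with `1 + n x` in place of the exponential.
-- Pairing the factors `1 + x` and `1 - x` leaves powers of `1 - x²`.
[1+nx][1-x]^n≤1 : ∀ {x} → 0ℚ ≤ x → x ≤ 1ℚ → ∀ n → (1ℚ + toℚ n * x) * (1ℚ - x) ↑ n ≤ 1ℚ
[1+nx][1-x]^n≤1 {x} 0≤x x≤1 n = begin
  (1ℚ + toℚ n * x) * (1ℚ - x) ↑ n  ≤⟨ *-monoʳ-≤ (0≤↑ (≤-toDiff x≤1) n) (bernoulli⁺ 0≤x n) ⟩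
  (1ℚ + x) ↑ n * (1ℚ - x) ↑ n      ≡⟨ *-↑ (1ℚ + x) (1ℚ - x) n ⟨
  ((1ℚ + x) * (1ℚ - x)) ↑ n        ≤⟨ ↑≤1 (0≤* (0≤+ 0≤1 0≤x) (≤-toDiff x≤1)) ([1+x][1-x]≤1 x) n ⟩
  1ℚ                               ∎
  where open ℚₚ.≤-Reasoning

-- Rational form of `(1 + x/r)^r ≤ e^x ≤ 1/(1 - x)`, with `y` standing for `x/r`. It lets a single
-- factor `1 - p` pay for many factors `1 + p y`.
[1+x/r]^r[1-x]≤1 : ∀ {x y} r → 0ℚ ≤ y → y ≤ 1ℚ → toℚ r * y ≡ x → (1ℚ + y) ↑ r * (1ℚ - x) ≤ 1ℚ
[1+x/r]^r[1-x]≤1 {x} {y} r 0≤y y≤1 refl = begin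
  (1ℚ + y) ↑ r * (1ℚ - toℚ r * y)  ≤⟨ *-monoˡ-≤ (0≤↑ 0≤1+y r) (bernoulli⁻ 0≤y y≤1 r) ⟩
  (1ℚ + y) ↑ r * (1ℚ - y) ↑ r      ≡⟨ *-↑ (1ℚ + y) (1ℚ - y) r ⟨
  ((1ℚ + y) * (1ℚ - y)) ↑ r        ≤⟨ ↑≤1 (0≤* 0≤1+y (≤-toDiff y≤1)) ([1+x][1-x]≤1 y) r ⟩
  1ℚ                               ∎
  where
  open ℚₚ.≤-Reasoning
  0≤1+y = 0≤+ 0≤1 0≤y

-- Finite sums and expectations

∑ : List A → (A → ℚ) → ℚ
∑ [] g = 0ℚ
∑ (x ∷ l) g = g x + ∑ l g

∑-cong : ∀ (l : List A) {g h} → (∀ x → g x ≡ h x) → ∑ l g ≡ ∑ l h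
∑-cong [] e = refl
∑-cong (x ∷ l) e = cong₂ _+_ (e x) (∑-cong l e)

∑-mono : ∀ (l : List A) {g h} → (∀ x → x ∈ l → g x ≤ h x) → ∑ l g ≤ ∑ l h
∑-mono [] e = ℚₚ.≤-refl
∑-mono (x ∷ l) e = ℚₚ.+-mono-≤ (e x (here refl)) (∑-mono l (λ y y∈l → e y (there y∈l)))

∑-nonneg : ∀ (l : List A) {g} → (∀ x → 0ℚ ≤ g x) → 0ℚ ≤ ∑ l g
∑-nonneg [] e = ℚₚ.≤-refl
∑-nonneg (x ∷ l) e = 0≤+ (e x) (∑-nonneg l e)

∑-++ : ∀ (l m : List A) g → ∑ (l ++ m) g ≡ ∑ l g + ∑ m g
∑-++ [] m g = sym (ℚₚ.+-identityˡ _)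
∑-++ (x ∷ l) m g = trans (cong (g x +_) (∑-++ l m g)) (sym (ℚₚ.+-assoc (g x) (∑ l g) (∑ m g)))

∑-map : ∀ (f : A → A′) l g → ∑ (map f l) g ≡ ∑ l (g ∘ f)
∑-map f [] g = refl
∑-map f (x ∷ l) g = cong (g (f x) +_) (∑-map f l g)

∑-*ˡ : ∀ (l : List A) c g → ∑ l (λ x → c * g x) ≡ c * ∑ l g
∑-*ˡ [] c g = sym (ℚₚ.*-zeroʳ c)
∑-*ˡ (x ∷ l) c g = trans (cong (c * g x +_) (∑-*ˡ l c g)) (sym (ℚₚ.*-distribˡ-+ c (g x) (∑ l g)))

∑-+ : ∀ (l : List A) g h → ∑ l (λ x → g x + h x) ≡ ∑ l g + ∑ l h
∑-+ [] g h = refl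
∑-+ (x ∷ l) g h = trans (cong (g x + h x +_) (∑-+ l g h)) (lemma (g x) (h x) (∑ l g) (∑ l h))
  where
  lemma : ∀ a b c d → a + b + (c + d) ≡ a + c + (b + d)
  lemma = solve-∀ ringℚ

∑-0 : ∀ (l : List A) → ∑ l (λ _ → 0ℚ) ≡ 0ℚ
∑-0 [] = refl
∑-0 (x ∷ l) = trans (ℚₚ.+-identityˡ _) (∑-0 l)

∑-const : ∀ (l : List A) c → ∑ l (λ _ → c) ≡ toℚ (length l) * c
∑-const [] c = sym (ℚₚ.*-zeroˡ c)
∑-const (x ∷ l) c = trans (cong (c +_) (∑-const l c))
  (trans (lemma c (toℚ (length l))) (cong (_* c) (sym (toℚ-suc (length l)))))
  where
  lemma : ∀ c t → c + t * c ≡ (1ℚ + t) * c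
  lemma = solve-∀ ringℚ

∑-swap : ∀ (l : List A) (m : List A′) (g : A → A′ → ℚ) →
  ∑ l (λ x → ∑ m (g x)) ≡ ∑ m (λ y → ∑ l (λ x → g x y))
∑-swap [] m g = sym (∑-0 m)
∑-swap (x ∷ l) m g = trans (cong (∑ m (g x) +_) (∑-swap l m g)) (sym (∑-+ m (g x) (λ y → ∑ l (λ x → g x y))))

term≤∑ : ∀ (l : List A) {g} → (∀ x → 0ℚ ≤ g x) → ∀ {x} → x ∈ l → g x ≤ ∑ l g
term≤∑ (x ∷ l) e (here refl) = a≤a+b (∑-nonneg l e)
term≤∑ (x ∷ l) e (there x∈l) = ℚₚ.≤-trans (term≤∑ l e x∈l) (a≤b+a (e x))

∏ : ∀ {N} → Vec ℚ N → ℚ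
∏ [] = 1ℚ
∏ (x ∷ xs) = x * ∏ xs

∑-allVecs-suc : ∀ N (g : Vec Bool (suc N) → ℚ) →
  ∑ (allVecs (suc N)) g ≡ ∑ (allVecs N) (g ∘ (true ∷_)) + ∑ (allVecs N) (g ∘ (false ∷_))
∑-allVecs-suc N g = trans (∑-++ (map (true ∷_) (allVecs N)) (map (false ∷_) (allVecs N)) g)
  (cong₂ _+_ (∑-map (true ∷_) (allVecs N) g) (∑-map (false ∷_) (allVecs N) g))

E : ℚ → ∀ {N} → (Vec Bool N → ℚ) → ℚ
E p {N} g = ∑ (allVecs N) (λ H → weight p H * g H)

E-suc : ∀ p {N} (g : Vec Bool (suc N) → ℚ) →
  E p g ≡ p * E p (g ∘ (true ∷_)) + (1ℚ - p) * E p (g ∘ (false ∷_))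
E-suc p {N} g = trans (∑-allVecs-suc N (λ H → weight p H * g H))
  (cong₂ _+_ (pull p true) (pull (1ℚ - p) false))
  where
  pull : ∀ c b → ∑ (allVecs N) (λ H → c * weight p H * g (b ∷ H)) ≡ c * E p (g ∘ (b ∷_))
  pull c b = trans (∑-cong (allVecs N) (λ H → ℚₚ.*-assoc c (weight p H) (g (b ∷ H))))
    (∑-*ˡ (allVecs N) c (λ H → weight p H * g (b ∷ H)))

E-∑ : ∀ p {N} (l : List A) (g : A → Vec Bool N → ℚ) →
  E p (λ H → ∑ l (λ x → g x H)) ≡ ∑ l (λ x → E p (g x))
E-∑ p {N} l g = trans
  (∑-cong (allVecs N) (λ H → sym (∑-*ˡ l (weight p H) (λ x → g x H))))
  (∑-swap (allVecs N) l (λ H x → weight p H * g x H))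

E-+ : ∀ p {N} (g h : Vec Bool N → ℚ) → E p (λ H → g H + h H) ≡ E p g + E p h
E-+ p {N} g h = trans (∑-cong (allVecs N) (λ H → ℚₚ.*-distribˡ-+ (weight p H) (g H) (h H)))
  (∑-+ (allVecs N) (λ H → weight p H * g H) (λ H → weight p H * h H))

E-*ˡ : ∀ p {N} c (g : Vec Bool N → ℚ) → E p (λ H → c * g H) ≡ c * E p g
E-*ˡ p {N} c g = trans (∑-cong (allVecs N) (λ H → lemma (weight p H) c (g H)))
  (∑-*ˡ (allVecs N) c (λ H → weight p H * g H))
  where
  lemma : ∀ w c x → w * (c * x) ≡ c * (w * x)
  lemma = solve-∀ ringℚ

-- Both union bounds are sums of multiples of such functions: the bits are independent, so the
-- expectation factors into means of single bits.
bitProduct : ∀ {N} → Vec (Bool → ℚ) N → Vec Bool N → ℚ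
bitProduct [] [] = 1ℚ
bitProduct (φ ∷ φs) (b ∷ H) = φ b * bitProduct φs H

mean : ℚ → (Bool → ℚ) → ℚ
mean p φ = p * φ true + (1ℚ - p) * φ false

E-bitProduct : ∀ p {N} (φs : Vec (Bool → ℚ) N) → E p (bitProduct φs) ≡ ∏ (Vec.map (mean p) φs)
E-bitProduct p [] = refl
E-bitProduct p (φ ∷ φs) = begin
  E p (bitProduct (φ ∷ φs))
    ≡⟨ E-suc p (bitProduct (φ ∷ φs)) ⟩
  p * E p (λ H → φ true * bitProduct φs H) + (1ℚ - p) * E p (λ H → φ false * bitProduct φs H)
    ≡⟨ cong₂ (λ s t → p * s + (1ℚ - p) * t) (E-*ˡ p (φ true) (bitProduct φs)) (E-*ˡ p (φ false) (bitProduct φs)) ⟩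
  p * (φ true * E p (bitProduct φs)) + (1ℚ - p) * (φ false * E p (bitProduct φs))
    ≡⟨ lemma p (1ℚ - p) (φ true) (φ false) (E p (bitProduct φs)) ⟩
  mean p φ * E p (bitProduct φs)
    ≡⟨ cong (mean p φ *_) (E-bitProduct p φs) ⟩
  mean p φ * ∏ (Vec.map (mean p) φs) ∎
  where
  open ≡-Reasoning
  lemma : ∀ p q x y e → p * (x * e) + q * (y * e) ≡ (p * x + q * y) * e
  lemma = solve-∀ ringℚ

E-1 : ∀ p N → E p {N} (λ _ → 1ℚ) ≡ 1ℚ
E-1 p zero = refl
E-1 p (suc N) = trans (E-suc p {N} (λ _ → 1ℚ)) (trans (cong (λ e → p * e + (1ℚ - p) * e) (E-1 p N)) (lemma p))
  where
  lemma : ∀ p → p * 1ℚ + (1ℚ - p) * 1ℚ ≡ 1ℚ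
  lemma = solve-∀ ringℚ

weight-nonneg : ∀ {p} → 0ℚ ≤ p → p ≤ 1ℚ → ∀ {N} (H : Vec Bool N) → 0ℚ ≤ weight p H
weight-nonneg 0≤p p≤1 [] = 0≤1
weight-nonneg 0≤p p≤1 (true ∷ H) = 0≤* 0≤p (weight-nonneg 0≤p p≤1 H)
weight-nonneg 0≤p p≤1 (false ∷ H) = 0≤* (≤-toDiff p≤1) (weight-nonneg 0≤p p≤1 H)

E-mono : ∀ {p} → 0ℚ ≤ p → p ≤ 1ℚ → ∀ {N} {g h : Vec Bool N → ℚ} → (∀ H → g H ≤ h H) → E p g ≤ E p h
E-mono 0≤p p≤1 {N} g≤h = ∑-mono (allVecs N) (λ H _ → *-monoˡ-≤ (weight-nonneg 0≤p p≤1 H) (g≤h H))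

indicator : Bool → ℚ
indicator b = if b then 1ℚ else 0ℚ

-- The auxiliary signature is left to unification because the recursion inside `prob` has no name outside Defs.
mutual
  prob≡E : ∀ n k p f → prob n k p f ≡ E p (indicator ∘ f)
  prob≡E n k p f with allVecs (length (kSubsets n k))
  ... | Hs = prob-go n k p f Hs

  prob-go : ∀ n k p f Hs → _ ≡ ∑ Hs (λ H → weight p H * indicator (f H))
  prob-go n k p f [] = refl
  prob-go n k p f (H ∷ Hs) = cong₂ _+_ (weight-indicator (f H)) (prob-go n k p f Hs)
    where
    weight-indicator : ∀ b → (if b then weight p H else 0ℚ) ≡ weight p H * indicator b
    weight-indicator true = sym (ℚₚ.*-identityʳ _)
    weight-indicator false = sym (ℚₚ.*-zeroʳ (weight p H))

-- Since `Z` is nonnegative, `1 - Z` lies below the indicator of `Z < 1` pointwise. Comparing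
-- rationals supplies a Boolean event without any decision procedure for torsion-freeness.
markov : ∀ {p} → 0ℚ ≤ p → p ≤ 1ℚ → ∀ n k (Z : Hypergraph n k → ℚ) → (∀ H → 0ℚ ≤ Z H) →
  1ℚ - E p Z ≤ prob n k p (λ H → does (Z H ℚₚ.<? 1ℚ))
markov {p} 0≤p p≤1 n k Z 0≤Z = begin
  1ℚ - E p Z                                     ≡⟨ E-complement ⟨
  E p (λ H → 1ℚ + (- 1ℚ) * Z H)                  ≤⟨ E-mono 0≤p p≤1 pointwise ⟩
  E p (λ H → indicator (does (Z H ℚₚ.<? 1ℚ)))    ≡⟨ prob≡E n k p _ ⟨
  prob n k p (λ H → does (Z H ℚₚ.<? 1ℚ))         ∎
  where
  open ℚₚ.≤-Reasoning
  lemma : ∀ z → 1ℚ + (- 1ℚ) * z ≡ 1ℚ - z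
  lemma = solve-∀ ringℚ
  E-complement : E p (λ H → 1ℚ + (- 1ℚ) * Z H) ≡ 1ℚ - E p Z
  E-complement = trans (E-+ p {length (kSubsets n k)} (λ _ → 1ℚ) (λ H → (- 1ℚ) * Z H))
    (trans (cong₂ _+_ (E-1 p (length (kSubsets n k))) (E-*ˡ p (- 1ℚ) Z)) (lemma (E p Z)))
  truncation : ∀ z → 0ℚ ≤ z → (z<1? : Dec (z < 1ℚ)) → 1ℚ + (- 1ℚ) * z ≤ indicator (does z<1?)
  truncation z 0≤z (yes _) = subst (_≤ 1ℚ) (sym (lemma z)) (a-b≤a 0≤z)
  truncation z 0≤z (no z≮1) = subst₂ _≤_ (sym (lemma z)) (ℚₚ.+-inverseʳ z) (ℚₚ.+-monoˡ-≤ (- z) (ℚₚ.≮⇒≥ z≮1))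
  pointwise : ∀ H → 1ℚ + (- 1ℚ) * Z H ≤ indicator (does (Z H ℚₚ.<? 1ℚ))
  pointwise H = truncation (Z H) (0≤Z H) (Z H ℚₚ.<? 1ℚ)

-- Vectors of integers

infixl 6 _⊕_ _⊖_

_⊕_ _⊖_ : ∀ {n} → Vec ℤ n → Vec ℤ n → Vec ℤ n
_⊕_ = zipWith ℤ._+_
_⊖_ = zipWith ℤ._-_

𝟎 : ∀ {n} → Vec ℤ n
𝟎 {n} = replicate n ℤ.0ℤ

⊖-self : ∀ {n} (z : Vec ℤ n) → z ⊖ z ≡ 𝟎
⊖-self [] = refl
⊖-self (a ∷ z) = cong₂ _∷_ (ℤₚ.+-inverseʳ a) (⊖-self z)

⊕-⊖-cancel : ∀ {n} (c z w : Vec ℤ n) → (c ⊕ z) ⊖ (c ⊕ w) ≡ z ⊖ w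
⊕-⊖-cancel [] [] [] = refl
⊕-⊖-cancel (c ∷ cs) (a ∷ z) (b ∷ w) = cong₂ _∷_ (lemma c a b) (⊕-⊖-cancel cs z w)
  where
  lemma : ∀ c a b → c ℤ.+ a ℤ.- (c ℤ.+ b) ≡ a ℤ.- b
  lemma = ℤ-Ring.solve-∀

⊕-⊖-⊖ : ∀ {n} (c z w : Vec ℤ n) → (c ⊕ z) ⊖ w ⊖ c ≡ z ⊖ w
⊕-⊖-⊖ [] [] [] = refl
⊕-⊖-⊖ (c ∷ cs) (a ∷ z) (b ∷ w) = cong₂ _∷_ (lemma c a b) (⊕-⊖-⊖ cs z w)
  where
  lemma : ∀ c a b → c ℤ.+ a ℤ.- b ℤ.- c ≡ a ℤ.- b
  lemma = ℤ-Ring.solve-∀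

⊖-⊕-⊕ : ∀ {n} (c z w : Vec ℤ n) → z ⊖ (c ⊕ w) ⊕ c ≡ z ⊖ w
⊖-⊕-⊕ [] [] [] = refl
⊖-⊕-⊕ (c ∷ cs) (a ∷ z) (b ∷ w) = cong₂ _∷_ (lemma c a b) (⊖-⊕-⊕ cs z w)
  where
  lemma : ∀ c a b → a ℤ.- (c ℤ.+ b) ℤ.+ c ≡ a ℤ.- b
  lemma = ℤ-Ring.solve-∀

⊕-⊖ʳ : ∀ {n} (c w : Vec ℤ n) → (c ⊕ w) ⊖ w ≡ c
⊕-⊖ʳ [] [] = refl
⊕-⊖ʳ (c ∷ cs) (b ∷ w) = cong₂ _∷_ (lemma c b) (⊕-⊖ʳ cs w)
  where
  lemma : ∀ c b → c ℤ.+ b ℤ.- b ≡ c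
  lemma = ℤ-Ring.solve-∀

⊕-cancelˡ : ∀ {n} (c : Vec ℤ n) {z w} → c ⊕ z ≡ c ⊕ w → z ≡ w
⊕-cancelˡ [] {[]} {[]} e = refl
⊕-cancelˡ (c ∷ cs) {a ∷ z} {b ∷ w} e =
  cong₂ _∷_ (ℤ-cancel c (Vecₚ.∷-injectiveˡ e)) (⊕-cancelˡ cs (Vecₚ.∷-injectiveʳ e))
  where
  ℤ-cancel : ∀ c {a b} → c ℤ.+ a ≡ c ℤ.+ b → a ≡ b
  ℤ-cancel c {a} {b} = ∙-cancelˡ c a b
    where open import Algebra.Properties.Group (AbelianGroup.group ℤₚ.+-0-abelianGroup) using (∙-cancelˡ)

-- Signed combinations and subset sums

-- The coefficients -1, 0, 1 are those of a difference of two subset sums; this is what ties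
-- independence to the distinctness of subset sums.
Signed : ∀ {n} → List (Vec ℤ n) → Vec ℤ n → Set
Signed [] z = z ≡ 𝟎
Signed (c ∷ F) z = Signed F z ⊎ Signed F (z ⊖ c) ⊎ Signed F (z ⊕ c)

signed? : ∀ {n} (F : List (Vec ℤ n)) z → Dec (Signed F z)
signed? [] z = Vecₚ.≡-dec ℤ._≟_ z 𝟎
signed? (c ∷ F) z = signed? F z ⊎-dec signed? F (z ⊖ c) ⊎-dec signed? F (z ⊕ c)

signed-𝟎 : ∀ {n} (F : List (Vec ℤ n)) → Signed F 𝟎
signed-𝟎 [] = refl
signed-𝟎 (c ∷ F) = inj₁ (signed-𝟎 F)

signed-head : ∀ {n} c (F : List (Vec ℤ n)) → Signed (c ∷ F) c
signed-head c F = inj₂ (inj₁ (subst (Signed F) (sym (⊖-self c)) (signed-𝟎 F)))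

subsetSums : ∀ {n} → List (Vec ℤ n) → List (Vec ℤ n)
subsetSums [] = 𝟎 ∷ []
subsetSums (c ∷ F) = subsetSums F ++ map (c ⊕_) (subsetSums F)

subsetSums-difference : ∀ {n} (F : List (Vec ℤ n)) {z w} →
  z ∈ subsetSums F → w ∈ subsetSums F → Signed F (z ⊖ w)
subsetSums-difference [] (here refl) (here refl) = ⊖-self 𝟎
subsetSums-difference (c ∷ F) {z} {w} z∈ w∈
  with ∈-++⁻ (subsetSums F) z∈ | ∈-++⁻ (subsetSums F) w∈
... | inj₁ z∈F | inj₁ w∈F = inj₁ (subsetSums-difference F z∈F w∈F)
... | inj₁ z∈F | inj₂ w∈cF with ∈-map⁻ (c ⊕_) w∈cF
...   | w′ , w′∈F , refl = inj₂ (inj₂ (subst (Signed F) (sym (⊖-⊕-⊕ c z w′)) (subsetSums-difference F z∈F w′∈F)))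
subsetSums-difference (c ∷ F) {z} {w} z∈ w∈ | inj₂ z∈cF | inj₁ w∈F with ∈-map⁻ (c ⊕_) z∈cF
...   | z′ , z′∈F , refl = inj₂ (inj₁ (subst (Signed F) (sym (⊕-⊖-⊖ c z′ w)) (subsetSums-difference F z′∈F w∈F)))
subsetSums-difference (c ∷ F) {z} {w} z∈ w∈ | inj₂ z∈cF | inj₂ w∈cF with ∈-map⁻ (c ⊕_) z∈cF | ∈-map⁻ (c ⊕_) w∈cF
...   | z′ , z′∈F , refl | w′ , w′∈F , refl =
  inj₁ (subst (Signed F) (sym (⊕-⊖-cancel c z′ w′)) (subsetSums-difference F z′∈F w′∈F))

Independent : ∀ {n} → List (Vec ℤ n) → Set
Independent [] = ⊤
Independent (c ∷ F) = ¬ Signed F c × Independent F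

-- If a sum using `c` equals one avoiding it, then `c` is a difference of two subset sums of `F`,
-- hence a signed combination of `F`.
subsetSums-unique : ∀ {n} (F : List (Vec ℤ n)) → Independent F → Unique (subsetSums F)
subsetSums-unique [] _ = [] ∷ []
subsetSums-unique (c ∷ F) (c∉F , ind) =
  Unique.++⁺ (subsetSums-unique F ind) (Unique.map⁺ (⊕-cancelˡ c) (subsetSums-unique F ind)) disjoint
  where
  disjoint : ∀ {z} → z ∈ subsetSums F × z ∈ map (c ⊕_) (subsetSums F) → ⊥
  disjoint (z∈F , z∈cF) with ∈-map⁻ (c ⊕_) z∈cF
  ... | w , w∈F , refl = c∉F (subst (Signed F) (⊕-⊖ʳ c w) (subsetSums-difference F z∈F w∈F))

‖_‖ : ∀ {n} → Vec ℤ n → ℕ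
‖ [] ‖ = 0
‖ a ∷ z ‖ = ℤ.∣ a ∣ ℕ.+ ‖ z ‖

‖𝟎‖ : ∀ n → ‖ 𝟎 {n} ‖ ≡ 0
‖𝟎‖ zero = refl
‖𝟎‖ (suc n) = ‖𝟎‖ n

‖⊕‖ : ∀ {n} (z w : Vec ℤ n) → ‖ z ⊕ w ‖ ℕ.≤ ‖ z ‖ ℕ.+ ‖ w ‖
‖⊕‖ [] [] = ℕ.z≤n
‖⊕‖ (a ∷ z) (b ∷ w) = ℕₚ.≤-trans (ℕₚ.+-mono-≤ (ℤₚ.∣i+j∣≤∣i∣+∣j∣ a b) (‖⊕‖ z w))
  (ℕₚ.≤-reflexive (interchange ℤ.∣ a ∣ ℤ.∣ b ∣ ‖ z ‖ ‖ w ‖))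
  where
  open import Algebra.Properties.CommutativeSemigroup ℕₚ.+-commutativeSemigroup using (interchange)

subsetSums-norm : ∀ {n} k (F : List (Vec ℤ n)) → All (λ c → ‖ c ‖ ≡ k) F →
  ∀ {z} → z ∈ subsetSums F → ‖ z ‖ ℕ.≤ length F ℕ.* k
subsetSums-norm {n} k [] [] (here refl) = ℕₚ.≤-reflexive (‖𝟎‖ n)
subsetSums-norm k (c ∷ F) (‖c‖ ∷ ‖F‖) z∈ with ∈-++⁻ (subsetSums F) z∈
... | inj₁ z∈F = ℕₚ.≤-trans (subsetSums-norm k F ‖F‖ z∈F) (ℕₚ.m≤n+m _ k)
... | inj₂ z∈cF with ∈-map⁻ (c ⊕_) z∈cF
...   | w , w∈F , refl = ℕₚ.≤-trans (‖⊕‖ c w)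
  (ℕₚ.+-mono-≤ (ℕₚ.≤-reflexive ‖c‖) (subsetSums-norm k F ‖F‖ w∈F))

-- Adding a vector of norm `k` raises the norm by at most `k`, so the sums that use `c` weigh at
-- least `x ↑ k` times those that avoid it.
subsetSums-weight : ∀ {n} k x → 0ℚ ≤ x → x ≤ 1ℚ → (F : List (Vec ℤ n)) → All (λ c → ‖ c ‖ ≡ k) F →
  (1ℚ + x ↑ k) ↑ length F ≤ ∑ (subsetSums F) (λ z → x ↑ ‖ z ‖)
subsetSums-weight {n} k x 0≤x x≤1 [] [] = ℚₚ.≤-reflexive
  (sym (trans (ℚₚ.+-identityʳ (x ↑ ‖ 𝟎 {n} ‖)) (cong (x ↑_) (‖𝟎‖ n))))
subsetSums-weight k x 0≤x x≤1 (c ∷ F) (‖c‖ ∷ ‖F‖) = begin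
  (1ℚ + x ↑ k) * (1ℚ + x ↑ k) ↑ length F   ≤⟨ *-monoˡ-≤ (0≤+ 0≤1 (0≤↑ 0≤x k)) (subsetSums-weight k x 0≤x x≤1 F ‖F‖) ⟩
  (1ℚ + x ↑ k) * ∑ S wt                    ≡⟨ expand (x ↑ k) (∑ S wt) ⟩
  ∑ S wt + x ↑ k * ∑ S wt                  ≡⟨ cong (∑ S wt +_) (∑-*ˡ S (x ↑ k) wt) ⟨
  ∑ S wt + ∑ S (λ z → x ↑ k * wt z)        ≤⟨ ℚₚ.+-monoʳ-≤ (∑ S wt) (∑-mono S (λ z _ → shifted z)) ⟩
  ∑ S wt + ∑ S (wt ∘ (c ⊕_))               ≡⟨ cong (∑ S wt +_) (∑-map (c ⊕_) S wt) ⟨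
  ∑ S wt + ∑ (map (c ⊕_) S) wt             ≡⟨ ∑-++ S (map (c ⊕_) S) wt ⟨
  ∑ (S ++ map (c ⊕_) S) wt                 ∎
  where
  open ℚₚ.≤-Reasoning
  S = subsetSums F
  wt : Vec ℤ _ → ℚ
  wt z = x ↑ ‖ z ‖
  expand : ∀ a s → (1ℚ + a) * s ≡ s + a * s
  expand = solve-∀ ringℚ
  shifted : ∀ z → x ↑ k * wt z ≤ wt (c ⊕ z)
  shifted z = subst (_≤ wt (c ⊕ z)) (↑-+ x k ‖ z ‖)
    (↑-antimono 0≤x x≤1 (subst (λ t → ‖ c ⊕ z ‖ ℕ.≤ t ℕ.+ ‖ z ‖) ‖c‖ (‖⊕‖ c z)))

-- Lattice points weighted by their ℓ¹-norm.

interval : ℕ → List ℤ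
interval zero = ℤ.0ℤ ∷ []
interval (suc R) = ℤ.+ suc R ∷ -[1+ R ] ∷ interval R

∈-interval : ∀ R a → ℤ.∣ a ∣ ℕ.≤ R → a ∈ interval R
∈-interval zero (ℤ.+ zero) _ = here refl
∈-interval (suc R) (ℤ.+ a) a≤ with ℕₚ.m≤n⇒m<n∨m≡n a≤
... | inj₁ (ℕ.s≤s a≤R) = there (there (∈-interval R (ℤ.+ a) a≤R))
... | inj₂ refl = here refl
∈-interval (suc R) -[1+ a ] a≤ with ℕₚ.m≤n⇒m<n∨m≡n a≤
... | inj₁ (ℕ.s≤s a≤R) = there (there (∈-interval R -[1+ a ] a≤R))
... | inj₂ refl = there (here refl)

-- The extra summand makes the bound on a truncated geometric series inductive.
interval-weight : ∀ M y → M * y ≡ 1ℚ → ∀ R →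
  ∑ (interval R) (λ a → (1ℚ - y) ↑ ℤ.∣ a ∣) + (M + M) * (1ℚ - y) ↑ suc R ≡ M + M - 1ℚ
interval-weight M y My≡1 zero = begin
  1ℚ + 0ℚ + (M + M) * ((1ℚ - y) * 1ℚ)     ≡⟨ lemma M y ⟩
  1ℚ + (M + M) - (M * y + M * y)          ≡⟨ cong (λ t → 1ℚ + (M + M) - (t + t)) My≡1 ⟩
  1ℚ + (M + M) - (1ℚ + 1ℚ)                ≡⟨ lemma′ (M + M) ⟩
  M + M - 1ℚ                              ∎
  where
  open ≡-Reasoning
  lemma : ∀ m y → 1ℚ + 0ℚ + (m + m) * ((1ℚ - y) * 1ℚ) ≡ 1ℚ + (m + m) - (m * y + m * y)
  lemma = solve-∀ ringℚ
  lemma′ : ∀ t → 1ℚ + t - (1ℚ + 1ℚ) ≡ t - 1ℚ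
  lemma′ = solve-∀ ringℚ
interval-weight M y My≡1 (suc R) = begin
  a + (a + S) + (M + M) * (x * a)                          ≡⟨ lemma M y a S ⟩
  S + (M + M) * a + (a + a - (M * y + M * y) * a)          ≡⟨ cong (λ t → S + (M + M) * a + (a + a - (t + t) * a)) My≡1 ⟩
  S + (M + M) * a + (a + a - (1ℚ + 1ℚ) * a)                ≡⟨ lemma′ S (M + M) a ⟩
  S + (M + M) * a                                          ≡⟨ interval-weight M y My≡1 R ⟩
  M + M - 1ℚ                                               ∎
  where
  open ≡-Reasoning
  x = 1ℚ - y
  a = x ↑ suc R
  S = ∑ (interval R) (λ a → x ↑ ℤ.∣ a ∣)
  lemma : ∀ m y a S → a + (a + S) + (m + m) * ((1ℚ - y) * a) ≡ S + (m + m) * a + (a + a - (m * y + m * y) * a)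
  lemma = solve-∀ ringℚ
  lemma′ : ∀ S D a → S + D * a + (a + a - (1ℚ + 1ℚ) * a) ≡ S + D * a
  lemma′ = solve-∀ ringℚ

-- The cube contains the ℓ¹-ball of radius `R` and, unlike the ball, is a product, so its total
-- weight is an `n`-th power.
box : ∀ n → ℕ → List (Vec ℤ n)
box zero R = [] ∷ []
box (suc n) R = concatMap (λ a → map (a ∷_) (box n R)) (interval R)

∈-box : ∀ {n} R (z : Vec ℤ n) → ‖ z ‖ ℕ.≤ R → z ∈ box n R
∈-box R [] _ = here refl
∈-box R (a ∷ z) ‖z‖≤R = ∈-concatMap⁺ (λ a → map (a ∷_) (box _ R))
  (Any.map (λ { refl → ∈-map⁺ (a ∷_) (∈-box R z (ℕₚ.≤-trans (ℕₚ.m≤n+m ‖ z ‖ ℤ.∣ a ∣) ‖z‖≤R)) })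
    (∈-interval R a (ℕₚ.≤-trans (ℕₚ.m≤m+n ℤ.∣ a ∣ ‖ z ‖) ‖z‖≤R)))

∑-concatMap : ∀ {A B : Set} (f : A → List B) l g → ∑ (concatMap f l) g ≡ ∑ l (λ x → ∑ (f x) g)
∑-concatMap f [] g = refl
∑-concatMap f (x ∷ l) g = trans (∑-++ (f x) (concatMap f l) g) (cong (∑ (f x) g +_) (∑-concatMap f l g))

box-weight : ∀ x n R → ∑ (box n R) (λ z → x ↑ ‖ z ‖) ≡ ∑ (interval R) (λ a → x ↑ ℤ.∣ a ∣) ↑ n
box-weight x zero R = ℚₚ.+-identityʳ _
box-weight x (suc n) R = begin
  ∑ (box (suc n) R) wt
    ≡⟨ ∑-concatMap (λ a → map (a ∷_) (box n R)) (interval R) wt ⟩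
  ∑ (interval R) (λ a → ∑ (map (a ∷_) (box n R)) wt)
    ≡⟨ ∑-cong (interval R) factor ⟩
  ∑ (interval R) (λ a → B * x ↑ ℤ.∣ a ∣)
    ≡⟨ ∑-*ˡ (interval R) B (λ a → x ↑ ℤ.∣ a ∣) ⟩
  B * I
    ≡⟨ ℚₚ.*-comm B I ⟩
  I * B
    ≡⟨ cong (I *_) (box-weight x n R) ⟩
  I * I ↑ n ∎
  where
  open ≡-Reasoning
  wt : ∀ {n} → Vec ℤ n → ℚ
  wt z = x ↑ ‖ z ‖
  I = ∑ (interval R) (λ a → x ↑ ℤ.∣ a ∣)
  B = ∑ (box n R) wt
  factor : ∀ a → ∑ (map (a ∷_) (box n R)) wt ≡ B * x ↑ ℤ.∣ a ∣
  factor a = trans (∑-map (a ∷_) (box n R) wt)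
    (trans (∑-cong (box n R) (λ z → ↑-+ x ℤ.∣ a ∣ ‖ z ‖))
    (trans (∑-*ˡ (box n R) (x ↑ ℤ.∣ a ∣) wt) (ℚₚ.*-comm (x ↑ ℤ.∣ a ∣) B)))

∑-unique-⊆ : ∀ {A : Set} (S T : List A) {g} → (∀ x → 0ℚ ≤ g x) → Unique S → (∀ {x} → x ∈ S → x ∈ T) → ∑ S g ≤ ∑ T g
∑-unique-⊆ [] T 0≤g _ _ = ∑-nonneg T 0≤g
∑-unique-⊆ (x ∷ S) T {g} 0≤g (x∉S ∷ uniq) S⊆T with ∈-∃++ (S⊆T (here refl))
... | T₁ , T₂ , refl = begin
  g x + ∑ S g                  ≤⟨ ℚₚ.+-monoʳ-≤ (g x) (∑-unique-⊆ S (T₁ ++ T₂) 0≤g uniq S⊆T₁T₂) ⟩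
  g x + ∑ (T₁ ++ T₂) g         ≡⟨ cong (g x +_) (∑-++ T₁ T₂ g) ⟩
  g x + (∑ T₁ g + ∑ T₂ g)      ≡⟨ lemma (g x) (∑ T₁ g) (∑ T₂ g) ⟩
  ∑ T₁ g + (g x + ∑ T₂ g)      ≡⟨ ∑-++ T₁ (x ∷ T₂) g ⟨
  ∑ (T₁ ++ x ∷ T₂) g           ∎
  where
  open ℚₚ.≤-Reasoning
  lemma : ∀ a b c → a + (b + c) ≡ b + (a + c)
  lemma = solve-∀ ringℚ
  S⊆T₁T₂ : ∀ {y} → y ∈ S → y ∈ T₁ ++ T₂
  S⊆T₁T₂ y∈S with ∈-++⁻ T₁ (S⊆T (there y∈S))
  ... | inj₁ y∈T₁ = ∈-++⁺ˡ y∈T₁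
  ... | inj₂ (here refl) = ⊥-elim (All.lookup x∉S y∈S refl)
  ... | inj₂ (there y∈T₂) = ∈-++⁺ʳ T₁ y∈T₂

∃-inverse : ∀ a → 1ℚ ≤ a → ∃ λ b → a * b ≡ 1ℚ × 0ℚ ≤ b × b ≤ 1ℚ
∃-inverse a 1≤a = b , ℚₚ.*-inverseʳ a , 0≤b , subst₂ _≤_ (ℚₚ.*-identityˡ b) (ℚₚ.*-inverseʳ a) (*-monoʳ-≤ 0≤b 1≤a)
  where
  instance
    a>0 : ℚ.Positive a
    a>0 = ℚ.positive (ℚₚ.<-≤-trans (ℚₚ.positive⁻¹ 1ℚ) 1≤a)
    a≢0 : ℚ.NonZero a
    a≢0 = ℚₚ.pos⇒nonZero a
  b = ℚ.1/ a
  0≤b : 0ℚ ≤ b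
  0≤b = ℚₚ.<⇒≤ (ℚₚ.positive⁻¹ b {{ℚₚ.1/pos⇒pos a}})

-- Here `h` is one half, known only through its equation, and 9/4 exceeds 2 by `h * h`. Each vector
-- will multiply the weight by 3/2 only, so the growth bound has to be squared to reach powers of 2.
2≤[3/2]² : ∀ h → h + h ≡ 1ℚ → 1ℚ + 1ℚ ≤ (1ℚ + (1ℚ - h)) * (1ℚ + (1ℚ - h))
2≤[3/2]² h h+h≡1 = ≤-fromDiff (subst (0ℚ ≤_) difference (0≤* 0≤h 0≤h))
  where
  0≤h : 0ℚ ≤ h
  0≤h with ℚₚ.≤-total 0ℚ h
  ... | inj₁ 0≤h = 0≤h
  ... | inj₂ h≤0 = ⊥-elim (ℚₚ.<-irrefl refl (ℚₚ.<-≤-trans (ℚₚ.positive⁻¹ 1ℚ) (subst (_≤ 0ℚ) h+h≡1 (ℚₚ.+-mono-≤ h≤0 h≤0))))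
  lemma : ∀ h → h * h + (1ℚ + 1ℚ) * (1ℚ - (h + h)) ≡ (1ℚ + (1ℚ - h)) * (1ℚ + (1ℚ - h)) - (1ℚ + 1ℚ)
  lemma = solve-∀ ringℚ
  zero-summand : ∀ a b → a ≡ a + b * (1ℚ - 1ℚ)
  zero-summand = solve-∀ ringℚ
  difference : h * h ≡ (1ℚ + (1ℚ - h)) * (1ℚ + (1ℚ - h)) - (1ℚ + 1ℚ)
  difference = trans (zero-summand (h * h) (1ℚ + 1ℚ))
    (trans (cong (λ s → h * h + (1ℚ + 1ℚ) * (1ℚ - s)) (sym h+h≡1)) (lemma h))

-- All subset sums of an independent family are distinct and have ℓ¹-norm at most k ∣ F ∣, so weighting
-- z by x ^ ‖ z ‖ with x = 1 - 1/2k compares their number with a power of n.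
independent-length-via : ∀ {n} k (F : List (Vec ℤ n)) → All (λ c → ‖ c ‖ ≡ k) F → Independent F →
  ∀ y → (toℚ k + toℚ k) * y ≡ 1ℚ → 0ℚ ≤ y → y ≤ 1ℚ →
  (1ℚ + 1ℚ) ↑ length F ≤ ((toℚ k + toℚ k + (toℚ k + toℚ k)) * (toℚ k + toℚ k + (toℚ k + toℚ k))) ↑ n
independent-length-via {n} k F ‖F‖ ind y 2ky≡1 0≤y y≤1 = begin
  (1ℚ + 1ℚ) ↑ t                          ≤⟨ ↑-mono (0≤+ 0≤1 0≤1) 2≤ t ⟩
  ((1ℚ + x ↑ k) * (1ℚ + x ↑ k)) ↑ t      ≡⟨ *-↑ (1ℚ + x ↑ k) (1ℚ + x ↑ k) t ⟩
  (1ℚ + x ↑ k) ↑ t * (1ℚ + x ↑ k) ↑ t    ≤⟨ *-mono-≤ (0≤↑ 0≤1+xk t) (0≤↑ 0≤1+xk t) growth growth ⟩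
  D ↑ n * D ↑ n                          ≡⟨ *-↑ D D n ⟨
  (D * D) ↑ n                            ∎
  where
  open ℚₚ.≤-Reasoning
  t = length F
  x = 1ℚ - y
  2k = toℚ k + toℚ k
  0≤x : 0ℚ ≤ x
  0≤x = ≤-toDiff y≤1
  x≤1 : x ≤ 1ℚ
  x≤1 = a-b≤a 0≤y
  0≤1+xk : 0ℚ ≤ 1ℚ + x ↑ k
  0≤1+xk = 0≤+ 0≤1 (0≤↑ 0≤x k)
  D = 2k + 2k
  half = toℚ k * y
  0≤half : 0ℚ ≤ half
  0≤half = 0≤* (0≤toℚ k) 0≤y
  2half : half + half ≡ 1ℚ
  2half = trans (sym (ℚₚ.*-distribʳ-+ y (toℚ k) (toℚ k))) 2ky≡1
  -- As `y` is 1/(2k), Bernoulli keeps `x ↑ k` above 1/2, so every vector contributes a factor of at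
  -- least 3/2.
  half≤xk : 1ℚ - half ≤ x ↑ k
  half≤xk = bernoulli⁻ 0≤y y≤1 k
  half≤1 : half ≤ 1ℚ
  half≤1 = subst (half ≤_) 2half (a≤a+b 0≤half)
  0≤2-half : 0ℚ ≤ 1ℚ + (1ℚ - half)
  0≤2-half = 0≤+ 0≤1 (≤-toDiff half≤1)
  2≤ : 1ℚ + 1ℚ ≤ (1ℚ + x ↑ k) * (1ℚ + x ↑ k)
  2≤ = ℚₚ.≤-trans (2≤[3/2]² half 2half)
    (*-mono-≤ 0≤2-half 0≤2-half (ℚₚ.+-monoʳ-≤ 1ℚ half≤xk) (ℚₚ.+-monoʳ-≤ 1ℚ half≤xk))
  R = t ℕ.* k
  I = ∑ (interval R) (λ a → x ↑ ℤ.∣ a ∣)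
  0≤D : 0ℚ ≤ D
  0≤D = 0≤+ (0≤+ (0≤toℚ k) (0≤toℚ k)) (0≤+ (0≤toℚ k) (0≤toℚ k))
  I≤D : I ≤ D
  I≤D = ℚₚ.≤-trans (a≤a+b (0≤* 0≤D (0≤↑ 0≤x (suc R))))
    (ℚₚ.≤-trans (ℚₚ.≤-reflexive (interval-weight 2k y 2ky≡1 R)) (a-b≤a 0≤1))
  growth : (1ℚ + x ↑ k) ↑ t ≤ D ↑ n
  growth = begin
    (1ℚ + x ↑ k) ↑ t                        ≤⟨ subsetSums-weight k x 0≤x x≤1 F ‖F‖ ⟩
    ∑ (subsetSums F) (λ z → x ↑ ‖ z ‖)      ≤⟨ ∑-unique-⊆ (subsetSums F) (box n R) (λ z → 0≤↑ 0≤x ‖ z ‖)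
                                                  (subsetSums-unique F ind) (λ {z} z∈ → ∈-box R z (subsetSums-norm k F ‖F‖ z∈)) ⟩
    ∑ (box n R) (λ z → x ↑ ‖ z ‖)           ≡⟨ box-weight x n R ⟩
    I ↑ n                                   ≤⟨ ↑-mono (∑-nonneg (interval R) (λ a → 0≤↑ 0≤x ℤ.∣ a ∣)) I≤D n ⟩
    D ↑ n                                   ∎

independent-length : ∀ {n} k → 1 ℕ.≤ k → (F : List (Vec ℤ n)) → All (λ c → ‖ c ‖ ≡ k) F → Independent F →
  (1ℚ + 1ℚ) ↑ length F ≤ ((toℚ k + toℚ k + (toℚ k + toℚ k)) * (toℚ k + toℚ k + (toℚ k + toℚ k))) ↑ n
independent-length {n} k 1≤k F ‖F‖ ind =
  let y , 2ky≡1 , 0≤y , y≤1 = ∃-inverse (toℚ k + toℚ k) (ℚₚ.≤-trans (1≤toℚ 1≤k) (a≤a+b (0≤toℚ k)))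
  in independent-length-via k F ‖F‖ ind y 2ky≡1 0≤y y≤1

-- Columns

count : ∀ {n} → (Fin n → Bool) → ℕ
count {zero} P = 0
count {suc n} P = (if P zero then 1 else 0) ℕ.+ count (P ∘ suc)

count-cong : ∀ {n} {P Q : Fin n → Bool} → (∀ i → P i ≡ Q i) → count P ≡ count Q
count-cong {zero} e = refl
count-cong {suc n} e = cong₂ (λ b c → (if b then 1 else 0) ℕ.+ c) (e zero) (count-cong (e ∘ suc))

count-false : ∀ n → count {n} (λ _ → false) ≡ 0
count-false zero = refl
count-false (suc n) = count-false n

length-filter-tabulate : ∀ {A : Set} {n} (P : A → Bool) (f : Fin n → A) →
  length (filter (λ u → Data.Bool._≟_ (P u) true) (tabulate f)) ≡ count (P ∘ f)
length-filter-tabulate {n = zero} P f = refl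
length-filter-tabulate {n = suc n} P f with P (f zero)
... | true = cong suc (length-filter-tabulate P (f ∘ suc))
... | false = length-filter-tabulate P (f ∘ suc)

countBelow≡count : ∀ {n} (e : Subset n) v → countBelow e v ≡ count (λ u → lookup e u ∧ (toℕ u <ᵇ toℕ v))
countBelow≡count e v = length-filter-tabulate (λ u → lookup e u ∧ (toℕ u <ᵇ toℕ v)) id

∧-false : ∀ b → b ∧ false ≡ false
∧-false true = refl
∧-false false = refl

countBelow-zero : ∀ {n} (e : Subset (suc n)) → countBelow e zero ≡ 0
countBelow-zero {n} e = trans (countBelow≡count e zero)
  (trans (count-cong (λ u → ∧-false (lookup e u))) (count-false (suc n)))

countBelow-suc : ∀ {n} b (e : Subset n) v → countBelow (b ∷ e) (suc v) ≡ (if b then 1 else 0) ℕ.+ countBelow e v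
countBelow-suc true e v = trans (countBelow≡count (true ∷ e) (suc v)) (cong suc (sym (countBelow≡count e v)))
countBelow-suc false e v = trans (countBelow≡count (false ∷ e) (suc v)) (sym (countBelow≡count e v))

even-suc : ∀ m → even (suc m) ≡ not (even m)
even-suc m with even m
... | true = refl
... | false = refl

-- Each element of the set reverses the signs of all later ones, so the recursion negates the tail.
-- Vectors, unlike functions, have decidable equality, on which `signed?` relies.
col : ∀ {n} → Subset n → Vec ℤ n
col [] = []
col (true ∷ e) = ℤ.1ℤ ∷ Vec.map ℤ.-_ (col e)
col (false ∷ e) = ℤ.0ℤ ∷ col e

column≡col : ∀ {n} (e : Subset n) v → column e v ≡ lookup (col e) v
column≡col (true ∷ e) zero = cong (λ c → if even c then ℤ.1ℤ else ℤ.-1ℤ) (countBelow-zero (true ∷ e))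
column≡col (false ∷ e) zero = refl
column≡col (true ∷ e) (suc v) = begin
  column (true ∷ e) (suc v)
    ≡⟨ cong (λ c → if lookup e v then (if even c then ℤ.1ℤ else ℤ.-1ℤ) else ℤ.0ℤ) (countBelow-suc true e v) ⟩
  (if lookup e v then (if even (suc (countBelow e v)) then ℤ.1ℤ else ℤ.-1ℤ) else ℤ.0ℤ)
    ≡⟨ cong (λ b → if lookup e v then (if b then ℤ.1ℤ else ℤ.-1ℤ) else ℤ.0ℤ) (even-suc (countBelow e v)) ⟩
  (if lookup e v then (if not (even (countBelow e v)) then ℤ.1ℤ else ℤ.-1ℤ) else ℤ.0ℤ)
    ≡⟨ negate (lookup e v) (even (countBelow e v)) ⟩
  ℤ.- column e v
    ≡⟨ cong ℤ.-_ (column≡col e v) ⟩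
  ℤ.- lookup (col e) v
    ≡⟨ Vecₚ.lookup-map v ℤ.-_ (col e) ⟨
  lookup (Vec.map ℤ.-_ (col e)) v ∎
  where
  open ≡-Reasoning
  negate : ∀ a b → (if a then (if not b then ℤ.1ℤ else ℤ.-1ℤ) else ℤ.0ℤ)
                   ≡ ℤ.- (if a then (if b then ℤ.1ℤ else ℤ.-1ℤ) else ℤ.0ℤ)
  negate true true = refl
  negate true false = refl
  negate false b = refl
column≡col (false ∷ e) (suc v) = trans
  (cong (λ c → if lookup e v then (if even c then ℤ.1ℤ else ℤ.-1ℤ) else ℤ.0ℤ) (countBelow-suc false e v))
  (column≡col e v)

‖col‖ : ∀ {n} (e : Subset n) → ‖ col e ‖ ≡ ∣ e ∣
‖col‖ [] = refl
‖col‖ (true ∷ e) = cong suc (trans (‖-‖ (col e)) (‖col‖ e))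
  where
  ‖-‖ : ∀ {n} (z : Vec ℤ n) → ‖ Vec.map ℤ.-_ z ‖ ≡ ‖ z ‖
  ‖-‖ [] = refl
  ‖-‖ (a ∷ z) = cong₂ ℕ._+_ (ℤₚ.∣-i∣≡∣i∣ a) (‖-‖ z)
‖col‖ (false ∷ e) = ‖col‖ e

sumF : ∀ {n} → (Fin n → ℤ) → ℤ
sumF {zero} v = ℤ.0ℤ
sumF {suc n} v = v zero ℤ.+ sumF (v ∘ suc)

sumF-cong : ∀ {n} {v w : Fin n → ℤ} → (∀ i → v i ≡ w i) → sumF v ≡ sumF w
sumF-cong {zero} e = refl
sumF-cong {suc n} e = cong₂ ℤ._+_ (e zero) (sumF-cong (e ∘ suc))

sumF-linear : ∀ {n} (v w : Fin n → ℤ) a → sumF (λ i → v i ℤ.- a ℤ.* w i) ≡ sumF v ℤ.- a ℤ.* sumF w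
sumF-linear {zero} v w a = lemma a
  where
  lemma : ∀ a → ℤ.0ℤ ≡ ℤ.0ℤ ℤ.- a ℤ.* ℤ.0ℤ
  lemma = ℤ-Ring.solve-∀
sumF-linear {suc n} v w a = trans
  (cong (λ t → v zero ℤ.- a ℤ.* w zero ℤ.+ t) (sumF-linear (v ∘ suc) (w ∘ suc) a))
  (lemma (v zero) (w zero) a (sumF (v ∘ suc)) (sumF (w ∘ suc)))
  where
  lemma : ∀ x y a s t → x ℤ.- a ℤ.* y ℤ.+ (s ℤ.- a ℤ.* t) ≡ x ℤ.+ s ℤ.- a ℤ.* (y ℤ.+ t)
  lemma = ℤ-Ring.solve-∀

sumF-neg : ∀ {n} (v : Fin n → ℤ) → sumF (λ i → ℤ.- v i) ≡ ℤ.- sumF v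
sumF-neg {zero} v = refl
sumF-neg {suc n} v = trans (cong (λ t → ℤ.- v zero ℤ.+ t) (sumF-neg (v ∘ suc))) (sym (ℤₚ.neg-distrib-+ (v zero) (sumF (v ∘ suc))))

sumF-* : ∀ {n} d (v : Fin n → ℤ) → sumF (λ i → d ℤ.* v i) ≡ d ℤ.* sumF v
sumF-* {zero} d v = sym (ℤₚ.*-zeroʳ d)
sumF-* {suc n} d v = trans (cong (λ t → d ℤ.* v zero ℤ.+ t) (sumF-* d (v ∘ suc))) (sym (ℤₚ.*-distribˡ-+ d (v zero) (sumF (v ∘ suc))))

sumF-0 : ∀ n → sumF {n} (λ _ → ℤ.0ℤ) ≡ ℤ.0ℤ
sumF-0 zero = refl
sumF-0 (suc n) = trans (ℤₚ.+-identityˡ _) (sumF-0 n)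

-- The common coordinate sum of all columns: 0 for even `k`, 1 for odd `k`. The parity of `k` enters
-- the argument only through this number.
altSum : ℕ → ℤ
altSum zero = ℤ.0ℤ
altSum (suc k) = ℤ.1ℤ ℤ.- altSum k

altSum-01 : ∀ k → altSum k ≡ ℤ.0ℤ ⊎ altSum k ≡ ℤ.1ℤ
altSum-01 zero = inj₁ refl
altSum-01 (suc k) with altSum-01 k
... | inj₁ e = inj₂ (cong (λ t → ℤ.1ℤ ℤ.- t) e)
... | inj₂ e = inj₁ (cong (λ t → ℤ.1ℤ ℤ.- t) e)

sumF-col : ∀ {n} (e : Subset n) → sumF (lookup (col e)) ≡ altSum ∣ e ∣
sumF-col [] = refl
sumF-col (true ∷ e) = cong (λ t → ℤ.1ℤ ℤ.+ t) (trans (sumF-cong (λ v → Vecₚ.lookup-map v ℤ.-_ (col e)))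
  (trans (sumF-neg (lookup (col e))) (cong ℤ.-_ (sumF-col e))))
sumF-col (false ∷ e) = trans (ℤₚ.+-identityˡ _) (sumF-col e)

sumF-column : ∀ {n} (e : Subset n) → sumF (column e) ≡ altSum ∣ e ∣
sumF-column e = trans (sumF-cong (column≡col e)) (sumF-col e)

column-∉ : ∀ {n} (e : Subset n) v → lookup e v ≡ false → column e v ≡ ℤ.0ℤ
column-∉ e v v∉e rewrite v∉e = refl

-- Nonzero entries are units equal to their own inverses; multiplying by such an entry therefore
-- divides by it.
column-∈ : ∀ {n} (e : Subset n) v → lookup e v ≡ true → column e v ℤ.* column e v ≡ ℤ.1ℤ
column-∈ e v v∈e rewrite v∈e with even (countBelow e v)
... | true = refl
... | false = refl

-- The image lattice

InImage-cong : ∀ (cs : List (Fin n → ℤ)) {v w} → (∀ i → v i ≡ w i) → InImage cs v → InImage cs w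
InImage-cong [] v≡w h i = trans (sym (v≡w i)) (h i)
InImage-cong (c ∷ cs) v≡w (a , h) = a , InImage-cong cs (λ i → cong (ℤ._- a ℤ.* c i) (v≡w i)) h

InImage-0 : ∀ (cs : List (Fin n → ℤ)) → InImage cs (λ _ → ℤ.0ℤ)
InImage-0 [] i = refl
InImage-0 (c ∷ cs) = ℤ.0ℤ , InImage-cong cs (λ i → lemma (c i)) (InImage-0 cs)
  where
  lemma : ∀ c → ℤ.0ℤ ≡ ℤ.0ℤ ℤ.- ℤ.0ℤ ℤ.* c
  lemma = ℤ-Ring.solve-∀

InImage-+* : ∀ (cs : List (Fin n → ℤ)) {v w} a → InImage cs v → InImage cs w → InImage cs (λ i → v i ℤ.+ a ℤ.* w i)
InImage-+* [] a hv hw i = trans (cong₂ (λ x y → x ℤ.+ a ℤ.* y) (hv i) (hw i)) (lemma a)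
  where
  lemma : ∀ a → ℤ.0ℤ ℤ.+ a ℤ.* ℤ.0ℤ ≡ ℤ.0ℤ
  lemma = ℤ-Ring.solve-∀
InImage-+* (c ∷ cs) {v} {w} a (b , hv) (b′ , hw) = b ℤ.+ a ℤ.* b′ ,
  InImage-cong cs (λ i → lemma (v i) (w i) (c i) a b b′) (InImage-+* cs a hv hw)
  where
  lemma : ∀ v w c a b b′ → v ℤ.- b ℤ.* c ℤ.+ a ℤ.* (w ℤ.- b′ ℤ.* c) ≡ v ℤ.+ a ℤ.* w ℤ.- (b ℤ.+ a ℤ.* b′) ℤ.* c
  lemma = ℤ-Ring.solve-∀

InImage-generator : ∀ {cs : List (Fin n → ℤ)} {c} → c ∈ cs → InImage cs c
InImage-generator {cs = c ∷ cs} (here refl) = ℤ.1ℤ , InImage-cong cs (λ i → lemma (c i)) (InImage-0 cs)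
  where
  lemma : ∀ c → ℤ.0ℤ ≡ c ℤ.- ℤ.1ℤ ℤ.* c
  lemma = ℤ-Ring.solve-∀
InImage-generator {cs = c′ ∷ cs} {c} (there c∈) = ℤ.0ℤ , InImage-cong cs (λ i → lemma (c i) (c′ i)) (InImage-generator c∈)
  where
  lemma : ∀ c c′ → c ≡ c ℤ.- ℤ.0ℤ ℤ.* c′
  lemma = ℤ-Ring.solve-∀

InImage-from-- : ∀ (cs : List (Fin n → ℤ)) {v w} a → InImage cs w → InImage cs (λ i → v i ℤ.- a ℤ.* w i) → InImage cs v
InImage-from-- cs {v} {w} a hw h = InImage-cong cs (λ i → lemma (v i) (w i) a) (InImage-+* cs a h hw)
  where
  lemma : ∀ v w a → v ℤ.- a ℤ.* w ℤ.+ a ℤ.* w ≡ v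
  lemma = ℤ-Ring.solve-∀

InImage-remove : ∀ (xs : List (Fin n → ℤ)) {c ys v} → InImage (xs ++ c ∷ ys) v →
  ∃ λ a → InImage (xs ++ ys) (λ i → v i ℤ.- a ℤ.* c i)
InImage-remove [] h = h
InImage-remove (x ∷ xs) {c} {ys} {v} (b , h) with InImage-remove xs h
... | a , h′ = a , b , InImage-cong (xs ++ ys) (λ i → lemma (v i) (x i) (c i) a b) h′
  where
  lemma : ∀ v x c a b → v ℤ.- b ℤ.* x ℤ.- a ℤ.* c ≡ v ℤ.- a ℤ.* c ℤ.- b ℤ.* x
  lemma = ℤ-Ring.solve-∀

InImage-zero-row : ∀ (cs : List (Fin n → ℤ)) {v} i → (∀ c → c ∈ cs → c i ≡ ℤ.0ℤ) → InImage cs v → v i ≡ ℤ.0ℤ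
InImage-zero-row [] i z h = h i
InImage-zero-row (c ∷ cs) {v} i z (a , h) = trans (lemma (v i) a)
  (trans (cong (λ t → v i ℤ.- a ℤ.* t) (sym (z c (here refl)))) (InImage-zero-row cs i (λ c c∈ → z c (there c∈)) h))
  where
  lemma : ∀ v a → v ≡ v ℤ.- a ℤ.* ℤ.0ℤ
  lemma = ℤ-Ring.solve-∀

InImage-sum-0 : ∀ (cs : List (Fin n → ℤ)) {v} → (∀ c → c ∈ cs → sumF c ≡ ℤ.0ℤ) → InImage cs v → sumF v ≡ ℤ.0ℤ
InImage-sum-0 {n} [] z h = trans (sumF-cong h) (sumF-0 n)
InImage-sum-0 (c ∷ cs) {v} z (a , h) = trans (lemma (sumF v) a)
  (trans (cong (λ t → sumF v ℤ.- a ℤ.* t) (sym (z c (here refl))))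
  (trans (sym (sumF-linear v c a)) (InImage-sum-0 cs (λ c c∈ → z c (there c∈)) h)))
  where
  lemma : ∀ v a → v ≡ v ℤ.- a ℤ.* ℤ.0ℤ
  lemma = ℤ-Ring.solve-∀

Signed⇒InImage : ∀ (cs : List (Fin n → ℤ)) F → (∀ c → c ∈ F → InImage cs (lookup c)) →
  ∀ {z} → Signed F z → InImage cs (lookup z)
Signed⇒InImage cs [] gen refl = InImage-cong cs (λ i → sym (Vecₚ.lookup-replicate i ℤ.0ℤ)) (InImage-0 cs)
Signed⇒InImage cs (c ∷ F) gen (inj₁ h) = Signed⇒InImage cs F (λ c c∈ → gen c (there c∈)) h
Signed⇒InImage cs (c ∷ F) gen {z} (inj₂ (inj₁ h)) =
  InImage-cong cs (λ i → trans (cong (λ t → t ℤ.+ ℤ.1ℤ ℤ.* lookup c i) (Vecₚ.lookup-zipWith ℤ._-_ i z c)) (lemma (lookup z i) (lookup c i)))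
    (InImage-+* cs ℤ.1ℤ (Signed⇒InImage cs F (λ c c∈ → gen c (there c∈)) h) (gen c (here refl)))
  where
  lemma : ∀ z c → z ℤ.- c ℤ.+ ℤ.1ℤ ℤ.* c ≡ z
  lemma = ℤ-Ring.solve-∀
Signed⇒InImage cs (c ∷ F) gen {z} (inj₂ (inj₂ h)) =
  InImage-cong cs (λ i → trans (cong (λ t → t ℤ.+ ℤ.-1ℤ ℤ.* lookup c i) (Vecₚ.lookup-zipWith ℤ._+_ i z c)) (lemma (lookup z i) (lookup c i)))
    (InImage-+* cs ℤ.-1ℤ (Signed⇒InImage cs F (λ c c∈ → gen c (there c∈)) h) (gen c (here refl)))
  where
  lemma : ∀ z c → z ℤ.+ c ℤ.+ ℤ.-1ℤ ℤ.* c ≡ z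
  lemma = ℤ-Ring.solve-∀

-- Greedy selection of independent edges

spanned? : ∀ {n} (Es : List (Subset n)) (e : Subset n) → Dec (Signed (map col Es) (col e))
spanned? Es e = signed? (map col Es) (col e)

Spanned : ∀ {n} (Es : List (Subset n)) (e : Subset n) → Bool
Spanned Es e = does (spanned? Es e)

-- The selection runs from the end of the list, so each edge is tested against the selected edges
-- behind it, in agreement with the recursion of `Independent`.
greedy : ∀ (l : List (Subset n)) → Vec Bool (length l) → Vec Bool (length l)
greedy [] [] = []
greedy (e ∷ l) (b ∷ H) = (b ∧ not (Spanned (select l (greedy l H)) e)) ∷ greedy l H

greedy-independent : ∀ (l : List (Subset n)) H → Independent (map col (select l (greedy l H)))
greedy-independent [] [] = tt
greedy-independent (e ∷ l) (false ∷ H) = greedy-independent l H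
greedy-independent (e ∷ l) (true ∷ H) with spanned? (select l (greedy l H)) e
... | yes _ = greedy-independent l H
... | no ¬s = ¬s , greedy-independent l H

-- The condition `F ⊆ H ⊆ T`, stated position by position so that for fixed `F` and `T` its
-- indicator is a product over the bits of `H`.
Compatible : ∀ (l : List (Subset n)) → Vec Bool (length l) → Vec Bool (length l) → (Subset n → Bool) → Set
Compatible [] [] [] T = ⊤
Compatible (e ∷ l) (f ∷ F) (b ∷ H) T = (f ≡ true → b ≡ true) × (b ≡ true → T e ≡ true) × Compatible l F H T

Compatible-mono : ∀ (l : List (Subset n)) F H {T T′} → (∀ e → T e ≡ true → T′ e ≡ true) →
  Compatible l F H T → Compatible l F H T′
Compatible-mono [] [] [] T⇒T′ c = tt
Compatible-mono (e ∷ l) (f ∷ F) (b ∷ H) T⇒T′ (p , q , c) = p , (λ h → T⇒T′ e (q h)) , Compatible-mono l F H T⇒T′ c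

does-true : ∀ {P : Set} (d : Dec P) → P → does d ≡ true
does-true (yes _) _ = refl
does-true (no ¬p) p = ⊥-elim (¬p p)

from-does : ∀ {P : Set} (d : Dec P) → does d ≡ true → P
from-does (yes p) _ = p

Spanned-weaken : ∀ (e′ : Subset n) Es e → Spanned Es e ≡ true → Spanned (e′ ∷ Es) e ≡ true
Spanned-weaken e′ Es e h = does-true (spanned? (e′ ∷ Es) e) (inj₁ (from-does (spanned? Es e) h))

-- A rejected edge is spanned by the edges selected so far, an accepted edge is spanned by itself,
-- and further selections only enlarge the span.
greedy-compatible : ∀ (l : List (Subset n)) H → Compatible l (greedy l H) H (Spanned (select l (greedy l H)))
greedy-compatible [] [] = tt
greedy-compatible (e ∷ l) (false ∷ H) = (λ ()) , (λ ()) , greedy-compatible l H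
greedy-compatible (e ∷ l) (true ∷ H) with Spanned (select l (greedy l H)) e in eq
... | true = (λ ()) , (λ _ → eq) , greedy-compatible l H
... | false = (λ _ → refl) ,
  (λ _ → does-true (spanned? (e ∷ select l (greedy l H)) e) (signed-head (col e) (map col (select l (greedy l H))))) ,
  Compatible-mono l (greedy l H) H (Spanned-weaken e (select l (greedy l H))) (greedy-compatible l H)

select-⊆ : ∀ {A : Set} (l : List A) F {x} → x ∈ select l F → x ∈ l
select-⊆ [] [] ()
select-⊆ (y ∷ l) (true ∷ F) (here refl) = here refl
select-⊆ (y ∷ l) (true ∷ F) (there x∈) = there (select-⊆ l F x∈)
select-⊆ (y ∷ l) (false ∷ F) x∈ = there (select-⊆ l F x∈)

select-compatible : ∀ (l : List (Subset n)) F H T → Compatible l F H T → ∀ {x} → x ∈ select l F → x ∈ select l H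
select-compatible [] [] [] T c ()
select-compatible (y ∷ l) (true ∷ F) (b ∷ H) T (p , q , c) x∈ with p refl
select-compatible (y ∷ l) (true ∷ F) (b ∷ H) T (p , q , c) (here refl) | refl = here refl
select-compatible (y ∷ l) (true ∷ F) (b ∷ H) T (p , q , c) (there x∈) | refl = there (select-compatible l F H T c x∈)
select-compatible (y ∷ l) (false ∷ F) (true ∷ H) T (p , q , c) x∈ = there (select-compatible l F H T c x∈)
select-compatible (y ∷ l) (false ∷ F) (false ∷ H) T (p , q , c) x∈ = select-compatible l F H T c x∈

-- Peeling

bit : Bool → ℕ
bit b = if b then 1 else 0

Σᶠ : (Fin n → ℕ) → ℕ
Σᶠ {zero} g = 0
Σᶠ {suc n} g = g zero ℕ.+ Σᶠ (g ∘ suc)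

Σᶠ-mono : ∀ {g h : Fin n → ℕ} → (∀ i → g i ℕ.≤ h i) → Σᶠ g ℕ.≤ Σᶠ h
Σᶠ-mono {zero} e = ℕ.z≤n
Σᶠ-mono {suc n} e = ℕₚ.+-mono-≤ (e zero) (Σᶠ-mono (e ∘ suc))

Σᶠ-cong : ∀ {g h : Fin n → ℕ} → (∀ i → g i ≡ h i) → Σᶠ g ≡ Σᶠ h
Σᶠ-cong {zero} e = refl
Σᶠ-cong {suc n} e = cong₂ ℕ._+_ (e zero) (Σᶠ-cong (e ∘ suc))

ℕ-interchange : ∀ a b c d → a ℕ.+ b ℕ.+ (c ℕ.+ d) ≡ a ℕ.+ c ℕ.+ (b ℕ.+ d)
ℕ-interchange = ℕ-Ring.solve-∀

Σᶠ-+ : ∀ (g h : Fin n → ℕ) → Σᶠ (λ i → g i ℕ.+ h i) ≡ Σᶠ g ℕ.+ Σᶠ h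
Σᶠ-+ {zero} g h = refl
Σᶠ-+ {suc n} g h = trans (cong (g zero ℕ.+ h zero ℕ.+_) (Σᶠ-+ (g ∘ suc) (h ∘ suc)))
  (ℕ-interchange (g zero) (h zero) (Σᶠ (g ∘ suc)) (Σᶠ (h ∘ suc)))

Σᶠ-0 : ∀ n → Σᶠ {n} (λ _ → 0) ≡ 0
Σᶠ-0 zero = refl
Σᶠ-0 (suc n) = Σᶠ-0 n

term≤Σᶠ : ∀ (g : Fin n → ℕ) i → g i ℕ.≤ Σᶠ g
term≤Σᶠ g zero = ℕₚ.m≤m+n _ _
term≤Σᶠ g (suc i) = ℕₚ.≤-trans (term≤Σᶠ (g ∘ suc) i) (ℕₚ.m≤n+m _ (g zero))

Σˡ : List A → (A → ℕ) → ℕ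
Σˡ [] g = 0
Σˡ (x ∷ l) g = g x ℕ.+ Σˡ l g

Σˡ-mono : ∀ (l : List A) {g h} → (∀ x → x ∈ l → g x ℕ.≤ h x) → Σˡ l g ℕ.≤ Σˡ l h
Σˡ-mono [] e = ℕ.z≤n
Σˡ-mono (x ∷ l) e = ℕₚ.+-mono-≤ (e x (here refl)) (Σˡ-mono l (λ y y∈ → e y (there y∈)))

Σˡ-++ : ∀ (l m : List A) g → Σˡ (l ++ m) g ≡ Σˡ l g ℕ.+ Σˡ m g
Σˡ-++ [] m g = refl
Σˡ-++ (x ∷ l) m g = trans (cong (g x ℕ.+_) (Σˡ-++ l m g)) (sym (ℕₚ.+-assoc (g x) (Σˡ l g) (Σˡ m g)))

Σˡ-*2 : ∀ (l : List A) g → Σˡ l (λ x → 2 ℕ.* g x) ≡ 2 ℕ.* Σˡ l g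
Σˡ-*2 [] g = refl
Σˡ-*2 (x ∷ l) g = trans (cong (2 ℕ.* g x ℕ.+_) (Σˡ-*2 l g)) (sym (ℕₚ.*-distribˡ-+ 2 (g x) (Σˡ l g)))

Σˡ-Σᶠ-swap : ∀ (l : List A) (g : A → Fin n → ℕ) → Σˡ l (λ x → Σᶠ (g x)) ≡ Σᶠ (λ i → Σˡ l (λ x → g x i))
Σˡ-Σᶠ-swap {n = n} [] g = sym (Σᶠ-0 n)
Σˡ-Σᶠ-swap (x ∷ l) g = trans (cong (Σᶠ (g x) ℕ.+_) (Σˡ-Σᶠ-swap l g)) (sym (Σᶠ-+ (g x) (λ i → Σˡ l (λ x → g x i))))

bits-unique-Fin : ∀ (P : Fin n → Bool) → Σᶠ (bit ∘ P) ≡ 1 → ∃ λ b → P b ≡ true × (∀ v → P v ≡ true → v ≡ b)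
bits-unique-Fin {suc n} P e with P zero in P0
... | true = zero , P0 , λ { zero _ → refl ; (suc v) Pv → ⊥-elim (none v Pv) }
  where
  none : ∀ v → P (suc v) ≡ true → ⊥
  none v Pv = ℕₚ.<⇒≱ (subst (λ c → 0 ℕ.< bit c) (sym Pv) (ℕ.s≤s ℕ.z≤n))
    (ℕₚ.≤-trans (term≤Σᶠ (bit ∘ P ∘ suc) v) (ℕₚ.≤-reflexive (ℕₚ.suc-injective e)))
... | false with bits-unique-Fin (P ∘ suc) e
...   | b , Pb , unique = suc b , Pb , λ { zero Pv → ⊥-elim (true≢false (trans (sym Pv) P0)) ; (suc v) Pv → cong suc (unique v Pv) }
  where
  true≢false : true ≡ false → ⊥
  true≢false ()

bits-none : ∀ (P : A → Bool) l → Σˡ l (bit ∘ P) ≡ 0 → ∀ x → x ∈ l → P x ≡ false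
bits-none P (y ∷ l) e x x∈ with P y in Py
bits-none P (y ∷ l) e x (here refl) | false = Py
bits-none P (y ∷ l) e x (there x∈) | false = bits-none P l e x x∈

bits-unique-List : ∀ (P : A → Bool) l → Σˡ l (bit ∘ P) ≡ 1 →
  ∃ λ xs → ∃ λ x → ∃ λ ys → l ≡ xs ++ x ∷ ys × P x ≡ true × (∀ y → y ∈ xs ++ ys → P y ≡ false)
bits-unique-List P (y ∷ l) e with P y in Py
... | true = [] , y , l , refl , Py , bits-none P l (ℕₚ.suc-injective e)
... | false with bits-unique-List P l e
...   | xs , x , ys , refl , Px , none = y ∷ xs , x , ys , refl , Px , λ { z (here refl) → Py ; z (there z∈) → none z z∈ }

∣∣≡Σᶠ : ∀ (U : Subset n) → ∣ U ∣ ≡ Σᶠ (bit ∘ lookup U)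
∣∣≡Σᶠ [] = refl
∣∣≡Σᶠ (true ∷ U) = cong suc (∣∣≡Σᶠ U)
∣∣≡Σᶠ (false ∷ U) = ∣∣≡Σᶠ U

meet : Subset n → Subset n → ℕ
meet e U = Σᶠ (λ i → bit (lookup e i ∧ lookup U i))

infix 4 _⊆ᵇ_

_⊆ᵇ_ : Subset n → Subset n → Set
U ⊆ᵇ B = ∀ i → lookup U i ≡ true → lookup B i ≡ true

∧-true : ∀ a b → a ∧ b ≡ true → a ≡ true × b ≡ true
∧-true true true _ = refl , refl

bit-mono : ∀ {a b} → (a ≡ true → b ≡ true) → bit a ℕ.≤ bit b
bit-mono {false} h = ℕ.z≤n
bit-mono {true} {b} h = ℕₚ.≤-reflexive (cong bit (sym (h refl)))

∧-monoʳ : ∀ a {b c} → (b ≡ true → c ≡ true) → a ∧ b ≡ true → a ∧ c ≡ true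
∧-monoʳ true h = h

meet-mono : ∀ (e U V : Subset n) → U ⊆ᵇ V → meet e U ℕ.≤ meet e V
meet-mono e U V U⊆V = Σᶠ-mono (λ i → bit-mono (∧-monoʳ (lookup e i) (U⊆V i)))

meet≤∣∣ : ∀ (e U : Subset n) → meet e U ℕ.≤ ∣ U ∣
meet≤∣∣ e U = subst (meet e U ℕ.≤_) (sym (∣∣≡Σᶠ U))
  (Σᶠ-mono (λ i → bit-mono (λ h → proj₂ (∧-true (lookup e i) (lookup U i) h))))

surplus : List (Subset n) → Subset n → ℕ
surplus Es U = Σˡ Es (λ e → meet e U ∸ 1)

surplus-mono : ∀ (Es : List (Subset n)) U V → U ⊆ᵇ V → surplus Es U ℕ.≤ surplus Es V
surplus-mono Es U V U⊆V = Σˡ-mono Es (λ e _ → ℕₚ.∸-monoˡ-≤ 1 (meet-mono e U V U⊆V))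

-- The edge `e` contributes nothing at `U`, so its whole contribution at `V` is gain, and no other
-- edge loses.
surplus-gain : ∀ (Es : List (Subset n)) U V → U ⊆ᵇ V → ∀ {e} → e ∈ Es → meet e U ≡ 1 →
  surplus Es U ℕ.+ (meet e V ∸ 1) ℕ.≤ surplus Es V
surplus-gain (e ∷ Es) U V U⊆V (here refl) m≡1 rewrite m≡1 =
  subst (ℕ._≤ (meet e V ∸ 1) ℕ.+ surplus Es V) (ℕₚ.+-comm (meet e V ∸ 1) (surplus Es U))
    (ℕₚ.+-monoʳ-≤ (meet e V ∸ 1) (surplus-mono Es U V U⊆V))
surplus-gain (e′ ∷ Es) U V U⊆V {e} (there e∈) m≡1 =
  subst (ℕ._≤ (meet e′ V ∸ 1) ℕ.+ surplus Es V) (sym (ℕₚ.+-assoc (meet e′ U ∸ 1) (surplus Es U) (meet e V ∸ 1)))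
    (ℕₚ.+-mono-≤ (ℕₚ.∸-monoˡ-≤ 1 (meet-mono e′ U V U⊆V)) (surplus-gain Es U V U⊆V e∈ m≡1))

module _ (U e B : Subset n) where

  extension : Subset n
  extension = Vec.tabulate (λ i → lookup U i ∨ (lookup e i ∧ lookup B i))

  extension-lookup : ∀ i → lookup extension i ≡ lookup U i ∨ (lookup e i ∧ lookup B i)
  extension-lookup = Vecₚ.lookup∘tabulate _

  ⊆-extension : U ⊆ᵇ extension
  ⊆-extension i h = trans (extension-lookup i) (cong (_∨ (lookup e i ∧ lookup B i)) h)

  extension-⊆ : U ⊆ᵇ B → extension ⊆ᵇ B
  extension-⊆ U⊆B i h = or (lookup U i) (lookup e i) (lookup B i) (U⊆B i) (trans (sym (extension-lookup i)) h)
    where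
    or : ∀ u e b → (u ≡ true → b ≡ true) → u ∨ (e ∧ b) ≡ true → b ≡ true
    or true e b f _ = f refl
    or false true true f _ = refl

  extension-size : U ⊆ᵇ B → ∣ extension ∣ ℕ.+ meet e U ≡ ∣ U ∣ ℕ.+ meet e B
  extension-size U⊆B = begin
    ∣ extension ∣ ℕ.+ meet e U
      ≡⟨ cong (ℕ._+ meet e U) (∣∣≡Σᶠ extension) ⟩
    Σᶠ (bit ∘ lookup extension) ℕ.+ meet e U
      ≡⟨ Σᶠ-+ (bit ∘ lookup extension) (λ i → bit (lookup e i ∧ lookup U i)) ⟨
    Σᶠ (λ i → bit (lookup extension i) ℕ.+ bit (lookup e i ∧ lookup U i))
      ≡⟨ Σᶠ-cong (λ i → trans (cong (λ b → bit b ℕ.+ bit (lookup e i ∧ lookup U i)) (extension-lookup i))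
                              (inclusion-exclusion (lookup U i) (lookup e i) (lookup B i) (U⊆B i))) ⟩
    Σᶠ (λ i → bit (lookup U i) ℕ.+ bit (lookup e i ∧ lookup B i))
      ≡⟨ Σᶠ-+ (bit ∘ lookup U) (λ i → bit (lookup e i ∧ lookup B i)) ⟩
    Σᶠ (bit ∘ lookup U) ℕ.+ meet e B
      ≡⟨ cong (ℕ._+ meet e B) (∣∣≡Σᶠ U) ⟨
    ∣ U ∣ ℕ.+ meet e B ∎
    where
    open ≡-Reasoning
    inclusion-exclusion : ∀ u e b → (u ≡ true → b ≡ true) → bit (u ∨ (e ∧ b)) ℕ.+ bit (e ∧ u) ≡ bit u ℕ.+ bit (e ∧ b)
    inclusion-exclusion true e b f rewrite f refl with e
    ... | true = refl
    ... | false = refl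
    inclusion-exclusion false true b f = ℕₚ.+-comm (bit b) 0
    inclusion-exclusion false false b f = refl

  meet-extension : U ⊆ᵇ B → meet e extension ≡ meet e B
  meet-extension U⊆B = Σᶠ-cong (λ i → cong bit (trans (cong (lookup e i ∧_) (extension-lookup i))
    (absorb (lookup U i) (lookup e i) (lookup B i) (U⊆B i))))
    where
    absorb : ∀ u e b → (u ≡ true → b ≡ true) → e ∧ (u ∨ (e ∧ b)) ≡ e ∧ b
    absorb u false b f = refl
    absorb true true b f = sym (f refl)
    absorb false true b f = refl

⊆ᵇ-size : ∀ (U B : Subset n) → U ⊆ᵇ B → ∣ U ∣ ℕ.≤ ∣ B ∣
⊆ᵇ-size U B U⊆B = subst₂ ℕ._≤_ (sym (∣∣≡Σᶠ U)) (sym (∣∣≡Σᶠ B)) (Σᶠ-mono (λ i → bit-mono (U⊆B i)))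

≢1⇒2≤ : ∀ {m} → 1 ℕ.≤ m → ¬ m ≡ 1 → 2 ℕ.≤ m
≢1⇒2≤ 1≤m m≢1 = ℕₚ.≤∧≢⇒< 1≤m (m≢1 ∘ sym)

-- Its failure is the event of the second union bound. The first alternative makes failure rare: of
-- the many `k`-sets meeting `U` exactly once, none may be an edge.
Sparse : List (Subset n) → ℕ → Set
Sparse Es β = ∀ U → 1 ℕ.≤ ∣ U ∣ → ∣ U ∣ ℕ.≤ β → Any.Any (λ e → meet e U ≡ 1) Es ⊎ surplus Es U ℕ.< ∣ U ∣

-- Upward induction: an edge meeting U once meets B again, and absorbing its trace on B keeps surplus ≥ size.
surplus-small : ∀ (Es : List (Subset n)) β B → Sparse Es β → ∣ B ∣ ℕ.≤ β → (∀ e → e ∈ Es → ¬ meet e B ≡ 1) →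
  ∀ fuel U → U ⊆ᵇ B → 1 ℕ.≤ ∣ U ∣ → ∣ B ∣ ℕ.≤ ∣ U ∣ ℕ.+ fuel → surplus Es U ℕ.< ∣ U ∣
surplus-small Es β B sparse B≤β noSingle fuel U U⊆B 1≤U enough with sparse U 1≤U (ℕₚ.≤-trans (⊆ᵇ-size U B U⊆B) B≤β)
... | inj₂ small = small
... | inj₁ single with find single
...   | e , e∈Es , m≡1 = step fuel enough
  where
  V = extension U e B
  2≤m : 2 ℕ.≤ meet e B
  2≤m = ≢1⇒2≤ (subst (ℕ._≤ meet e B) m≡1 (meet-mono e U B U⊆B)) (noSingle e e∈Es)
  m′ = meet e B ∸ 1
  size : ∣ V ∣ ≡ ∣ U ∣ ℕ.+ m′
  size = ℕₚ.suc-injective (begin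
    suc ∣ V ∣                 ≡⟨ ℕₚ.+-comm 1 ∣ V ∣ ⟩
    ∣ V ∣ ℕ.+ 1               ≡⟨ cong (∣ V ∣ ℕ.+_) m≡1 ⟨
    ∣ V ∣ ℕ.+ meet e U        ≡⟨ extension-size U e B U⊆B ⟩
    ∣ U ∣ ℕ.+ meet e B        ≡⟨ cong (∣ U ∣ ℕ.+_) (ℕₚ.m+[n∸m]≡n (ℕₚ.≤-trans (ℕ.s≤s ℕ.z≤n) 2≤m)) ⟨
    ∣ U ∣ ℕ.+ suc m′          ≡⟨ ℕₚ.+-suc ∣ U ∣ m′ ⟩
    suc (∣ U ∣ ℕ.+ m′)        ∎)
    where open ≡-Reasoning
  U<V : ∣ U ∣ ℕ.< ∣ V ∣
  U<V = subst (∣ U ∣ ℕ.<_) (sym size) (ℕₚ.m<m+n ∣ U ∣ (ℕₚ.∸-monoˡ-≤ 1 2≤m))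
  V⊆B = extension-⊆ U e B U⊆B
  step : ∀ fuel → ∣ B ∣ ℕ.≤ ∣ U ∣ ℕ.+ fuel → surplus Es U ℕ.< ∣ U ∣
  step zero enough = ⊥-elim (ℕₚ.<⇒≱ U<V (ℕₚ.≤-trans (⊆ᵇ-size V B V⊆B) (subst (∣ B ∣ ℕ.≤_) (ℕₚ.+-identityʳ ∣ U ∣) enough)))
  step (suc fuel) enough = ℕₚ.+-cancelʳ-< m′ (surplus Es U) ∣ U ∣ (ℕₚ.≤-<-trans
    (subst (λ t → surplus Es U ℕ.+ (t ∸ 1) ℕ.≤ surplus Es V) (meet-extension U e B U⊆B)
      (surplus-gain Es U V (⊆-extension U e B) e∈Es m≡1))
    (subst (surplus Es V ℕ.<_) size
      (surplus-small Es β B sparse B≤β noSingle fuel V V⊆B (ℕₚ.≤-trans 1≤U (ℕₚ.<⇒≤ U<V))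
        (ℕₚ.≤-trans (subst (∣ B ∣ ℕ.≤_) (ℕₚ.+-suc ∣ U ∣ fuel) enough) (ℕₚ.+-monoˡ-≤ fuel U<V)))))

-- In terms of the classes x_v: all x_v with v ∉ B are equal, and they vanish if k is odd.
Absorbed : ℕ → List (Fin n → ℤ) → Subset n → Set
Absorbed k cs B = ∀ w → (∀ v → lookup B v ≡ true → w v ≡ ℤ.0ℤ) → (altSum k ≡ ℤ.0ℤ → sumF w ≡ ℤ.0ℤ) → InImage cs w

Uniform : ℕ → List (Subset n) → Set
Uniform k Es = ∀ e → e ∈ Es → ∣ e ∣ ≡ k

remove-size : ∀ (B : Subset n) b → lookup B b ≡ true → ∣ B ∣ ≡ suc ∣ B Vec.[ b ]≔ false ∣
remove-size (true ∷ B) zero refl = refl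
remove-size (true ∷ B) (suc b) h = cong suc (remove-size B b h)
remove-size (false ∷ B) (suc b) h = remove-size B b h

-- A multiple of the column of `e` clears the coordinate at `b`. It touches no other coordinate in
-- `B`, and for even `k` it keeps the coordinate sum at zero because every column has sum zero.
absorb-vertex : ∀ k (Es : List (Subset n)) → Uniform k Es → ∀ B e → e ∈ Es → Absorbed k (map column Es) B →
  ∀ b → lookup e b ∧ lookup B b ≡ true → (∀ v → lookup e v ∧ lookup B v ≡ true → v ≡ b) →
  Absorbed k (map column Es) (B Vec.[ b ]≔ false)
absorb-vertex k Es uniform B e e∈ absorbed b eb unique w support sum0 =
  InImage-from-- (map column Es) a (InImage-generator (∈-map⁺ column e∈)) (absorbed w′ support′ sum0′)
  where
  -- The entry of `e` at `b` is its own inverse, so `a` times the column has entry `w b` there.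
  a = w b ℤ.* column e b
  w′ = λ v → w v ℤ.- a ℤ.* column e v
  b∈e = proj₁ (∧-true _ _ eb)
  at-b : w′ b ≡ ℤ.0ℤ
  at-b = trans (cong (λ t → w b ℤ.- t) (trans (ℤₚ.*-assoc (w b) (column e b) (column e b))
    (trans (cong (λ t → w b ℤ.* t) (column-∈ e b b∈e)) (ℤₚ.*-identityʳ (w b))))) (ℤₚ.+-inverseʳ (w b))
  elsewhere : ∀ v → lookup B v ≡ true → ¬ v ≡ b → w′ v ≡ ℤ.0ℤ
  elsewhere v Bv v≢b = trans (cong₂ (λ s t → s ℤ.- a ℤ.* t)
      (support v (trans (Vecₚ.lookup∘update′ v≢b B false) Bv))
      (column-∉ e v (notIn (lookup e v) refl)))
    (lemma a)
    where
    notIn : ∀ c → lookup e v ≡ c → lookup e v ≡ false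
    notIn true ev = ⊥-elim (v≢b (unique v (subst₂ (λ x y → x ∧ y ≡ true) (sym ev) (sym Bv) refl)))
    notIn false ev = ev
    lemma : ∀ a → ℤ.0ℤ ℤ.- a ℤ.* ℤ.0ℤ ≡ ℤ.0ℤ
    lemma = ℤ-Ring.solve-∀
  support′ : ∀ v → lookup B v ≡ true → w′ v ≡ ℤ.0ℤ
  support′ v Bv with v Data.Fin.≟ b
  ... | yes refl = at-b
  ... | no v≢b = elsewhere v Bv v≢b
  sum0′ : altSum k ≡ ℤ.0ℤ → sumF w′ ≡ ℤ.0ℤ
  sum0′ alt = trans (sumF-linear w (column e) a)
    (trans (cong₂ (λ s t → s ℤ.- a ℤ.* t) (sum0 alt) (trans (sumF-column e) (trans (cong altSum (uniform e e∈)) alt))) (lemma a))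
    where
    lemma : ∀ a → ℤ.0ℤ ℤ.- a ℤ.* ℤ.0ℤ ≡ ℤ.0ℤ
    lemma = ℤ-Ring.solve-∀

absorb-closure : ∀ k (Es : List (Subset n)) → Uniform k Es → ∀ fuel B → ∣ B ∣ ℕ.≤ fuel → Absorbed k (map column Es) B →
  ∃ λ B′ → ∣ B′ ∣ ℕ.≤ ∣ B ∣ × Absorbed k (map column Es) B′ × (∀ e → e ∈ Es → ¬ meet e B′ ≡ 1)
absorb-closure k Es uniform fuel B B≤fuel absorbed with Any.any? (λ e → meet e B ℕ.≟ 1) Es
... | no none = B , ℕₚ.≤-refl , absorbed , λ e e∈ m≡1 → none (Any.map (λ { refl → m≡1 }) e∈)
... | yes some with find some
...   | e , e∈ , m≡1 with bits-unique-Fin (λ i → lookup e i ∧ lookup B i) m≡1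
...     | b , eb , unique = step fuel B≤fuel
  where
  size = remove-size B b (proj₂ (∧-true (lookup e b) (lookup B b) eb))
  step : ∀ fuel → ∣ B ∣ ℕ.≤ fuel → _
  step zero B≤0 = ⊥-elim (ℕₚ.1+n≰n (ℕₚ.≤-trans (ℕₚ.≤-trans (ℕ.s≤s ℕ.z≤n) (ℕₚ.≤-reflexive (sym size))) (ℕₚ.≤-trans B≤0 ℕ.z≤n)))
  step (suc fuel) B≤
    with absorb-closure k Es uniform fuel (B Vec.[ b ]≔ false) (ℕₚ.≤-pred (subst (ℕ._≤ suc fuel) size B≤))
           (absorb-vertex k Es uniform B e e∈ absorbed b eb unique)
  ... | B′ , B′≤ , absorbed′ , noSingle =
    B′ , ℕₚ.≤-trans B′≤ (ℕₚ.≤-trans (ℕₚ.n≤1+n _) (ℕₚ.≤-reflexive (sym size))) , absorbed′ , noSingle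

degree : List (Subset n) → Fin n → ℕ
degree Es b = Σˡ Es (λ e → bit (lookup e b))

meet-0-∉ : ∀ (e B : Subset n) → meet e B ≡ 0 → ∀ v → lookup B v ≡ true → lookup e v ≡ false
meet-0-∉ e B m≡0 v Bv with lookup e v in ev
... | false = refl
... | true = ⊥-elim (ℕₚ.1+n≰n (ℕₚ.≤-trans
  (subst₂ (λ x y → bit (x ∧ y) ℕ.≤ meet e B) ev Bv (term≤Σᶠ (λ i → bit (lookup e i ∧ lookup B i)) v))
  (ℕₚ.≤-reflexive m≡0)))

module _ (Es : List (Subset n)) (B : Subset n) where

  -- Vertices of `B` on no edge are dropped, so that in the absence of leaves every remaining vertex
  -- has degree at least two.
  covered : Subset n
  covered = Vec.tabulate (λ b → lookup B b ∧ (0 <ᵇ degree Es b))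

  covered-lookup : ∀ b → lookup covered b ≡ lookup B b ∧ (0 <ᵇ degree Es b)
  covered-lookup = Vecₚ.lookup∘tabulate _

  covered-⊆ : covered ⊆ᵇ B
  covered-⊆ b h = proj₁ (∧-true (lookup B b) _ (trans (sym (covered-lookup b)) h))

  meet-covered : ∀ {e} → e ∈ Es → meet e B ≡ meet e covered
  meet-covered {e} e∈ = Σᶠ-cong (λ i → cong bit (trans (at i (lookup e i) refl) (cong (lookup e i ∧_) (sym (covered-lookup i)))))
    where
    positive : ∀ {m} → 1 ℕ.≤ m → (0 <ᵇ m) ≡ true
    positive (ℕ.s≤s _) = refl
    term≤Σˡ : ∀ (l : List (Subset n)) i → e ∈ l → bit (lookup e i) ℕ.≤ degree l i
    term≤Σˡ (x ∷ l) i (here refl) = ℕₚ.m≤m+n _ _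
    term≤Σˡ (x ∷ l) i (there e∈l) = ℕₚ.≤-trans (term≤Σˡ l i e∈l) (ℕₚ.m≤n+m _ (bit (lookup x i)))
    ∧-identityʳ : ∀ b → b ≡ b ∧ true
    ∧-identityʳ true = refl
    ∧-identityʳ false = refl
    at : ∀ i c → lookup e i ≡ c → c ∧ lookup B i ≡ c ∧ (lookup B i ∧ (0 <ᵇ degree Es i))
    at i false ei = refl
    at i true ei = trans (∧-identityʳ (lookup B i)) (cong (lookup B i ∧_)
      (sym (positive (subst (λ c → bit c ℕ.≤ degree Es i) ei (term≤Σˡ Es i e∈)))))

  handshake : (∀ b → lookup B b ≡ true → ¬ degree Es b ≡ 1) → 2 ℕ.* ∣ covered ∣ ℕ.≤ Σˡ Es (λ e → meet e covered)
  handshake noLeaf = begin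
    2 ℕ.* ∣ covered ∣                                                ≡⟨ cong (2 ℕ.*_) (∣∣≡Σᶠ covered) ⟩
    2 ℕ.* Σᶠ (bit ∘ lookup covered)                                  ≡⟨ double (Σᶠ (bit ∘ lookup covered)) ⟩
    Σᶠ (bit ∘ lookup covered) ℕ.+ Σᶠ (bit ∘ lookup covered)          ≡⟨ Σᶠ-+ (bit ∘ lookup covered) (bit ∘ lookup covered) ⟨
    Σᶠ (λ i → bit (lookup covered i) ℕ.+ bit (lookup covered i))     ≤⟨ Σᶠ-mono (λ i → at i (lookup covered i) refl) ⟩
    Σᶠ (λ i → Σˡ Es (λ e → bit (lookup e i ∧ lookup covered i)))     ≡⟨ Σˡ-Σᶠ-swap Es (λ e i → bit (lookup e i ∧ lookup covered i)) ⟨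
    Σˡ Es (λ e → meet e covered)                                     ∎
    where
    open ℕₚ.≤-Reasoning
    double : ∀ m → 2 ℕ.* m ≡ m ℕ.+ m
    double = ℕ-Ring.solve-∀
    0<ᵇ : ∀ m → (0 <ᵇ m) ≡ true → 1 ℕ.≤ m
    0<ᵇ (suc m) _ = ℕ.s≤s ℕ.z≤n
    at : ∀ i c → lookup covered i ≡ c → bit c ℕ.+ bit c ℕ.≤ Σˡ Es (λ e → bit (lookup e i ∧ c))
    at i false _ = ℕ.z≤n
    at i true h = ℕₚ.≤-trans
      (≢1⇒2≤ (0<ᵇ (degree Es i) (proj₂ (∧-true (lookup B i) _ (trans (sym (covered-lookup i)) h)))) (noLeaf i (covered-⊆ i h)))
      (Σˡ-mono Es (λ e _ → bit-mono {lookup e i} (λ ei → cong (_∧ true) ei)))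

  -- Double counting. Without leaves the incidences with the covered part of `B` number at least
  -- twice its size; an intersection of size `m ≠ 1` satisfies `m ≤ 2 (m - 1)`, so they number at
  -- most twice the surplus. A nonempty covered part would contradict the smallness of the surplus.
  no-leaf⇒disjoint : (∀ e → e ∈ Es → ¬ meet e B ≡ 1) →
    (∀ U → U ⊆ᵇ B → 1 ℕ.≤ ∣ U ∣ → surplus Es U ℕ.< ∣ U ∣) →
    (∀ b → lookup B b ≡ true → ¬ degree Es b ≡ 1) → ∀ e → e ∈ Es → meet e B ≡ 0
  no-leaf⇒disjoint noSingle small noLeaf e e∈ = ℕₚ.n≤0⇒n≡0
    (subst₂ ℕ._≤_ (sym (meet-covered e∈)) (ℕₚ.n≤0⇒n≡0 (ℕₚ.≮⇒≥ nonempty-impossible)) (meet≤∣∣ e covered))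
    where
    double-surplus : ∀ m → ¬ m ≡ 1 → m ℕ.≤ 2 ℕ.* (m ∸ 1)
    double-surplus zero _ = ℕ.z≤n
    double-surplus (suc zero) m≢1 = ⊥-elim (m≢1 refl)
    double-surplus (suc (suc m)) _ = subst (suc (suc m) ℕ.≤_) (lemma m) (ℕₚ.m≤m+n (suc (suc m)) m)
      where
      lemma : ∀ m → suc (suc m) ℕ.+ m ≡ 2 ℕ.* suc m
      lemma = ℕ-Ring.solve-∀
    nonempty-impossible : ¬ 1 ℕ.≤ ∣ covered ∣
    nonempty-impossible 1≤ = ℕₚ.<⇒≱ (ℕₚ.*-monoʳ-< 2 (small covered covered-⊆ 1≤)) (ℕₚ.≤-trans (handshake noLeaf)
      (ℕₚ.≤-trans (Σˡ-mono Es (λ e e∈ → double-surplus (meet e covered) (noSingle e e∈ ∘ trans (meet-covered e∈))))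
        (ℕₚ.≤-reflexive (Σˡ-*2 Es (λ e → meet e covered ∸ 1)))))

ℤ-cancel-0 : ∀ d {x} → ℤ.+ suc d ℤ.* x ≡ ℤ.0ℤ → x ≡ ℤ.0ℤ
ℤ-cancel-0 d {x} h = ℤₚ.*-cancelˡ-≡ (ℤ.+ suc d) x ℤ.0ℤ (trans h (sym (ℤₚ.*-zeroʳ (ℤ.+ suc d))))

-- At a vertex of degree one the coefficient of its edge is divisible by d, so the edge can be subtracted off;
-- once no edge meets B, what remains is supported off B.
peel : ∀ k (cs : List (Fin n → ℤ)) B → Absorbed k cs B → ∀ d fuel (Es : List (Subset n)) → length Es ℕ.≤ fuel →
  Uniform k Es → (∀ e → e ∈ Es → InImage cs (column e)) → (∀ e → e ∈ Es → ¬ meet e B ≡ 1) →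
  (∀ U → U ⊆ᵇ B → 1 ℕ.≤ ∣ U ∣ → surplus Es U ℕ.< ∣ U ∣) →
  ∀ v → InImage (map column Es) (λ i → ℤ.+ suc d ℤ.* v i) → InImage cs v
peel {n} k cs B absorbed d fuel Es len uniform inCs noSingle small v h
  with any? (λ b → (lookup B b Data.Bool.≟ true) ×-dec (degree Es b ℕ.≟ 1))
... | no noLeaf = absorbed v support sum0
  where
  disjoint = no-leaf⇒disjoint Es B noSingle small (λ b Bb deg≡1 → noLeaf (b , Bb , deg≡1))
  support : ∀ b → lookup B b ≡ true → v b ≡ ℤ.0ℤ
  support b Bb = ℤ-cancel-0 d (InImage-zero-row (map column Es) b zero-entry h)
    where
    zero-entry : ∀ c → c ∈ map column Es → c b ≡ ℤ.0ℤ
    zero-entry c c∈ with ∈-map⁻ column c∈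
    ... | e , e∈ , refl = column-∉ e b (meet-0-∉ e B (disjoint e e∈) b Bb)
  sum0 : altSum k ≡ ℤ.0ℤ → sumF v ≡ ℤ.0ℤ
  sum0 alt = ℤ-cancel-0 d (trans (sym (sumF-* (ℤ.+ suc d) v)) (InImage-sum-0 (map column Es) zero-sum h))
    where
    zero-sum : ∀ c → c ∈ map column Es → sumF c ≡ ℤ.0ℤ
    zero-sum c c∈ with ∈-map⁻ column c∈
    ... | e , e∈ , refl = trans (sumF-column e) (trans (cong altSum (uniform e e∈)) alt)
... | yes (b , Bb , deg≡1) with bits-unique-List (λ e → lookup e b) Es deg≡1
...   | xs , e , ys , refl , eb , none with InImage-remove (map column xs) (subst (λ cs → InImage cs _) (map-++ column xs (e ∷ ys)) h)
...     | a , h′ = step fuel len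
  where
  D = ℤ.+ suc d
  rest = xs ++ ys
  embed : ∀ {x} → x ∈ rest → x ∈ xs ++ e ∷ ys
  embed x∈ with ∈-++⁻ xs x∈
  ... | inj₁ x∈xs = ∈-++⁺ˡ x∈xs
  ... | inj₂ x∈ys = ∈-++⁺ʳ xs (there x∈ys)
  h″ : InImage (map column rest) (λ i → D ℤ.* v i ℤ.- a ℤ.* column e i)
  h″ = subst (λ cs → InImage cs (λ i → D ℤ.* v i ℤ.- a ℤ.* column e i)) (sym (map-++ column xs ys)) h′
  c = column e b
  at-b : D ℤ.* v b ℤ.- a ℤ.* c ≡ ℤ.0ℤ
  at-b = InImage-zero-row (map column rest) b zero-entry h″
    where
    zero-entry : ∀ c → c ∈ map column rest → c b ≡ ℤ.0ℤ
    zero-entry c c∈ with ∈-map⁻ column c∈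
    ... | e′ , e′∈ , refl = column-∉ e′ b (none e′ e′∈)
  q = v b ℤ.* c
  a≡Dq : a ≡ D ℤ.* q
  a≡Dq = begin
    a                                                    ≡⟨ ℤₚ.*-identityʳ a ⟨
    a ℤ.* ℤ.1ℤ                                           ≡⟨ cong (a ℤ.*_) (column-∈ e b eb) ⟨
    a ℤ.* (c ℤ.* c)                                      ≡⟨ lemma a c (D ℤ.* v b) ⟩
    D ℤ.* v b ℤ.* c ℤ.- (D ℤ.* v b ℤ.- a ℤ.* c) ℤ.* c    ≡⟨ cong (λ t → D ℤ.* v b ℤ.* c ℤ.- t ℤ.* c) at-b ⟩
    D ℤ.* v b ℤ.* c ℤ.- ℤ.0ℤ ℤ.* c                       ≡⟨ lemma′ D (v b) c ⟩
    D ℤ.* q                                              ∎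
    where
    open ≡-Reasoning
    lemma : ∀ a c x → a ℤ.* (c ℤ.* c) ≡ x ℤ.* c ℤ.- (x ℤ.- a ℤ.* c) ℤ.* c
    lemma = ℤ-Ring.solve-∀
    lemma′ : ∀ D v c → D ℤ.* v ℤ.* c ℤ.- ℤ.0ℤ ℤ.* c ≡ D ℤ.* (v ℤ.* c)
    lemma′ = ℤ-Ring.solve-∀
  v′ = λ i → v i ℤ.- q ℤ.* column e i
  h‴ : InImage (map column rest) (λ i → D ℤ.* v′ i)
  h‴ = InImage-cong (map column rest) (λ i → trans (cong (λ t → D ℤ.* v i ℤ.- t ℤ.* column e i) a≡Dq) (lemma D (v i) q (column e i))) h″
    where
    lemma : ∀ D v q c → D ℤ.* v ℤ.- D ℤ.* q ℤ.* c ≡ D ℤ.* (v ℤ.- q ℤ.* c)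
    lemma = ℤ-Ring.solve-∀
  surplus-rest : ∀ U → surplus rest U ℕ.≤ surplus (xs ++ e ∷ ys) U
  surplus-rest U = subst₂ ℕ._≤_ (sym (Σˡ-++ xs ys _)) (sym (Σˡ-++ xs (e ∷ ys) _))
    (ℕₚ.+-monoʳ-≤ (surplus xs U) (ℕₚ.m≤n+m (surplus ys U) (meet e U ∸ 1)))
  length-rest : length (xs ++ e ∷ ys) ≡ suc (length rest)
  length-rest = trans (length-++ xs) (trans (ℕₚ.+-suc (length xs) (length ys)) (cong suc (sym (length-++ xs))))
  step : ∀ fuel → length (xs ++ e ∷ ys) ℕ.≤ fuel → InImage cs v
  step zero len = ⊥-elim (ℕₚ.1+n≰n (ℕₚ.≤-trans (subst (1 ℕ.≤_) (sym length-rest) (ℕ.s≤s ℕ.z≤n)) (ℕₚ.≤-trans len ℕ.z≤n)))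
  step (suc fuel) len = InImage-from-- cs q (inCs e (∈-++⁺ʳ xs (here refl)))
    (peel k cs B absorbed d fuel rest (ℕₚ.≤-pred (subst (ℕ._≤ suc fuel) length-rest len))
      (λ e e∈ → uniform e (embed e∈)) (λ e e∈ → inCs e (embed e∈)) (λ e e∈ → noSingle e (embed e∈))
      (λ U U⊆B 1≤U → ℕₚ.≤-<-trans (surplus-rest U) (small U U⊆B 1≤U)) v′ h‴)

torsion-free : ∀ k (Es : List (Subset n)) β B → Uniform k Es → Sparse Es β → ∣ B ∣ ℕ.≤ β →
  Absorbed k (map column Es) B → CokerTorsionFree (map column Es)
torsion-free k Es β B uniform sparse B≤β absorbed v d h with absorb-closure k Es uniform ∣ B ∣ B ℕₚ.≤-refl absorbed
... | B′ , B′≤B , absorbed′ , noSingle = peel k (map column Es) B′ absorbed′ d (length Es) Es ℕₚ.≤-refl uniform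
  (λ e e∈ → InImage-generator (∈-map⁺ column e∈)) noSingle
  (λ U U⊆B′ 1≤U → surplus-small Es β B′ sparse (ℕₚ.≤-trans B′≤B B≤β) noSingle ∣ B′ ∣ U U⊆B′ 1≤U (ℕₚ.m≤n+m ∣ B′ ∣ ∣ U ∣)) v h

-- Counting k-subsets

-- Comparing only the Boolean parts of the decisions lets the size tests before and after prepending
-- a bit agree by computation.
filter-map-does : ∀ {A B : Set} {P : B → Set} {Q : A → Set} (P? : ∀ x → Dec (P x)) (Q? : ∀ x → Dec (Q x)) (f : A → B) →
  (∀ x → does (P? (f x)) ≡ does (Q? x)) → ∀ l → filter P? (map f l) ≡ map f (filter Q? l)
filter-map-does P? Q? f same [] = refl
filter-map-does P? Q? f same (x ∷ l) with does (P? (f x)) | does (Q? x) | same x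
... | true | .true | refl = cong (f x ∷_) (filter-map-does P? Q? f same l)
... | false | .false | refl = filter-map-does P? Q? f same l

kSubsets-suc : ∀ n k → kSubsets (suc n) (suc k) ≡ map (true ∷_) (kSubsets n k) ++ map (false ∷_) (kSubsets n (suc k))
kSubsets-suc n k = trans (filter-++ (λ s → ∣ s ∣ ℕ.≟ suc k) (map (true ∷_) (allVecs n)) (map (false ∷_) (allVecs n)))
  (cong₂ _++_ (filter-map-does (λ s → ∣ s ∣ ℕ.≟ suc k) (λ s → ∣ s ∣ ℕ.≟ k) (true ∷_) (λ _ → refl) (allVecs n))
              (filter-map-does (λ s → ∣ s ∣ ℕ.≟ suc k) (λ s → ∣ s ∣ ℕ.≟ suc k) (false ∷_) (λ _ → refl) (allVecs n)))

kSubsets-zero : ∀ n → kSubsets (suc n) 0 ≡ map (false ∷_) (kSubsets n 0)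
kSubsets-zero n = trans (filter-++ (λ s → ∣ s ∣ ℕ.≟ 0) (map (true ∷_) (allVecs n)) (map (false ∷_) (allVecs n)))
  (cong₂ _++_ (none (allVecs n)) (filter-map-does (λ s → ∣ s ∣ ℕ.≟ 0) (λ s → ∣ s ∣ ℕ.≟ 0) (false ∷_) (λ _ → refl) (allVecs n)))
  where
  none : ∀ (l : List (Subset n)) → filter (λ s → ∣ s ∣ ℕ.≟ 0) (map (true ∷_) l) ≡ []
  none [] = refl
  none (x ∷ l) = none l

∈-kSubsets⇒size : ∀ n k {e} → e ∈ kSubsets n k → ∣ e ∣ ≡ k
∈-kSubsets⇒size n k e∈ = proj₂ (∈-filter⁻ (λ s → ∣ s ∣ ℕ.≟ k) {xs = allVecs n} e∈)

∈-allVecs : ∀ {n} (v : Vec Bool n) → v ∈ allVecs n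
∈-allVecs [] = here refl
∈-allVecs (true ∷ v) = ∈-++⁺ˡ (∈-map⁺ (true ∷_) (∈-allVecs v))
∈-allVecs {suc n} (false ∷ v) = ∈-++⁺ʳ (map (true ∷_) (allVecs n)) (∈-map⁺ (false ∷_) (∈-allVecs v))

∈-kSubsets : ∀ {n} (e : Subset n) → e ∈ kSubsets n ∣ e ∣
∈-kSubsets e = ∈-filter⁺ (λ s → ∣ s ∣ ℕ.≟ ∣ e ∣) (∈-allVecs e) refl

Σˡ-map : ∀ {A B : Set} (f : A → B) l g → Σˡ (map f l) g ≡ Σˡ l (g ∘ f)
Σˡ-map f [] g = refl
Σˡ-map f (x ∷ l) g = cong (g (f x) ℕ.+_) (Σˡ-map f l g)

Σˡ-*ˡ : ∀ (l : List A) c g → Σˡ l (λ x → c ℕ.* g x) ≡ c ℕ.* Σˡ l g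
Σˡ-*ˡ [] c g = sym (ℕₚ.*-zeroʳ c)
Σˡ-*ˡ (x ∷ l) c g = trans (cong (c ℕ.* g x ℕ.+_) (Σˡ-*ˡ l c g)) (sym (ℕₚ.*-distribˡ-+ c (g x) (Σˡ l g)))

Σˡ-0 : ∀ (l : List A) → Σˡ l (λ _ → 0) ≡ 0
Σˡ-0 [] = refl
Σˡ-0 (x ∷ l) = Σˡ-0 l

Σˡ-kSubsets-suc : ∀ n k g → Σˡ (kSubsets (suc n) (suc k)) g
  ≡ Σˡ (kSubsets n k) (g ∘ (true ∷_)) ℕ.+ Σˡ (kSubsets n (suc k)) (g ∘ (false ∷_))
Σˡ-kSubsets-suc n k g = trans (cong (λ l → Σˡ l g) (kSubsets-suc n k))
  (trans (Σˡ-++ (map (true ∷_) (kSubsets n k)) (map (false ∷_) (kSubsets n (suc k))) g)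
  (cong₂ ℕ._+_ (Σˡ-map (true ∷_) (kSubsets n k) g) (Σˡ-map (false ∷_) (kSubsets n (suc k)) g)))

Σˡ-kSubsets-zero : ∀ n g → Σˡ (kSubsets (suc n) 0) g ≡ Σˡ (kSubsets n 0) (g ∘ (false ∷_))
Σˡ-kSubsets-zero n g = trans (cong (λ l → Σˡ l g) (kSubsets-zero n)) (Σˡ-map (false ∷_) (kSubsets n 0) g)

-- Bounds on binomial coefficients.

binom : ℕ → ℕ → ℕ
binom n zero = 1
binom zero (suc k) = 0
binom (suc n) (suc k) = binom n k ℕ.+ binom n (suc k)

length-kSubsets : ∀ n k → length (kSubsets n k) ≡ binom n k
length-kSubsets zero zero = refl
length-kSubsets zero (suc k) = refl
length-kSubsets (suc n) zero = trans (cong length (kSubsets-zero n)) (trans (length-map (false ∷_) (kSubsets n 0)) (length-kSubsets n 0))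
length-kSubsets (suc n) (suc k) = trans (cong length (kSubsets-suc n k))
  (trans (length-++ (map (true ∷_) (kSubsets n k)))
  (cong₂ ℕ._+_ (trans (length-map (true ∷_) (kSubsets n k)) (length-kSubsets n k))
               (trans (length-map (false ∷_) (kSubsets n (suc k))) (length-kSubsets n (suc k)))))

binom-0 : ∀ n → binom n 0 ≡ 1
binom-0 zero = refl
binom-0 (suc n) = refl

binom-sucˡ : ∀ n k → binom n k ℕ.≤ binom (suc n) k
binom-sucˡ n zero = ℕₚ.≤-reflexive (binom-0 n)
binom-sucˡ n (suc k) = ℕₚ.m≤n+m (binom n (suc k)) (binom n k)

binom-+ : ∀ l m k → binom m k ℕ.≤ binom (l ℕ.+ m) k
binom-+ zero m k = ℕₚ.≤-refl
binom-+ (suc l) m k = ℕₚ.≤-trans (binom-+ l m k) (binom-sucˡ (l ℕ.+ m) k)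

binom-mono : ∀ {m n} k → m ℕ.≤ n → binom m k ℕ.≤ binom n k
binom-mono {m} {n} k m≤n = subst (λ t → binom m k ℕ.≤ binom t k) (ℕₚ.m∸n+n≡m m≤n) (binom-+ (n ∸ m) m k)

-- Count only the sets with exactly one of the `l` extra points and `k` of the `m` others.
binom-suc-lower : ∀ l m k → l ℕ.* binom m k ℕ.≤ binom (l ℕ.+ m) (suc k)
binom-suc-lower zero m k = ℕ.z≤n
binom-suc-lower (suc l) m k = ℕₚ.+-mono-≤ (binom-+ l m k) (binom-suc-lower l m k)

-- Split the points into `k` blocks of size `m` and take one point from each.
binom-lower : ∀ m k → m ^ k ℕ.≤ binom (k ℕ.* m) k
binom-lower m zero = ℕₚ.≤-refl
binom-lower m (suc k) = ℕₚ.≤-trans (ℕₚ.*-monoʳ-≤ m (binom-lower m k)) (binom-suc-lower m (k ℕ.* m) k)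

binom-upper : ∀ n k → binom n k ℕ.≤ n ^ k
binom-upper n zero = ℕₚ.≤-reflexive (binom-0 n)
binom-upper zero (suc k) = ℕ.z≤n
binom-upper (suc n) (suc k) = ℕₚ.≤-trans (ℕₚ.+-mono-≤ (binom-upper n k) (binom-upper n (suc k)))
  (ℕₚ.*-monoʳ-≤ (suc n) (ℕₚ.^-monoˡ-≤ k (ℕₚ.n≤1+n n)))

-- The two leading terms of the binomial expansion.
power-increment : ∀ n u → suc u ℕ.* n ^ u ℕ.+ n ^ suc u ℕ.≤ suc n ^ suc u
power-increment n zero = ℕₚ.≤-reflexive (lemma n)
  where
  lemma : ∀ n → 1 ℕ.* 1 ℕ.+ n ℕ.* 1 ≡ suc n ℕ.* 1
  lemma = ℕ-Ring.solve-∀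
power-increment n (suc u) = ℕₚ.≤-trans
  (ℕₚ.m≤m+n (suc (suc u) ℕ.* (n ℕ.* n ^ u) ℕ.+ n ℕ.* (n ℕ.* n ^ u)) (suc u ℕ.* n ^ u))
  (ℕₚ.≤-trans (ℕₚ.≤-reflexive (lemma u n (n ^ u))) (ℕₚ.*-monoʳ-≤ (suc n) (power-increment n u)))
  where
  lemma : ∀ u n p → suc (suc u) ℕ.* (n ℕ.* p) ℕ.+ n ℕ.* (n ℕ.* p) ℕ.+ suc u ℕ.* p ≡ suc n ℕ.* (suc u ℕ.* p ℕ.+ n ℕ.* p)
  lemma = ℕ-Ring.solve-∀

binom-factorial : ∀ n u → binom n u ℕ.* u ! ℕ.≤ n ^ u
binom-factorial n zero = ℕₚ.≤-reflexive (trans (ℕₚ.*-identityʳ _) (binom-0 n))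
binom-factorial zero (suc u) = ℕ.z≤n
binom-factorial (suc n) (suc u) = ℕₚ.≤-trans (ℕₚ.≤-reflexive (lemma u (binom n u) (binom n (suc u)) (u !)))
  (ℕₚ.≤-trans (ℕₚ.+-mono-≤ (ℕₚ.*-monoʳ-≤ (suc u) (binom-factorial n u)) (binom-factorial n (suc u))) (power-increment n u))
  where
  lemma : ∀ u a b f → (a ℕ.+ b) ℕ.* (suc u ℕ.* f) ≡ suc u ℕ.* (a ℕ.* f) ℕ.+ b ℕ.* (suc u ℕ.* f)
  lemma = ℕ-Ring.solve-∀

-- Bernoulli's inequality `(1 - 1/(n+1))^i ≥ 1 - i/(n+1)` cleared of denominators, with
-- `r = n + 1 - i`.
power-ratio : ∀ n i r → i ℕ.+ r ≡ suc n → suc n ^ i ℕ.* r ℕ.≤ n ^ i ℕ.* suc n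
power-ratio n zero r refl = ℕₚ.≤-refl
power-ratio n (suc i) r e = begin
  suc n ℕ.* suc n ^ i ℕ.* r            ≡⟨ lemma (suc n) (suc n ^ i) r ⟩
  suc n ^ i ℕ.* (r ℕ.+ n ℕ.* r)        ≤⟨ ℕₚ.*-monoʳ-≤ (suc n ^ i) (ℕₚ.+-monoˡ-≤ (n ℕ.* r) r≤n) ⟩
  suc n ^ i ℕ.* (n ℕ.+ n ℕ.* r)        ≡⟨ lemma′ (suc n ^ i) n r ⟩
  n ℕ.* (suc n ^ i ℕ.* suc r)          ≤⟨ ℕₚ.*-monoʳ-≤ n (power-ratio n i (suc r) (trans (ℕₚ.+-suc i r) e)) ⟩
  n ℕ.* (n ^ i ℕ.* suc n)              ≡⟨ ℕₚ.*-assoc n (n ^ i) (suc n) ⟨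
  n ℕ.* n ^ i ℕ.* suc n                ∎
  where
  open ℕₚ.≤-Reasoning
  r≤n : r ℕ.≤ n
  r≤n = subst (r ℕ.≤_) (ℕₚ.suc-injective e) (ℕₚ.m≤n+m r i)
  lemma : ∀ s p r → s ℕ.* p ℕ.* r ≡ p ℕ.* (s ℕ.* r)
  lemma = ℕ-Ring.solve-∀
  lemma′ : ∀ p n r → p ℕ.* (n ℕ.+ n ℕ.* r) ≡ n ℕ.* (p ℕ.* suc r)
  lemma′ = ℕ-Ring.solve-∀

power-ratio-2 : ∀ n i r → i ℕ.≤ r → i ℕ.+ r ≡ suc n → suc n ^ i ℕ.≤ 2 ℕ.* n ^ i
power-ratio-2 n zero zero i≤r ()
power-ratio-2 n i (suc r) i≤r e = ℕₚ.*-cancelʳ-≤ (suc n ^ i) (2 ℕ.* n ^ i) (suc r) (begin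
  suc n ^ i ℕ.* suc r          ≤⟨ power-ratio n i (suc r) e ⟩
  n ^ i ℕ.* suc n              ≡⟨ cong (n ^ i ℕ.*_) e ⟨
  n ^ i ℕ.* (i ℕ.+ suc r)      ≤⟨ ℕₚ.*-monoʳ-≤ (n ^ i) (ℕₚ.+-monoˡ-≤ (suc r) i≤r) ⟩
  n ^ i ℕ.* (suc r ℕ.+ suc r)  ≡⟨ lemma (n ^ i) (suc r) ⟩
  2 ℕ.* n ^ i ℕ.* suc r        ∎)
  where
  open ℕₚ.≤-Reasoning
  lemma : ∀ p r → p ℕ.* (r ℕ.+ r) ≡ 2 ℕ.* p ℕ.* r
  lemma = ℕ-Ring.solve-∀

-- (1 + 1/n) ^ n ≤ 4, by squaring (1 + 1/n) ^ (n/2) ≤ 2.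
[1+n]^n≤4n^n : ∀ n → suc n ^ n ℕ.≤ 4 ℕ.* n ^ n
[1+n]^n≤4n^n n = begin
  suc n ^ n                                ≡⟨ split (suc n) ⟩
  suc n ^ a ℕ.* suc n ^ b                  ≤⟨ ℕₚ.*-mono-≤ (power-ratio-2 n a (suc b) (ℕₚ.≤-trans (ℕₚ.⌊n/2⌋≤⌈n/2⌉ n) (ℕₚ.n≤1+n b)) (trans (ℕₚ.+-suc a b) (cong suc a+b)))
                                                             (power-ratio-2 n b (suc a) b≤1+a (trans (ℕₚ.+-suc b a) (cong suc (trans (ℕₚ.+-comm b a) a+b)))) ⟩
  2 ℕ.* n ^ a ℕ.* (2 ℕ.* n ^ b)            ≡⟨ lemma (n ^ a) (n ^ b) ⟩
  4 ℕ.* (n ^ a ℕ.* n ^ b)                  ≡⟨ cong (4 ℕ.*_) (split n) ⟨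
  4 ℕ.* n ^ n                              ∎
  where
  open ℕₚ.≤-Reasoning
  a = ⌊ n /2⌋
  b = ⌈ n /2⌉
  a+b : a ℕ.+ b ≡ n
  a+b = ℕₚ.⌊n/2⌋+⌈n/2⌉≡n n
  b≤1+a : b ℕ.≤ suc a
  b≤1+a = ⌈n/2⌉≤1+⌊n/2⌋ n
    where
    ⌈n/2⌉≤1+⌊n/2⌋ : ∀ n → ⌈ n /2⌉ ℕ.≤ suc ⌊ n /2⌋
    ⌈n/2⌉≤1+⌊n/2⌋ zero = ℕ.z≤n
    ⌈n/2⌉≤1+⌊n/2⌋ (suc zero) = ℕ.s≤s ℕ.z≤n
    ⌈n/2⌉≤1+⌊n/2⌋ (suc (suc n)) = ℕ.s≤s (⌈n/2⌉≤1+⌊n/2⌋ n)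
  split : ∀ x → x ^ n ≡ x ^ a ℕ.* x ^ b
  split x = trans (cong (x ^_) (sym a+b)) (ℕₚ.^-distribˡ-+-* x a b)
  lemma : ∀ p q → 2 ℕ.* p ℕ.* (2 ℕ.* q) ≡ 4 ℕ.* (p ℕ.* q)
  lemma = ℕ-Ring.solve-∀

-- A weak form of Stirling's bound, with 4 in place of e.
n^n≤4^n*n! : ∀ n → n ^ n ℕ.≤ 4 ^ n ℕ.* n !
n^n≤4^n*n! zero = ℕₚ.≤-refl
n^n≤4^n*n! (suc n) = begin
  suc n ℕ.* suc n ^ n                 ≤⟨ ℕₚ.*-monoʳ-≤ (suc n) ([1+n]^n≤4n^n n) ⟩
  suc n ℕ.* (4 ℕ.* n ^ n)             ≤⟨ ℕₚ.*-monoʳ-≤ (suc n) (ℕₚ.*-monoʳ-≤ 4 (n^n≤4^n*n! n)) ⟩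
  suc n ℕ.* (4 ℕ.* (4 ^ n ℕ.* n !))   ≡⟨ lemma (suc n) (4 ^ n) (n !) ⟩
  4 ℕ.* 4 ^ n ℕ.* (suc n ℕ.* n !)     ∎
  where
  open ℕₚ.≤-Reasoning
  lemma : ∀ s p f → s ℕ.* (4 ℕ.* (p ℕ.* f)) ≡ 4 ℕ.* p ℕ.* (s ℕ.* f)
  lemma = ℕ-Ring.solve-∀

*-^ : ∀ a b n → (a ℕ.* b) ^ n ≡ a ^ n ℕ.* b ^ n
*-^ a b zero = refl
*-^ a b (suc n) = trans (cong (a ℕ.* b ℕ.*_) (*-^ a b n)) (lemma a b (a ^ n) (b ^ n))
  where
  lemma : ∀ a b p q → a ℕ.* b ℕ.* (p ℕ.* q) ≡ a ℕ.* p ℕ.* (b ℕ.* q)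
  lemma = ℕ-Ring.solve-∀

-- The usual bound `(e n / u)^u` for the binomial coefficient, with 4 for e and without division.
binom-u^u : ∀ n u → binom n u ℕ.* u ^ u ℕ.≤ (4 ℕ.* n) ^ u
binom-u^u n u = begin
  binom n u ℕ.* u ^ u                 ≤⟨ ℕₚ.*-monoʳ-≤ (binom n u) (n^n≤4^n*n! u) ⟩
  binom n u ℕ.* (4 ^ u ℕ.* u !)       ≡⟨ lemma (binom n u) (4 ^ u) (u !) ⟩
  4 ^ u ℕ.* (binom n u ℕ.* u !)       ≤⟨ ℕₚ.*-monoʳ-≤ (4 ^ u) (binom-factorial n u) ⟩
  4 ^ u ℕ.* n ^ u                     ≡⟨ *-^ 4 n u ⟨
  (4 ℕ.* n) ^ u                       ∎
  where
  open ℕₚ.≤-Reasoning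
  lemma : ∀ b p f → b ℕ.* (p ℕ.* f) ≡ p ℕ.* (b ℕ.* f)
  lemma = ℕ-Ring.solve-∀

-- Subsets meeting a fixed set in a prescribed number of points

co : Subset n → ℕ
co [] = 0
co (true ∷ U) = co U
co (false ∷ U) = suc (co U)

∣∣+co : ∀ (U : Subset n) → ∣ U ∣ ℕ.+ co U ≡ n
∣∣+co [] = refl
∣∣+co (true ∷ U) = cong suc (∣∣+co U)
∣∣+co (false ∷ U) = trans (ℕₚ.+-suc ∣ U ∣ (co U)) (cong suc (∣∣+co U))

meets0 meets1 : ℕ → ℕ
meets0 zero = 1
meets0 (suc m) = 0
meets1 zero = 0
meets1 (suc m) = meets0 m

count-meets0 : ∀ k (U : Subset n) → Σˡ (kSubsets n k) (λ e → meets0 (meet e U)) ≡ binom (co U) k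
count-meets0 zero [] = refl
count-meets0 (suc k) [] = refl
count-meets0 {suc n} zero (b ∷ U) = trans (Σˡ-kSubsets-zero n _) (trans (count-meets0 0 U) (trans (binom-0 (co U)) (sym (binom-0 (co (b ∷ U))))))
count-meets0 {suc n} (suc k) (true ∷ U) = trans (Σˡ-kSubsets-suc n k _)
  (cong₂ ℕ._+_ (Σˡ-0 (kSubsets n k)) (count-meets0 (suc k) U))
count-meets0 {suc n} (suc k) (false ∷ U) = trans (Σˡ-kSubsets-suc n k _)
  (cong₂ ℕ._+_ (count-meets0 k U) (count-meets0 (suc k) U))

count-meets1-0 : ∀ (U : Subset n) → Σˡ (kSubsets n 0) (λ e → meets1 (meet e U)) ≡ 0
count-meets1-0 [] = refl
count-meets1-0 {suc n} (b ∷ U) = trans (Σˡ-kSubsets-zero n _) (count-meets1-0 U)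

count-meets1 : ∀ k (U : Subset n) → Σˡ (kSubsets n (suc k)) (λ e → meets1 (meet e U)) ≡ ∣ U ∣ ℕ.* binom (co U) k
count-meets1 k [] = refl
count-meets1 {suc n} k (true ∷ U) = trans (Σˡ-kSubsets-suc n k _) (cong₂ ℕ._+_ (count-meets0 k U) (count-meets1 k U))
count-meets1 {suc n} zero (false ∷ U) = trans (Σˡ-kSubsets-suc n 0 _)
  (cong₂ ℕ._+_ (count-meets1-0 U) (trans (count-meets1 0 U) (cong (∣ U ∣ ℕ.*_) (binom-0 (co U)))))
count-meets1 {suc n} (suc k) (false ∷ U) = trans (Σˡ-kSubsets-suc n (suc k) _)
  (trans (cong₂ ℕ._+_ (count-meets1 k U) (count-meets1 (suc k) U)) (sym (ℕₚ.*-distribˡ-+ ∣ U ∣ (binom (co U) k) (binom (co U) (suc k)))))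

module _ (s : ℕ) where

  -- The power `s ^ m` cut off below `m = 1` and `m = 2`. A further common point multiplies by `s`
  -- and lowers the cutoff by one, which drives the recursion over the vertices.
  weight≥1 weight≥2 : ℕ → ℕ
  weight≥1 zero = 0
  weight≥1 (suc m) = s ^ suc m
  weight≥2 zero = 0
  weight≥2 (suc m) = s ℕ.* weight≥1 m

  private
    W : Subset n → ℕ
    W {n} U = n ℕ.+ s ℕ.* ∣ U ∣

    W-true : ∀ (U : Subset n) → W (true ∷ U) ≡ suc (s ℕ.+ W U)
    W-true {n} U = lemma n s ∣ U ∣
      where
      lemma : ∀ n s u → suc n ℕ.+ s ℕ.* suc u ≡ suc (s ℕ.+ (n ℕ.+ s ℕ.* u))
      lemma = ℕ-Ring.solve-∀

    W≤ : ∀ b (U : Subset n) → W U ℕ.≤ W (b ∷ U)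
    W≤ true U = subst (W U ℕ.≤_) (sym (W-true U)) (ℕₚ.≤-trans (ℕₚ.m≤n+m (W U) s) (ℕₚ.n≤1+n _))
    W≤ false U = ℕₚ.n≤1+n (W U)

    W^≤ : ∀ b (U : Subset n) k → W U ^ k ℕ.≤ W (b ∷ U) ^ k
    W^≤ b U k = ℕₚ.^-monoˡ-≤ k (W≤ b U)

  -- With weight `s` on the points of `U` and 1 elsewhere, the left side is an elementary symmetric
  -- polynomial, hence at most the `k`-th power of the total weight; `W U` overestimates that total.
  total-weight : ∀ k (U : Subset n) → Σˡ (kSubsets n k) (λ e → s ^ meet e U) ℕ.≤ W U ^ k
  total-weight zero [] = ℕₚ.≤-refl
  total-weight (suc k) [] = ℕ.z≤n
  total-weight {suc n} zero (b ∷ U) = subst (ℕ._≤ 1) (sym (Σˡ-kSubsets-zero n _)) (total-weight 0 U)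
  total-weight {suc n} (suc k) (true ∷ U) = begin
    Σˡ (kSubsets (suc n) (suc k)) (λ e → s ^ meet e (true ∷ U))   ≡⟨ Σˡ-kSubsets-suc n k _ ⟩
    Σˡ (kSubsets n k) (λ e → s ℕ.* s ^ meet e U) ℕ.+ Σˡ (kSubsets n (suc k)) (λ e → s ^ meet e U)
      ≤⟨ ℕₚ.+-mono-≤ (subst (ℕ._≤ s ℕ.* W U ^ k) (sym (Σˡ-*ˡ (kSubsets n k) s _)) (ℕₚ.*-monoʳ-≤ s (total-weight k U))) (total-weight (suc k) U) ⟩
    s ℕ.* W U ^ k ℕ.+ W U ℕ.* W U ^ k                             ≡⟨ ℕₚ.*-distribʳ-+ (W U ^ k) s (W U) ⟨
    (s ℕ.+ W U) ℕ.* W U ^ k                                       ≤⟨ ℕₚ.*-mono-≤ (ℕₚ.≤-trans (ℕₚ.n≤1+n _) (ℕₚ.≤-reflexive (sym (W-true U)))) (W^≤ true U k) ⟩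
    W (true ∷ U) ^ suc k                                          ∎
    where open ℕₚ.≤-Reasoning
  total-weight {suc n} (suc k) (false ∷ U) = begin
    Σˡ (kSubsets (suc n) (suc k)) (λ e → s ^ meet e (false ∷ U))  ≡⟨ Σˡ-kSubsets-suc n k _ ⟩
    Σˡ (kSubsets n k) (λ e → s ^ meet (true ∷ e) (false ∷ U)) ℕ.+ Σˡ (kSubsets n (suc k)) (λ e → s ^ meet e U)
      ≤⟨ ℕₚ.+-mono-≤ (total-weight k U) (total-weight (suc k) U) ⟩
    suc (W U) ℕ.* W U ^ k                                         ≤⟨ ℕₚ.*-monoʳ-≤ (suc (W U)) (W^≤ false U k) ⟩
    W (false ∷ U) ^ suc k                                         ∎
    where open ℕₚ.≤-Reasoning

  total-weight≥1-0 : ∀ (U : Subset n) → Σˡ (kSubsets n 0) (λ e → weight≥1 (meet e U)) ≡ 0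
  total-weight≥1-0 [] = refl
  total-weight≥1-0 {suc n} (b ∷ U) = trans (Σˡ-kSubsets-zero n _) (total-weight≥1-0 U)

  total-weight≥1 : ∀ k (U : Subset n) → Σˡ (kSubsets n (suc k)) (λ e → weight≥1 (meet e U)) ℕ.≤ s ℕ.* ∣ U ∣ ℕ.* W U ^ k
  total-weight≥1 k [] = ℕ.z≤n
  total-weight≥1 {suc n} k (true ∷ U) = begin
    Σˡ (kSubsets (suc n) (suc k)) (λ e → weight≥1 (meet e (true ∷ U)))   ≡⟨ Σˡ-kSubsets-suc n k _ ⟩
    Σˡ (kSubsets n k) (λ e → s ℕ.* s ^ meet e U) ℕ.+ Σˡ (kSubsets n (suc k)) (λ e → weight≥1 (meet e U))
      ≤⟨ ℕₚ.+-mono-≤ (subst (ℕ._≤ s ℕ.* W U ^ k) (sym (Σˡ-*ˡ (kSubsets n k) s _)) (ℕₚ.*-monoʳ-≤ s (total-weight k U))) (total-weight≥1 k U) ⟩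
    s ℕ.* W U ^ k ℕ.+ s ℕ.* ∣ U ∣ ℕ.* W U ^ k                            ≡⟨ lemma s ∣ U ∣ (W U ^ k) ⟩
    s ℕ.* suc ∣ U ∣ ℕ.* W U ^ k                                          ≤⟨ ℕₚ.*-monoʳ-≤ (s ℕ.* suc ∣ U ∣) (W^≤ true U k) ⟩
    s ℕ.* suc ∣ U ∣ ℕ.* W (true ∷ U) ^ k                                 ∎
    where
    open ℕₚ.≤-Reasoning
    lemma : ∀ s u w → s ℕ.* w ℕ.+ s ℕ.* u ℕ.* w ≡ s ℕ.* suc u ℕ.* w
    lemma = ℕ-Ring.solve-∀
  total-weight≥1 {suc n} zero (false ∷ U) = subst (ℕ._≤ s ℕ.* ∣ U ∣ ℕ.* 1) (sym (Σˡ-kSubsets-suc n 0 _))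
    (ℕₚ.+-mono-≤ (ℕₚ.≤-reflexive (total-weight≥1-0 U)) (total-weight≥1 0 U))
  total-weight≥1 {suc n} (suc k) (false ∷ U) = begin
    Σˡ (kSubsets (suc n) (suc (suc k))) (λ e → weight≥1 (meet e (false ∷ U)))   ≡⟨ Σˡ-kSubsets-suc n (suc k) _ ⟩
    Σˡ (kSubsets n (suc k)) (λ e → weight≥1 (meet (true ∷ e) (false ∷ U))) ℕ.+ Σˡ (kSubsets n (suc (suc k))) (λ e → weight≥1 (meet e U))
      ≤⟨ ℕₚ.+-mono-≤ (total-weight≥1 k U) (total-weight≥1 (suc k) U) ⟩
    su ℕ.* W U ^ k ℕ.+ su ℕ.* (W U ℕ.* W U ^ k)                                 ≡⟨ lemma su (W U) (W U ^ k) ⟩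
    su ℕ.* (suc (W U) ℕ.* W U ^ k)                                              ≤⟨ ℕₚ.*-monoʳ-≤ su (ℕₚ.*-monoʳ-≤ (suc (W U)) (W^≤ false U k)) ⟩
    su ℕ.* W (false ∷ U) ^ suc k                                                ∎
    where
    open ℕₚ.≤-Reasoning
    su = s ℕ.* ∣ U ∣
    lemma : ∀ a w p → a ℕ.* p ℕ.+ a ℕ.* (w ℕ.* p) ≡ a ℕ.* (suc w ℕ.* p)
    lemma = ℕ-Ring.solve-∀

  total-weight≥2-0 : ∀ (U : Subset n) → Σˡ (kSubsets n 0) (λ e → weight≥2 (meet e U)) ≡ 0
  total-weight≥2-0 [] = refl
  total-weight≥2-0 {suc n} (b ∷ U) = trans (Σˡ-kSubsets-zero n _) (total-weight≥2-0 U)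

  total-weight≥2-1 : ∀ (U : Subset n) → Σˡ (kSubsets n 1) (λ e → weight≥2 (meet e U)) ≡ 0
  total-weight≥2-1 [] = refl
  total-weight≥2-1 {suc n} (true ∷ U) = trans (Σˡ-kSubsets-suc n 0 _)
    (cong₂ ℕ._+_ (trans (Σˡ-*ˡ (kSubsets n 0) s _) (trans (cong (s ℕ.*_) (total-weight≥1-0 U)) (ℕₚ.*-zeroʳ s))) (total-weight≥2-1 U))
  total-weight≥2-1 {suc n} (false ∷ U) = trans (Σˡ-kSubsets-suc n 0 _) (cong₂ ℕ._+_ (total-weight≥2-0 U) (total-weight≥2-1 U))

  -- Two of the points must lie in `U`, each choice having total weight `s ∣ U ∣`; the remaining `k`
  -- points are unrestricted.
  total-weight≥2 : ∀ k (U : Subset n) → Σˡ (kSubsets n (suc (suc k))) (λ e → weight≥2 (meet e U))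
    ℕ.≤ s ℕ.* ∣ U ∣ ℕ.* (s ℕ.* ∣ U ∣) ℕ.* W U ^ k
  total-weight≥2 k [] = ℕ.z≤n
  total-weight≥2 {suc n} k (true ∷ U) = begin
    Σˡ (kSubsets (suc n) (suc (suc k))) (λ e → weight≥2 (meet e (true ∷ U)))   ≡⟨ Σˡ-kSubsets-suc n (suc k) _ ⟩
    Σˡ (kSubsets n (suc k)) (λ e → s ℕ.* weight≥1 (meet e U)) ℕ.+ Σˡ (kSubsets n (suc (suc k))) (λ e → weight≥2 (meet e U))
      ≤⟨ ℕₚ.+-mono-≤ (subst (ℕ._≤ s ℕ.* (su ℕ.* W U ^ k)) (sym (Σˡ-*ˡ (kSubsets n (suc k)) s _)) (ℕₚ.*-monoʳ-≤ s (total-weight≥1 k U))) (total-weight≥2 k U) ⟩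
    s ℕ.* (su ℕ.* W U ^ k) ℕ.+ su ℕ.* su ℕ.* W U ^ k                           ≤⟨ ℕₚ.m≤m+n _ (s ℕ.* (s ℕ.* suc ∣ U ∣) ℕ.* W U ^ k) ⟩
    s ℕ.* (su ℕ.* W U ^ k) ℕ.+ su ℕ.* su ℕ.* W U ^ k ℕ.+ s ℕ.* (s ℕ.* suc ∣ U ∣) ℕ.* W U ^ k
      ≡⟨ lemma s ∣ U ∣ (W U ^ k) ⟩
    s ℕ.* suc ∣ U ∣ ℕ.* (s ℕ.* suc ∣ U ∣) ℕ.* W U ^ k                          ≤⟨ ℕₚ.*-monoʳ-≤ (s ℕ.* suc ∣ U ∣ ℕ.* (s ℕ.* suc ∣ U ∣)) (W^≤ true U k) ⟩
    s ℕ.* suc ∣ U ∣ ℕ.* (s ℕ.* suc ∣ U ∣) ℕ.* W (true ∷ U) ^ k                 ∎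
    where
    open ℕₚ.≤-Reasoning
    su = s ℕ.* ∣ U ∣
    lemma : ∀ s u w → s ℕ.* (s ℕ.* u ℕ.* w) ℕ.+ s ℕ.* u ℕ.* (s ℕ.* u) ℕ.* w ℕ.+ s ℕ.* (s ℕ.* suc u) ℕ.* w ≡ s ℕ.* suc u ℕ.* (s ℕ.* suc u) ℕ.* w
    lemma = ℕ-Ring.solve-∀
  total-weight≥2 {suc n} zero (false ∷ U) = subst (ℕ._≤ s ℕ.* ∣ U ∣ ℕ.* (s ℕ.* ∣ U ∣) ℕ.* 1) (sym (Σˡ-kSubsets-suc n 1 _))
    (ℕₚ.+-mono-≤ (ℕₚ.≤-reflexive (total-weight≥2-1 U)) (total-weight≥2 0 U))
  total-weight≥2 {suc n} (suc k) (false ∷ U) = begin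
    Σˡ (kSubsets (suc n) (suc (suc (suc k)))) (λ e → weight≥2 (meet e (false ∷ U)))   ≡⟨ Σˡ-kSubsets-suc n (suc (suc k)) _ ⟩
    Σˡ (kSubsets n (suc (suc k))) (λ e → weight≥2 (meet (true ∷ e) (false ∷ U))) ℕ.+ Σˡ (kSubsets n (suc (suc (suc k)))) (λ e → weight≥2 (meet e U))
      ≤⟨ ℕₚ.+-mono-≤ (total-weight≥2 k U) (total-weight≥2 (suc k) U) ⟩
    su² ℕ.* W U ^ k ℕ.+ su² ℕ.* (W U ℕ.* W U ^ k)                               ≡⟨ lemma su² (W U) (W U ^ k) ⟩
    su² ℕ.* (suc (W U) ℕ.* W U ^ k)                                             ≤⟨ ℕₚ.*-monoʳ-≤ su² (ℕₚ.*-monoʳ-≤ (suc (W U)) (W^≤ false U k)) ⟩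
    su² ℕ.* W (false ∷ U) ^ suc k                                               ∎
    where
    open ℕₚ.≤-Reasoning
    su² = s ℕ.* ∣ U ∣ ℕ.* (s ℕ.* ∣ U ∣)
    lemma : ∀ a w p → a ℕ.* p ℕ.+ a ℕ.* (w ℕ.* p) ≡ a ℕ.* (suc w ℕ.* p)
    lemma = ℕ-Ring.solve-∀

-- The first l vertices of Fin (l + m) are low, the other m are high.

falses : ∀ l → Subset m → Subset (l ℕ.+ m)
falses zero S = S
falses (suc l) S = false ∷ falses l S

attach : Fin l → Subset m → Subset (l ℕ.+ m)
attach {suc l} zero S = true ∷ falses l S
attach (suc a) S = false ∷ attach a S

Σˡ-falses : ∀ l m k g → Σˡ (kSubsets m k) (g ∘ falses l) ℕ.≤ Σˡ (kSubsets (l ℕ.+ m) k) g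
Σˡ-falses zero m k g = ℕₚ.≤-refl
Σˡ-falses (suc l) m zero g = ℕₚ.≤-trans (Σˡ-falses l m 0 (g ∘ (false ∷_))) (ℕₚ.≤-reflexive (sym (Σˡ-kSubsets-zero (l ℕ.+ m) g)))
Σˡ-falses (suc l) m (suc k) g = ℕₚ.≤-trans (Σˡ-falses l m (suc k) (g ∘ (false ∷_)))
  (ℕₚ.≤-trans (ℕₚ.m≤n+m _ (Σˡ (kSubsets (l ℕ.+ m) k) (g ∘ (true ∷_)))) (ℕₚ.≤-reflexive (sym (Σˡ-kSubsets-suc (l ℕ.+ m) k g))))

-- The left side keeps just the sets with exactly one low vertex; averaging over their high parts
-- will produce a good `S`.
Σˡ-attach : ∀ l m k g → Σˡ (kSubsets m k) (λ S → Σᶠ {l} (λ a → g (attach a S))) ℕ.≤ Σˡ (kSubsets (l ℕ.+ m) (suc k)) g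
Σˡ-attach zero m k g = subst (ℕ._≤ Σˡ (kSubsets m (suc k)) g) (sym (Σˡ-0 (kSubsets m k))) ℕ.z≤n
Σˡ-attach (suc l) m k g = ℕₚ.≤-trans (ℕₚ.≤-reflexive (Σˡ-+ (kSubsets m k) _ _))
  (ℕₚ.≤-trans (ℕₚ.+-mono-≤ (Σˡ-falses l m k (g ∘ (true ∷_))) (Σˡ-attach l m k (g ∘ (false ∷_))))
  (ℕₚ.≤-reflexive (sym (Σˡ-kSubsets-suc (l ℕ.+ m) k g))))
  where
  Σˡ-+ : ∀ (l : List A) g h → Σˡ l (λ x → g x ℕ.+ h x) ≡ Σˡ l g ℕ.+ Σˡ l h
  Σˡ-+ [] g h = refl
  Σˡ-+ (x ∷ l) g h = trans (cong (g x ℕ.+ h x ℕ.+_) (Σˡ-+ l g h)) (ℕ-interchange (g x) (h x) (Σˡ l g) (Σˡ l h))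

below-average : ∀ (l : List A) g c → Σˡ l g ℕ.< c ℕ.* length l → ∃ λ x → x ∈ l × g x ℕ.< c
below-average [] g c h = ⊥-elim (ℕₚ.1+n≰n (ℕₚ.≤-trans h (subst (ℕ._≤ 0) (sym (ℕₚ.*-zeroʳ c)) ℕ.z≤n)))
below-average (x ∷ l) g c h with g x ℕ.<? c
... | yes gx<c = x , here refl , gx<c
... | no gx≮c with below-average l g c (ℕₚ.+-cancelˡ-< c _ _
        (ℕₚ.≤-<-trans (ℕₚ.+-monoˡ-≤ (Σˡ l g) (ℕₚ.≮⇒≥ gx≮c)) (subst (g x ℕ.+ Σˡ l g ℕ.<_) (ℕₚ.*-suc c (length l)) h)))
...   | y , y∈ , gy<c = y , there y∈ , gy<c

avoids : Subset n → Subset n → Bool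
avoids [] [] = true
avoids (true ∷ e) (b ∷ B) = not b ∧ avoids e B
avoids (false ∷ e) (b ∷ B) = avoids e B

avoids-∉ : ∀ (e B : Subset n) → avoids e B ≡ true → ∀ v → lookup B v ≡ true → lookup e v ≡ false
avoids-∉ (true ∷ e) (true ∷ B) () v Bv
avoids-∉ (true ∷ e) (false ∷ B) h (suc v) Bv = avoids-∉ e B h v Bv
avoids-∉ (false ∷ e) (b ∷ B) h zero Bv = refl
avoids-∉ (false ∷ e) (b ∷ B) h (suc v) Bv = avoids-∉ e B h v Bv

count-avoids : ∀ k (B : Subset n) → Σˡ (kSubsets n k) (λ e → bit (avoids e B)) ≡ binom (co B) k
count-avoids zero [] = refl
count-avoids (suc k) [] = refl
count-avoids {suc n} zero (b ∷ B) = trans (Σˡ-kSubsets-zero n _) (trans (count-avoids 0 B) (trans (binom-0 (co B)) (sym (binom-0 (co (b ∷ B))))))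
count-avoids {suc n} (suc k) (true ∷ B) = trans (Σˡ-kSubsets-suc n k _) (cong₂ ℕ._+_ (Σˡ-0 (kSubsets n k)) (count-avoids (suc k) B))
count-avoids {suc n} (suc k) (false ∷ B) = trans (Σˡ-kSubsets-suc n k _) (cong₂ ℕ._+_ (count-avoids k B) (count-avoids (suc k) B))

common-element : ∀ (l : List A) (P T : A → Bool) → Σˡ l (bit ∘ not ∘ T) ℕ.< Σˡ l (bit ∘ P) →
  ∃ λ x → x ∈ l × P x ≡ true × T x ≡ true
common-element (x ∷ l) P T h with P x in Px | T x in Tx
... | true | true = x , here refl , Px , Tx
... | false | true with common-element l P T h
...   | y , y∈ , Py , Ty = y , there y∈ , Py , Ty
common-element (x ∷ l) P T h | true | false with common-element l P T (ℕₚ.≤-pred h)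
...   | y , y∈ , Py , Ty = y , there y∈ , Py , Ty
common-element (x ∷ l) P T h | false | false with common-element l P T (ℕₚ.≤-trans (ℕₚ.n≤1+n _) h)
...   | y , y∈ , Py , Ty = y , there y∈ , Py , Ty

falses-low : ∀ l (S : Subset m) a → lookup (col (falses l S)) (a ↑ˡ m) ≡ ℤ.0ℤ
falses-low (suc l) S zero = refl
falses-low (suc l) S (suc a) = falses-low l S a

falses-high : ∀ l (S : Subset m) j → lookup (col (falses l S)) (l ↑ʳ j) ≡ lookup (col S) j
falses-high zero S j = refl
falses-high (suc l) S j = falses-high l S j

kronecker : Fin l → Fin l → ℤ
kronecker zero zero = ℤ.1ℤ
kronecker zero (suc b) = ℤ.0ℤ
kronecker (suc a) zero = ℤ.0ℤ
kronecker (suc a) (suc b) = kronecker a b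

col-attach-low : ∀ (S : Subset m) (a b : Fin l) → lookup (col (attach a S)) (b ↑ˡ m) ≡ kronecker a b
col-attach-low {l = suc l} S zero zero = refl
col-attach-low {m} {suc l} S zero (suc b) = trans (Vecₚ.lookup-map (b ↑ˡ m) ℤ.-_ (col (falses l S))) (cong ℤ.-_ (falses-low l S b))
col-attach-low S (suc a) zero = refl
col-attach-low S (suc a) (suc b) = col-attach-low S a b

-- Every low vertex precedes `S`, so the signs on `S` are the same for all `a`, and columns of two
-- attached sets differ only in their low entries.
col-attach-high : ∀ (S : Subset m) (a : Fin l) j → lookup (col (attach a S)) (l ↑ʳ j) ≡ ℤ.- lookup (col S) j
col-attach-high {l = suc l} S zero j = trans (Vecₚ.lookup-map (l ↑ʳ j) ℤ.-_ (col (falses l S))) (cong ℤ.-_ (falses-high l S j))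
col-attach-high S (suc a) j = col-attach-high S a j

sumF-kronecker : ∀ (c : Fin l → ℤ) b → sumF (λ a → c a ℤ.* kronecker a b) ≡ c b
sumF-kronecker {suc l} c zero = trans (cong₂ ℤ._+_ (ℤₚ.*-identityʳ (c zero)) (trans (sumF-cong (λ a → ℤₚ.*-zeroʳ (c (suc a)))) (sumF-0 l))) (ℤₚ.+-identityʳ (c zero))
sumF-kronecker {suc l} c (suc b) = trans (cong₂ ℤ._+_ (ℤₚ.*-zeroʳ (c zero)) (sumF-kronecker (c ∘ suc) b)) (ℤₚ.+-identityˡ (c (suc b)))

sumF-*ʳ : ∀ (c : Fin l → ℤ) t → sumF (λ a → c a ℤ.* t) ≡ sumF c ℤ.* t
sumF-*ʳ c t = trans (sumF-cong (λ a → ℤₚ.*-comm (c a) t)) (trans (sumF-* t c) (ℤₚ.*-comm t (sumF c)))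

split-elim : ∀ l {P : Fin (l ℕ.+ m) → Set} → (∀ a → P (a ↑ˡ m)) → (∀ j → P (l ↑ʳ j)) → ∀ i → P i
split-elim zero low high i = high i
split-elim (suc l) low high zero = low zero
split-elim (suc l) {P} low high (suc i) = split-elim l {P ∘ suc} (low ∘ suc) high i

sumF-split : ∀ l (w : Fin (l ℕ.+ m) → ℤ) → (∀ j → w (l ↑ʳ j) ≡ ℤ.0ℤ) → sumF w ≡ sumF (λ a → w (a ↑ˡ m))
sumF-split {m} zero w high = trans (sumF-cong high) (sumF-0 m)
sumF-split (suc l) w high = cong (λ t → w zero ℤ.+ t) (sumF-split l (w ∘ suc) high)

InImage-combination : ∀ (cs : List (Fin n → ℤ)) (c : Fin l → ℤ) (f : Fin l → Fin n → ℤ) →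
  (∀ a → c a ≡ ℤ.0ℤ ⊎ InImage cs (f a)) → InImage cs (λ i → sumF (λ a → c a ℤ.* f a i))
InImage-combination {l = zero} cs c f h = InImage-0 cs
InImage-combination {l = suc l} cs c f h with h zero | InImage-combination cs (c ∘ suc) (f ∘ suc) (h ∘ suc)
... | inj₁ c0 | rest = InImage-cong cs
  (λ i → sym (trans (cong (λ t → t ℤ.* f zero i ℤ.+ sumF (λ a → c (suc a) ℤ.* f (suc a) i)) c0) (ℤₚ.+-identityˡ _))) rest
... | inj₂ f0 | rest = InImage-cong cs (λ i → ℤₚ.+-comm (sumF (λ a → c (suc a) ℤ.* f (suc a) i)) (c zero ℤ.* f zero i))
  (InImage-+* cs (c zero) rest f0)

-- All high vertices are included as well, because attached sets relate the low vertices to one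
-- fixed sum over `S` and leave single high vertices undetermined.
unattached : (Subset (l ℕ.+ m) → Bool) → Subset m → Subset (l ℕ.+ m)
unattached {l} {m} T S = Vec.tabulate {n = l} (λ a → not (T (attach a S))) Vec.++ replicate m true

unattached-low : ∀ T (S : Subset m) (a : Fin l) → lookup (unattached T S) (a ↑ˡ m) ≡ not (T (attach a S))
unattached-low {m} T S a = trans (Vecₚ.lookup-++ˡ (Vec.tabulate _) (replicate m true) a) (Vecₚ.lookup∘tabulate _ a)

unattached-high : ∀ T (S : Subset m) j → lookup (unattached {l} T S) (l ↑ʳ j) ≡ true
unattached-high {m} {l} T S j = trans (Vecₚ.lookup-++ʳ (Vec.tabulate {n = l} _) (replicate m true) j) (Vecₚ.lookup-replicate j true)

∣unattached∣ : ∀ l m (T : Subset (l ℕ.+ m) → Bool) S → ∣ unattached {l} T S ∣ ≡ Σᶠ {l} (λ a → bit (not (T (attach a S)))) ℕ.+ m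
∣unattached∣ l m T S = ∣++∣ l m (λ a → not (T (attach a S)))
  where
  ∣trues∣ : ∀ m → ∣ replicate m true ∣ ≡ m
  ∣trues∣ zero = refl
  ∣trues∣ (suc m) = cong suc (∣trues∣ m)
  ∣++∣ : ∀ l m (f : Fin l → Bool) → ∣ Vec.tabulate f Vec.++ replicate m true ∣ ≡ Σᶠ (bit ∘ f) ℕ.+ m
  ∣++∣ zero m f = ∣trues∣ m
  ∣++∣ (suc l) m f with f zero
  ... | true = cong suc (∣++∣ l m (f ∘ suc))
  ... | false = ∣++∣ l m (f ∘ suc)

-- The witness is the combination of the columns of `attach a S` with coefficients `w a`: low
-- coordinates come out right one at a time, and on `S` the combination is a multiple of `sumF w`,
-- which vanishes.
InImage-attached : ∀ (cs : List (Fin (l ℕ.+ m) → ℤ)) (T : Subset (l ℕ.+ m) → Bool) S →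
  (∀ e → T e ≡ true → InImage cs (lookup (col e))) → ∀ w →
  (∀ v → lookup (unattached {l} T S) v ≡ true → w v ≡ ℤ.0ℤ) → sumF w ≡ ℤ.0ℤ → InImage cs w
InImage-attached {l} {m} cs T S spans w support sum0 = InImage-cong cs
  (split-elim l low high)
  (InImage-combination cs c (λ a → lookup (col (attach a S))) (λ a → coefficient a (T (attach a S)) refl))
  where
  c : Fin l → ℤ
  c a = w (a ↑ˡ m)
  w-high : ∀ j → w (l ↑ʳ j) ≡ ℤ.0ℤ
  w-high j = support (l ↑ʳ j) (unattached-high {l = l} T S j)
  coefficient : ∀ a b → T (attach a S) ≡ b → c a ≡ ℤ.0ℤ ⊎ InImage cs (lookup (col (attach a S)))
  coefficient a true Ta = inj₂ (spans (attach a S) Ta)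
  coefficient a false Ta = inj₁ (support (a ↑ˡ m) (trans (unattached-low T S a) (cong not Ta)))
  low : ∀ b → sumF (λ a → c a ℤ.* lookup (col (attach a S)) (b ↑ˡ m)) ≡ w (b ↑ˡ m)
  low b = trans (sumF-cong (λ a → cong (λ t → c a ℤ.* t) (col-attach-low S a b))) (sumF-kronecker c b)
  high : ∀ j → sumF (λ a → c a ℤ.* lookup (col (attach a S)) (l ↑ʳ j)) ≡ w (l ↑ʳ j)
  high j = trans (sumF-cong (λ a → cong (λ t → c a ℤ.* t) (col-attach-high S a j)))
    (trans (sumF-*ʳ c (ℤ.- lookup (col S) j))
    (trans (cong (λ t → t ℤ.* (ℤ.- lookup (col S) j)) (trans (sym (sumF-split l w w-high)) sum0)) (sym (w-high j))))

missing : ∀ n k → (Subset n → Bool) → ℕ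
missing n k T = Σˡ (kSubsets n k) (bit ∘ not ∘ T)

few-missing⇒absorbed : ∀ l m k (cs : List (Fin (l ℕ.+ m) → ℤ)) (T : Subset (l ℕ.+ m) → Bool) → 3 ℕ.* m ℕ.≤ l →
  (∀ e → T e ≡ true → InImage cs (lookup (col e))) →
  missing (l ℕ.+ m) (suc k) T ℕ.< m ℕ.* binom m k →
  ∃ λ B → ∣ B ∣ ℕ.≤ m ℕ.+ m × Absorbed (suc k) cs B
few-missing⇒absorbed l m k cs T 3m≤l spans few
  with below-average (kSubsets m k) (λ S → Σᶠ {l} (λ a → bit (not (T (attach a S))))) m
         (ℕₚ.≤-<-trans (Σˡ-attach l m k (bit ∘ not ∘ T)) (subst (λ t → missing (l ℕ.+ m) (suc k) T ℕ.< m ℕ.* t) (sym (length-kSubsets m k)) few))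
... | S , _ , few-a = B , B≤ , absorbed
  where
  B = unattached {l} T S
  B≤ : ∣ B ∣ ℕ.≤ m ℕ.+ m
  B≤ = subst (ℕ._≤ m ℕ.+ m) (sym (∣unattached∣ l m T S)) (ℕₚ.+-monoˡ-≤ m (ℕₚ.<⇒≤ few-a))
  2m≤co : m ℕ.+ m ℕ.≤ co B
  2m≤co = ℕₚ.+-cancelˡ-≤ ∣ B ∣ (m ℕ.+ m) (co B) (begin
    ∣ B ∣ ℕ.+ (m ℕ.+ m)        ≤⟨ ℕₚ.+-monoˡ-≤ (m ℕ.+ m) B≤ ⟩
    m ℕ.+ m ℕ.+ (m ℕ.+ m)      ≡⟨ lemma m ⟩
    3 ℕ.* m ℕ.+ m              ≤⟨ ℕₚ.+-monoˡ-≤ m 3m≤l ⟩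
    l ℕ.+ m                    ≡⟨ ∣∣+co B ⟨
    ∣ B ∣ ℕ.+ co B             ∎)
    where
    open ℕₚ.≤-Reasoning
    lemma : ∀ m → m ℕ.+ m ℕ.+ (m ℕ.+ m) ≡ 3 ℕ.* m ℕ.+ m
    lemma = ℕ-Ring.solve-∀
  -- At least `2 m` vertices lie off `B`, and they carry at least `m * binom m k` sets of size
  -- `k + 1`, more than are missing.
  inside : ∃ λ e → e ∈ kSubsets (l ℕ.+ m) (suc k) × avoids e B ≡ true × T e ≡ true
  inside = common-element (kSubsets (l ℕ.+ m) (suc k)) (λ e → avoids e B) T (ℕₚ.<-≤-trans few
    (ℕₚ.≤-trans (binom-suc-lower m m k) (ℕₚ.≤-trans (binom-mono (suc k) 2m≤co) (ℕₚ.≤-reflexive (sym (count-avoids (suc k) B))))))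
  e₀ = proj₁ inside
  e₀-sum : sumF (lookup (col e₀)) ≡ altSum (suc k)
  e₀-sum = trans (sumF-col e₀) (cong altSum (∈-kSubsets⇒size (l ℕ.+ m) (suc k) (proj₁ (proj₂ inside))))
  absorbed : Absorbed (suc k) cs B
  absorbed w support sum0 with altSum-01 (suc k)
  ... | inj₁ alt = InImage-attached cs T S spans w support (sum0 alt)
  -- For odd uniformity the column of `e₀` has sum 1 and vanishes on `B`, so subtracting it `sumF w`
  -- times reduces to coordinate sum zero.
  ... | inj₂ alt = InImage-from-- cs (sumF w) (spans e₀ (proj₂ (proj₂ (proj₂ inside))))
    (InImage-attached cs T S spans w′ support′ (trans (sumF-linear w (lookup (col e₀)) (sumF w))
      (trans (cong (λ t → sumF w ℤ.- sumF w ℤ.* t) (trans e₀-sum alt)) (lemma (sumF w)))))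
    where
    w′ = λ i → w i ℤ.- sumF w ℤ.* lookup (col e₀) i
    lemma : ∀ s → s ℤ.- s ℤ.* ℤ.1ℤ ≡ ℤ.0ℤ
    lemma = ℤ-Ring.solve-∀
    lemma′ : ∀ s → ℤ.0ℤ ℤ.- s ℤ.* ℤ.0ℤ ≡ ℤ.0ℤ
    lemma′ = ℤ-Ring.solve-∀
    support′ : ∀ v → lookup B v ≡ true → w′ v ≡ ℤ.0ℤ
    support′ v Bv = trans (cong₂ (λ s t → s ℤ.- sumF w ℤ.* t) (support v Bv)
      (trans (sym (column≡col e₀ v)) (column-∉ e₀ v (avoids-∉ e₀ B (proj₁ (proj₂ (proj₂ inside))) v Bv)))) (lemma′ (sumF w))

spanned-InImage : ∀ (cs : List (Fin n → ℤ)) Es → (∀ e → e ∈ Es → InImage cs (column e)) →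
  ∀ e → Spanned Es e ≡ true → InImage cs (lookup (col e))
spanned-InImage cs Es gen e h = Signed⇒InImage cs (map col Es) gen′ (from-does (spanned? Es e) h)
  where
  gen′ : ∀ c → c ∈ map col Es → InImage cs (lookup c)
  gen′ c c∈ with ∈-map⁻ col c∈
  ... | e , e∈ , refl = InImage-cong cs (column≡col e) (gen e e∈)

-- Probability of leaving many sets unspanned

indicator-nonneg : ∀ b → 0ℚ ≤ indicator b
indicator-nonneg true = 0≤1
indicator-nonneg false = ℚₚ.≤-refl

bitProduct-nonneg : ∀ {N} (φs : Vec (Bool → ℚ) N) → (∀ i b → 0ℚ ≤ lookup φs i b) → ∀ H → 0ℚ ≤ bitProduct φs H
bitProduct-nonneg [] _ [] = 0≤1
bitProduct-nonneg (φ ∷ φs) 0≤ (b ∷ H) = 0≤* (0≤ zero b) (bitProduct-nonneg φs (0≤ ∘ suc) H)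

mean-nonneg : ∀ {p} → 0ℚ ≤ p → p ≤ 1ℚ → ∀ φ → (∀ b → 0ℚ ≤ φ b) → 0ℚ ≤ mean p φ
mean-nonneg 0≤p p≤1 φ 0≤φ = 0≤+ (0≤* 0≤p (0≤φ true)) (0≤* (≤-toDiff p≤1) (0≤φ false))

compatibleBit : Bool → Bool → Bool → ℚ
compatibleBit f t b = indicator ((not f ∨ b) ∧ (not b ∨ t))

compatibleBits : ∀ (l : List A) → Vec Bool (length l) → (A → Bool) → Vec (Bool → ℚ) (length l)
compatibleBits [] [] T = []
compatibleBits (e ∷ l) (f ∷ F) T = compatibleBit f (T e) ∷ compatibleBits l F T

compatibleBits-nonneg : ∀ (l : List A) F T i b → 0ℚ ≤ lookup (compatibleBits l F T) i b
compatibleBits-nonneg (e ∷ l) (f ∷ F) T zero b = indicator-nonneg ((not f ∨ b) ∧ (not b ∨ T e))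
compatibleBits-nonneg (e ∷ l) (f ∷ F) T (suc i) b = compatibleBits-nonneg l F T i b

compatible⇒1 : ∀ (l : List (Subset n)) F H T → Compatible l F H T → bitProduct (compatibleBits l F T) H ≡ 1ℚ
compatible⇒1 [] [] [] T c = refl
compatible⇒1 (e ∷ l) (f ∷ F) (b ∷ H) T (p , q , c) = cong₂ _*_ (bit≡1 f (T e) b p q) (compatible⇒1 l F H T c)
  where
  bit≡1 : ∀ f t b → (f ≡ true → b ≡ true) → (b ≡ true → t ≡ true) → compatibleBit f t b ≡ 1ℚ
  bit≡1 true t false p q with p refl
  ... | ()
  bit≡1 f false true p q with q refl
  ... | ()
  bit≡1 true true true p q = refl
  bit≡1 false true true p q = refl
  bit≡1 false t false p q = refl

module _ {p} (0≤p : 0ℚ ≤ p) (p≤1 : p ≤ 1ℚ) where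

  private
    q = 1ℚ - p
    0≤q : 0ℚ ≤ q
    0≤q = ≤-toDiff p≤1

  mean-compatibleBit : ∀ f t → mean p (compatibleBit f t) ≤ p ↑ bit f * q ↑ bit (not t)
  mean-compatibleBit true true = ℚₚ.≤-reflexive (lemma p)
    where
    lemma : ∀ p → p * 1ℚ + (1ℚ - p) * 0ℚ ≡ p * 1ℚ * 1ℚ
    lemma = solve-∀ ringℚ
  mean-compatibleBit true false = subst (_≤ p * 1ℚ * (q * 1ℚ)) (lemma p) (0≤* (0≤* 0≤p 0≤1) (0≤* 0≤q 0≤1))
    where
    lemma : ∀ p → 0ℚ ≡ p * 0ℚ + (1ℚ - p) * 0ℚ
    lemma = solve-∀ ringℚ
  mean-compatibleBit false true = ℚₚ.≤-reflexive (lemma p)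
    where
    lemma : ∀ p → p * 1ℚ + (1ℚ - p) * 1ℚ ≡ 1ℚ * 1ℚ
    lemma = solve-∀ ringℚ
  mean-compatibleBit false false = ℚₚ.≤-reflexive (lemma p)
    where
    lemma : ∀ p → p * 0ℚ + (1ℚ - p) * 1ℚ ≡ 1ℚ * ((1ℚ - p) * 1ℚ)
    lemma = solve-∀ ringℚ

  ∣∷∣ : ∀ f {N} (F : Vec Bool N) → ∣ f ∷ F ∣ ≡ bit f ℕ.+ ∣ F ∣
  ∣∷∣ true F = refl
  ∣∷∣ false F = refl

  -- The product is the probability of `F ⊆ H ⊆ T`: bits of `F` are forced to be true and bits
  -- outside `T` to be false. A position subject to both demands makes it zero.
  ∏-compatibleBits : ∀ (l : List A) F T →
    0ℚ ≤ ∏ (Vec.map (mean p) (compatibleBits l F T)) ×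
    ∏ (Vec.map (mean p) (compatibleBits l F T)) ≤ p ↑ ∣ F ∣ * q ↑ Σˡ l (bit ∘ not ∘ T)
  ∏-compatibleBits [] [] T = 0≤1 , ℚₚ.≤-refl
  ∏-compatibleBits (e ∷ l) (f ∷ F) T =
    let 0≤∏ , ∏≤ = ∏-compatibleBits l F T
        t = T e
        0≤mean = mean-nonneg 0≤p p≤1 (compatibleBit f t) (λ b → indicator-nonneg ((not f ∨ b) ∧ (not b ∨ t)))
    in 0≤* 0≤mean 0≤∏ , (begin
      mean p (compatibleBit f t) * ∏ (Vec.map (mean p) (compatibleBits l F T))
        ≤⟨ *-mono-≤ 0≤mean 0≤∏ (mean-compatibleBit f t) ∏≤ ⟩
      p ↑ bit f * q ↑ bit (not t) * (p ↑ ∣ F ∣ * q ↑ Σˡ l (bit ∘ not ∘ T))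
        ≡⟨ interchange (p ↑ bit f) (q ↑ bit (not t)) (p ↑ ∣ F ∣) (q ↑ Σˡ l (bit ∘ not ∘ T)) ⟩
      p ↑ bit f * p ↑ ∣ F ∣ * (q ↑ bit (not t) * q ↑ Σˡ l (bit ∘ not ∘ T))
        ≡⟨ cong₂ _*_ (trans (sym (↑-+ p (bit f) ∣ F ∣)) (cong (p ↑_) (sym (∣∷∣ f F)))) (sym (↑-+ q (bit (not t)) (Σˡ l (bit ∘ not ∘ T)))) ⟩
      p ↑ ∣ f ∷ F ∣ * q ↑ Σˡ (e ∷ l) (bit ∘ not ∘ T) ∎)
    where
    open ℚₚ.≤-Reasoning
    interchange : ∀ a b c d → a * b * (c * d) ≡ a * c * (b * d)
    interchange = solve-∀ ringℚ

∑-binomial : ∀ x N → ∑ (allVecs N) (λ F → x ↑ ∣ F ∣) ≡ (1ℚ + x) ↑ N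
∑-binomial x zero = refl
∑-binomial x (suc N) = begin
  ∑ (allVecs (suc N)) (λ F → x ↑ ∣ F ∣)                                     ≡⟨ ∑-allVecs-suc N (λ F → x ↑ ∣ F ∣) ⟩
  ∑ (allVecs N) (λ F → x * x ↑ ∣ F ∣) + ∑ (allVecs N) (λ F → x ↑ ∣ F ∣)     ≡⟨ cong (_+ ∑ (allVecs N) (λ F → x ↑ ∣ F ∣)) (∑-*ˡ (allVecs N) x (λ F → x ↑ ∣ F ∣)) ⟩
  x * ∑ (allVecs N) (λ F → x ↑ ∣ F ∣) + ∑ (allVecs N) (λ F → x ↑ ∣ F ∣)     ≡⟨ cong (λ t → x * t + t) (∑-binomial x N) ⟩
  x * (1ℚ + x) ↑ N + (1ℚ + x) ↑ N                                           ≡⟨ lemma x ((1ℚ + x) ↑ N) ⟩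
  (1ℚ + x) * (1ℚ + x) ↑ N                                                   ∎
  where
  open ≡-Reasoning
  lemma : ∀ x a → x * a + a ≡ (1ℚ + x) * a
  lemma = solve-∀ ringℚ

length-select : ∀ (l : List A) F → length (select l F) ≡ ∣ F ∣
length-select [] [] = refl
length-select (x ∷ l) (true ∷ F) = cong suc (length-select l F)
length-select (x ∷ l) (false ∷ F) = length-select l F

-- Union bound over the independent families F that could be selected by the greedy procedure and leave at least Δ
-- sets unspanned.  The factor G * y ^ ∣ F ∣ is at least 1 for every independent F and makes the sum over F converge.
module Stage1 (n k : ℕ) (1≤k : 1 ℕ.≤ k) (Δ h : ℕ) (y : ℚ) (0≤y : 0ℚ ≤ y) (ry≡1 : (1ℚ + 1ℚ) ↑ h * y ≡ 1ℚ) where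

  ks = kSubsets n k

  4k 16k² G : ℚ
  4k = toℚ k + toℚ k + (toℚ k + toℚ k)
  16k² = 4k * 4k
  G = (16k² ↑ n) ↑ h

  0≤16k² : 0ℚ ≤ 16k²
  0≤16k² = 0≤* 0≤4k 0≤4k
    where
    0≤4k : 0ℚ ≤ 4k
    0≤4k = 0≤+ (0≤+ (0≤toℚ k) (0≤toℚ k)) (0≤+ (0≤toℚ k) (0≤toℚ k))

  0≤G : 0ℚ ≤ G
  0≤G = 0≤↑ (0≤↑ 0≤16k² n) h

  spanned : Hypergraph n k → Subset n → Bool
  spanned F = Spanned (select ks F)

  many : Hypergraph n k → Bool
  many F = does (Δ ℕ.≤? missing n k (spanned F))

  coefficient : Hypergraph n k → ℚ
  coefficient F = G * y ↑ ∣ F ∣ * indicator (many F)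

  -- Summing over all families, independent or not, turns the sum of the expectations into a
  -- binomial expansion; independence is used only for the greedy term.
  Z₁ : Hypergraph n k → ℚ
  Z₁ H = ∑ (allVecs (length ks)) (λ F → coefficient F * bitProduct (compatibleBits ks F (spanned F)) H)

  0≤Gy : ∀ (F : Hypergraph n k) → 0ℚ ≤ G * y ↑ ∣ F ∣
  0≤Gy F = 0≤* 0≤G (0≤↑ 0≤y ∣ F ∣)

  0≤coefficient : ∀ F → 0ℚ ≤ coefficient F
  0≤coefficient F = 0≤* (0≤Gy F) (indicator-nonneg (many F))

  0≤term : ∀ H F → 0ℚ ≤ coefficient F * bitProduct (compatibleBits ks F (spanned F)) H
  0≤term H F = 0≤* (0≤coefficient F)
    (bitProduct-nonneg (compatibleBits ks F (spanned F)) (compatibleBits-nonneg ks F (spanned F)) H)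

  0≤Z₁ : ∀ H → 0ℚ ≤ Z₁ H
  0≤Z₁ H = ∑-nonneg (allVecs (length ks)) (0≤term H)

  -- The bound on `2 ^ ∣ F ∣` from `independent-length`, raised to the power `h`, compares
  -- `(2 ^ h) ^ ∣ F ∣` with `G`, and `y` is the reciprocal of `2 ^ h`.
  1≤Gy : ∀ F → Independent (map col (select ks F)) → 1ℚ ≤ G * y ↑ ∣ F ∣
  1≤Gy F ind = begin
    1ℚ                                              ≡⟨ 1↑ ∣ F ∣ ⟨
    1ℚ ↑ ∣ F ∣                                      ≡⟨ cong (_↑ ∣ F ∣) ry≡1 ⟨
    (two ↑ h * y) ↑ ∣ F ∣                           ≡⟨ *-↑ (two ↑ h) y ∣ F ∣ ⟩
    (two ↑ h) ↑ ∣ F ∣ * y ↑ ∣ F ∣                   ≡⟨ cong (_* y ↑ ∣ F ∣) (trans (sym (↑-* two h ∣ F ∣)) (trans (cong (two ↑_) (ℕₚ.*-comm h ∣ F ∣)) (↑-* two ∣ F ∣ h))) ⟩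
    (two ↑ ∣ F ∣) ↑ h * y ↑ ∣ F ∣                   ≤⟨ *-monoʳ-≤ (0≤↑ 0≤y ∣ F ∣) (↑-mono (0≤↑ 0≤two ∣ F ∣) bound h) ⟩
    G * y ↑ ∣ F ∣                                   ∎
    where
    open ℚₚ.≤-Reasoning
    two = 1ℚ + 1ℚ
    0≤two : 0ℚ ≤ two
    0≤two = 0≤+ 0≤1 0≤1
    norms : All (λ c → ‖ c ‖ ≡ k) (map col (select ks F))
    norms = Allₚ.map⁺ (All.tabulate (λ {e} e∈ → trans (‖col‖ e) (∈-kSubsets⇒size n k (select-⊆ ks F e∈))))
    bound : two ↑ ∣ F ∣ ≤ 16k² ↑ n
    bound = subst (λ t → two ↑ t ≤ 16k² ↑ n) (trans (length-map col (select ks F)) (length-select ks F))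
      (independent-length k 1≤k (map col (select ks F)) norms ind)

  Z₁<1⇒few : ∀ H → Z₁ H < 1ℚ → missing n k (spanned (greedy ks H)) ℕ.< Δ
  Z₁<1⇒few H Z₁<1 = ℕₚ.≰⇒> λ Δ≤ → ℚₚ.<-irrefl refl (ℚₚ.≤-<-trans (ℚₚ.≤-trans (1≤term Δ≤) (term≤∑ (allVecs (length ks)) (0≤term H) (∈-allVecs F))) Z₁<1)
    where
    F = greedy ks H
    1≤term : Δ ℕ.≤ missing n k (spanned F) → 1ℚ ≤ coefficient F * bitProduct (compatibleBits ks F (spanned F)) H
    1≤term Δ≤ = subst (1ℚ ≤_)
      (sym (trans (cong₂ (λ b c → G * y ↑ ∣ F ∣ * indicator b * c) (does-true (Δ ℕ.≤? missing n k (spanned F)) Δ≤)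
                    (compatible⇒1 ks F H (spanned F) (greedy-compatible ks H)))
             (lemma (G * y ↑ ∣ F ∣))))
      (1≤Gy F (greedy-independent ks H))
      where
      lemma : ∀ a → a * 1ℚ * 1ℚ ≡ a
      lemma = solve-∀ ringℚ

  E-Z₁ : ∀ {p} → 0ℚ ≤ p → p ≤ 1ℚ → E p Z₁ ≤ G * (1ℚ - p) ↑ Δ * (1ℚ + p * y) ↑ length ks
  E-Z₁ {p} 0≤p p≤1 = begin
    E p Z₁
      ≡⟨ E-∑ p Fs (λ F H → coefficient F * bitProduct (bits F) H) ⟩
    ∑ Fs (λ F → E p (λ H → coefficient F * bitProduct (bits F) H))
      ≡⟨ ∑-cong Fs (λ F → trans (E-*ˡ p (coefficient F) (bitProduct (bits F))) (cong (coefficient F *_) (E-bitProduct p (bits F)))) ⟩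
    ∑ Fs (λ F → coefficient F * ∏ (Vec.map (mean p) (bits F)))
      ≤⟨ ∑-mono Fs (λ F _ → per-family F) ⟩
    ∑ Fs (λ F → G * q ↑ Δ * (p * y) ↑ ∣ F ∣)
      ≡⟨ ∑-*ˡ Fs (G * q ↑ Δ) (λ F → (p * y) ↑ ∣ F ∣) ⟩
    G * q ↑ Δ * ∑ Fs (λ F → (p * y) ↑ ∣ F ∣)
      ≡⟨ cong (G * q ↑ Δ *_) (∑-binomial (p * y) (length ks)) ⟩
    G * q ↑ Δ * (1ℚ + p * y) ↑ length ks ∎
    where
    open ℚₚ.≤-Reasoning
    Fs = allVecs (length ks)
    q = 1ℚ - p
    bits = λ F → compatibleBits ks F (spanned F)
    per-family : ∀ F → coefficient F * ∏ (Vec.map (mean p) (bits F)) ≤ G * q ↑ Δ * (p * y) ↑ ∣ F ∣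
    per-family F = by-cases (Δ ℕ.≤? missing n k (spanned F))
      where
      P = ∏ (Vec.map (mean p) (bits F))
      0≤q↑Δ : 0ℚ ≤ q ↑ Δ
      0≤q↑Δ = 0≤↑ (≤-toDiff p≤1) Δ
      rearrange : ∀ g y c p → g * y * 1ℚ * (p * c) ≡ g * c * (p * y)
      rearrange = solve-∀ ringℚ
      vanish : ∀ a P → 0ℚ ≡ a * 0ℚ * P
      vanish = solve-∀ ringℚ
      by-cases : (d : Dec (Δ ℕ.≤ missing n k (spanned F))) →
        G * y ↑ ∣ F ∣ * indicator (does d) * P ≤ G * q ↑ Δ * (p * y) ↑ ∣ F ∣
      by-cases (yes Δ≤) = begin
        G * y ↑ ∣ F ∣ * 1ℚ * P
          ≤⟨ *-monoˡ-≤ (0≤* (0≤Gy F) 0≤1) (proj₂ (∏-compatibleBits 0≤p p≤1 ks F (spanned F))) ⟩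
        G * y ↑ ∣ F ∣ * 1ℚ * (p ↑ ∣ F ∣ * q ↑ missing n k (spanned F))
          ≤⟨ *-monoˡ-≤ (0≤* (0≤Gy F) 0≤1) (*-monoˡ-≤ (0≤↑ 0≤p ∣ F ∣) (↑-antimono (≤-toDiff p≤1) (a-b≤a 0≤p) Δ≤)) ⟩
        G * y ↑ ∣ F ∣ * 1ℚ * (p ↑ ∣ F ∣ * q ↑ Δ)
          ≡⟨ rearrange G (y ↑ ∣ F ∣) (q ↑ Δ) (p ↑ ∣ F ∣) ⟩
        G * q ↑ Δ * (p ↑ ∣ F ∣ * y ↑ ∣ F ∣)
          ≡⟨ cong (G * q ↑ Δ *_) (*-↑ p y ∣ F ∣) ⟨
        G * q ↑ Δ * (p * y) ↑ ∣ F ∣ ∎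
      by-cases (no _) = subst (_≤ G * q ↑ Δ * (p * y) ↑ ∣ F ∣) (vanish (G * y ↑ ∣ F ∣) P)
        (0≤* (0≤* 0≤G 0≤q↑Δ) (0≤↑ (0≤* 0≤p 0≤y) ∣ F ∣))

-- Probability of a violation of sparsity

-- Equal to `s ^ (m - 1)` for `m ≥ 2` and to 0 otherwise: the factor an edge contributes when it
-- meets `U` in several points.
surplusWeight : ℕ → ℕ → ℕ
surplusWeight s zero = 0
surplusWeight s (suc m) = weight≥1 s m

weight≥2≡ : ∀ s m → weight≥2 s m ≡ s ℕ.* surplusWeight s m
weight≥2≡ s zero = sym (ℕₚ.*-zeroʳ s)
weight≥2≡ s (suc m) = refl

module UnionTerm (s : ℕ) (U : Subset n) where

  -- The zero at intersection size one makes the product over the edges equal to `s ^ surplus` times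
  -- the indicator that no edge meets `U` exactly once.
  edgeFactor : ℕ → ℚ
  edgeFactor zero = 1ℚ
  edgeFactor (suc zero) = 0ℚ
  edgeFactor (suc (suc m)) = toℚ s ↑ suc m

  edgeBit : ℕ → Bool → ℚ
  edgeBit m true = edgeFactor m
  edgeBit m false = 1ℚ

  edgeBits : ∀ (l : List (Subset n)) → Vec (Bool → ℚ) (length l)
  edgeBits [] = []
  edgeBits (e ∷ l) = edgeBit (meet e U) ∷ edgeBits l

  0≤edgeBit : ∀ m b → 0ℚ ≤ edgeBit m b
  0≤edgeBit zero true = 0≤1
  0≤edgeBit (suc zero) true = ℚₚ.≤-refl
  0≤edgeBit (suc (suc m)) true = 0≤↑ (0≤toℚ s) (suc m)
  0≤edgeBit m false = 0≤1

  0≤edgeBits : ∀ l i b → 0ℚ ≤ lookup (edgeBits l) i b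
  0≤edgeBits (e ∷ l) zero b = 0≤edgeBit (meet e U) b
  0≤edgeBits (e ∷ l) (suc i) b = 0≤edgeBits l i b

  edgeBits-surplus : ∀ l H → (∀ e → e ∈ select l H → ¬ meet e U ≡ 1) →
    bitProduct (edgeBits l) H ≡ toℚ s ↑ surplus (select l H) U
  edgeBits-surplus [] [] _ = refl
  edgeBits-surplus (e ∷ l) (false ∷ H) noSingle = trans (ℚₚ.*-identityˡ _) (edgeBits-surplus l H noSingle)
  edgeBits-surplus (e ∷ l) (true ∷ H) noSingle = trans
    (cong₂ _*_ (factor (meet e U) (noSingle e (here refl))) (edgeBits-surplus l H (λ e e∈ → noSingle e (there e∈))))
    (sym (↑-+ (toℚ s) (meet e U ∸ 1) (surplus (select l H) U)))
    where
    factor : ∀ m → ¬ m ≡ 1 → edgeFactor m ≡ toℚ s ↑ (m ∸ 1)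
    factor zero _ = refl
    factor (suc zero) m≢1 = ⊥-elim (m≢1 refl)
    factor (suc (suc m)) _ = refl

  module _ {p} (0≤p : 0ℚ ≤ p) (p≤1 : p ≤ 1ℚ) where

    private
      q = 1ℚ - p
      0≤q : 0ℚ ≤ q
      0≤q = ≤-toDiff p≤1
      x : Subset n → ℕ
      x e = surplusWeight s (meet e U)
      1+px : ℕ → ℚ
      1+px m = 1ℚ + toℚ (surplusWeight s m) * p
      0≤1+px : ∀ m → 0ℚ ≤ 1+px m
      0≤1+px m = 0≤+ 0≤1 (0≤* (0≤toℚ (surplusWeight s m)) 0≤p)

    mean-edgeBit : ∀ m → mean p (edgeBit m) ≤ q ↑ meets1 m * 1+px m
    mean-edgeBit zero = ℚₚ.≤-reflexive (lemma p)
      where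
      lemma : ∀ p → p * 1ℚ + (1ℚ - p) * 1ℚ ≡ 1ℚ * (1ℚ + 0ℚ * p)
      lemma = solve-∀ ringℚ
    mean-edgeBit (suc zero) = ℚₚ.≤-reflexive (lemma p)
      where
      lemma : ∀ p → p * 0ℚ + (1ℚ - p) * 1ℚ ≡ (1ℚ - p) * 1ℚ * (1ℚ + 0ℚ * p)
      lemma = solve-∀ ringℚ
    mean-edgeBit (suc (suc m)) = ≤-fromDiff (subst (0ℚ ≤_)
      (trans (lemma p (toℚ s ↑ suc m)) (cong (λ t → 1ℚ * (1ℚ + t * p) - mean p (edgeBit (suc (suc m)))) (sym (toℚ-^ s (suc m))))) 0≤p)
      where
      lemma : ∀ p a → p ≡ 1ℚ * (1ℚ + a * p) - (p * a + (1ℚ - p) * 1ℚ)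
      lemma = solve-∀ ringℚ

    0≤mean-edgeBit : ∀ m → 0ℚ ≤ mean p (edgeBit m)
    0≤mean-edgeBit m = mean-nonneg 0≤p p≤1 (edgeBit m) (0≤edgeBit m)

    private
      payoff : List (Subset n) → ℚ
      payoff [] = 1ℚ
      payoff (e ∷ l) = 1+px (meet e U) * payoff l

      0≤payoff : ∀ l → 0ℚ ≤ payoff l
      0≤payoff [] = 0≤1
      0≤payoff (e ∷ l) = 0≤* (0≤1+px (meet e U)) (0≤payoff l)

      interchange : ∀ a b c d → a * b * (c * d) ≡ a * c * (b * d)
      interchange = solve-∀ ringℚ

    0≤∏-edgeBits : ∀ l → 0ℚ ≤ ∏ (Vec.map (mean p) (edgeBits l))
    0≤∏-edgeBits [] = 0≤1
    0≤∏-edgeBits (e ∷ l) = 0≤* (0≤mean-edgeBit (meet e U)) (0≤∏-edgeBits l)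

    ∏-edgeBits-payoff : ∀ l → ∏ (Vec.map (mean p) (edgeBits l)) ≤ q ↑ Σˡ l (λ e → meets1 (meet e U)) * payoff l
    ∏-edgeBits-payoff [] = ℚₚ.≤-refl
    ∏-edgeBits-payoff (e ∷ l) = begin
      mean p (edgeBit c) * ∏ (Vec.map (mean p) (edgeBits l))   ≤⟨ *-mono-≤ (0≤mean-edgeBit c) (0≤∏-edgeBits l) (mean-edgeBit c) (∏-edgeBits-payoff l) ⟩
      q ↑ meets1 c * 1+px c * (q ↑ N * payoff l)               ≡⟨ interchange (q ↑ meets1 c) (1+px c) (q ↑ N) (payoff l) ⟩
      q ↑ meets1 c * q ↑ N * (1+px c * payoff l)               ≡⟨ cong (_* (1+px c * payoff l)) (↑-+ q (meets1 c) N) ⟨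
      q ↑ (meets1 c ℕ.+ N) * payoff (e ∷ l)                    ∎
      where
      open ℚₚ.≤-Reasoning
      c = meet e U
      N = Σˡ l (λ e → meets1 (meet e U))

    payoff≤ : ∀ l → payoff l * q ↑ Σˡ l x ≤ 1ℚ
    payoff≤ [] = ℚₚ.≤-refl
    payoff≤ (e ∷ l) = begin
      1+px c * payoff l * q ↑ (x e ℕ.+ X)               ≡⟨ cong (1+px c * payoff l *_) (↑-+ q (x e) X) ⟩
      1+px c * payoff l * (q ↑ x e * q ↑ X)             ≡⟨ interchange (1+px c) (payoff l) (q ↑ x e) (q ↑ X) ⟩
      1+px c * q ↑ x e * (payoff l * q ↑ X)             ≤⟨ *≤1 (0≤* (0≤1+px c) (0≤↑ 0≤q (x e))) (0≤* (0≤payoff l) (0≤↑ 0≤q X))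
                                                              ([1+nx][1-x]^n≤1 0≤p p≤1 (x e)) (payoff≤ l) ⟩
      1ℚ                                                ∎
      where
      open ℚₚ.≤-Reasoning
      c = meet e U
      X = Σˡ l x

    -- An edge meeting U in several points is paid for by x e of the factors q contributed by the sets meeting U once.
    ∏-edgeBits : ∀ l Y → Σˡ l x ℕ.+ Y ℕ.≤ Σˡ l (λ e → meets1 (meet e U)) → ∏ (Vec.map (mean p) (edgeBits l)) ≤ q ↑ Y
    ∏-edgeBits l Y enough = begin
      ∏ (Vec.map (mean p) (edgeBits l))                  ≤⟨ ∏-edgeBits-payoff l ⟩
      q ↑ Σˡ l (λ e → meets1 (meet e U)) * payoff l      ≤⟨ *-monoʳ-≤ (0≤payoff l) (↑-antimono 0≤q (a-b≤a 0≤p) enough) ⟩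
      q ↑ (X ℕ.+ Y) * payoff l                           ≡⟨ cong (_* payoff l) (↑-+ q X Y) ⟩
      q ↑ X * q ↑ Y * payoff l                           ≡⟨ rotate (q ↑ X) (q ↑ Y) (payoff l) ⟩
      payoff l * q ↑ X * q ↑ Y                           ≤⟨ ≤1*⇒≤ (0≤↑ 0≤q Y) (payoff≤ l) ⟩
      q ↑ Y                                              ∎
      where
      open ℚₚ.≤-Reasoning
      X = Σˡ l x
      rotate : ∀ a b c → a * b * c ≡ c * a * b
      rotate = solve-∀ ringℚ

-- The induction carries twice the next power on the left, which `x + x ≤ 1` allows to be absorbed
-- at each step.
geometric : ∀ {x} → 0ℚ ≤ x → x + x ≤ 1ℚ → ∀ β → ∑ (downFrom β) (λ u → x ↑ suc u) ≤ x + x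
geometric {x} 0≤x 2x≤1 β = ℚₚ.≤-trans (a≤a+b (0≤+ (0≤↑ 0≤x (suc β)) (0≤↑ 0≤x (suc β)))) (partial β)
  where
  open ℚₚ.≤-Reasoning
  partial : ∀ β → ∑ (downFrom β) (λ u → x ↑ suc u) + (x ↑ suc β + x ↑ suc β) ≤ x + x
  partial zero = ℚₚ.≤-reflexive (lemma x)
    where
    lemma : ∀ x → 0ℚ + (x * 1ℚ + x * 1ℚ) ≡ x + x
    lemma = solve-∀ ringℚ
  partial (suc β) = begin
    a + S + (x * a + x * a)     ≡⟨ lemma a S x ⟩
    a + S + (x + x) * a         ≤⟨ ℚₚ.+-monoʳ-≤ (a + S) (≤1*⇒≤ (0≤↑ 0≤x (suc β)) 2x≤1) ⟩
    a + S + a                   ≡⟨ lemma′ a S ⟩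
    S + (a + a)                 ≤⟨ partial β ⟩
    x + x                       ∎
    where
    a = x ↑ suc β
    S = ∑ (downFrom β) (λ u → x ↑ suc u)
    lemma : ∀ a S x → a + S + (x * a + x * a) ≡ a + S + (x + x) * a
    lemma = solve-∀ ringℚ
    lemma′ : ∀ a S → a + S + a ≡ S + (a + a)
    lemma′ = solve-∀ ringℚ

-- Union bound over the vertex sets U of size u = 1 + u′ ≤ β violating sparsity, each weighted by the factor
-- s ^ (surplus - u) with s slightly larger than β / u.
module Stage2 (n k β : ℕ) where

  ks = kSubsets n k

  -- The product of `s` and the size `u` stays between `β` and `2 β`. With `β` of order `n`, the
  -- factor `s ^ (- u)` cancels the number of sets `U`, which is about `(n / u) ^ u`, up to `B ^ u`.
  scale : ℕ → ℕ
  scale u′ = suc (β / suc u′)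

  inverse : ∀ u′ → ∃ λ t → toℚ (scale u′) * t ≡ 1ℚ × 0ℚ ≤ t × t ≤ 1ℚ
  inverse u′ = ∃-inverse (toℚ (scale u′)) (1≤toℚ {scale u′} (ℕ.s≤s ℕ.z≤n))

  t : ℕ → ℚ
  t u′ = proj₁ (inverse u′)

  0≤t : ∀ u′ → 0ℚ ≤ t u′
  0≤t u′ = proj₁ (proj₂ (proj₂ (inverse u′)))

  open UnionTerm

  violation : ℕ → Subset n → Hypergraph n k → ℚ
  violation u′ U H = t u′ ↑ suc u′ * bitProduct (edgeBits (scale u′) U ks) H

  0≤violation : ∀ u′ U H → 0ℚ ≤ violation u′ U H
  0≤violation u′ U H = 0≤* (0≤↑ (0≤t u′) (suc u′)) (bitProduct-nonneg (edgeBits (scale u′) U ks) (0≤edgeBits (scale u′) U ks) H)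

  Z₂ : Hypergraph n k → ℚ
  Z₂ H = ∑ (downFrom β) (λ u′ → ∑ (kSubsets n (suc u′)) (λ U → violation u′ U H))

  0≤Z₂-size : ∀ H u′ → 0ℚ ≤ ∑ (kSubsets n (suc u′)) (λ U → violation u′ U H)
  0≤Z₂-size H u′ = ∑-nonneg (kSubsets n (suc u′)) (λ U → 0≤violation u′ U H)

  0≤Z₂ : ∀ H → 0ℚ ≤ Z₂ H
  0≤Z₂ H = ∑-nonneg (downFrom β) (0≤Z₂-size H)

  1≤violation : ∀ u′ U H → (∀ e → e ∈ select ks H → ¬ meet e U ≡ 1) → suc u′ ℕ.≤ surplus (select ks H) U →
    1ℚ ≤ violation u′ U H
  1≤violation u′ U H noSingle many = begin
    1ℚ                                                      ≡⟨ 1↑ (suc u′) ⟨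
    1ℚ ↑ suc u′                                             ≡⟨ cong (_↑ suc u′) (proj₁ (proj₂ (inverse u′))) ⟨
    (toℚ (scale u′) * t u′) ↑ suc u′                        ≡⟨ *-↑ (toℚ (scale u′)) (t u′) (suc u′) ⟩
    toℚ (scale u′) ↑ suc u′ * t u′ ↑ suc u′                 ≡⟨ ℚₚ.*-comm (toℚ (scale u′) ↑ suc u′) (t u′ ↑ suc u′) ⟩
    t u′ ↑ suc u′ * toℚ (scale u′) ↑ suc u′                 ≤⟨ *-monoˡ-≤ (0≤↑ (0≤t u′) (suc u′)) (↑-monoʳ (1≤toℚ {scale u′} (ℕ.s≤s ℕ.z≤n)) many) ⟩
    t u′ ↑ suc u′ * toℚ (scale u′) ↑ surplus (select ks H) U ≡⟨ cong (t u′ ↑ suc u′ *_) (edgeBits-surplus (scale u′) U ks H noSingle) ⟨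
    violation u′ U H                                        ∎
    where open ℚₚ.≤-Reasoning

  Z₂<1⇒sparse : ∀ H → Z₂ H < 1ℚ → Sparse (select ks H) β
  Z₂<1⇒sparse H Z₂<1 U 1≤U U≤β with Any.any? (λ e → meet e U ℕ.≟ 1) (select ks H)
  ... | yes single = inj₁ single
  ... | no none = inj₂ (ℕₚ.≰⇒> (small ∣ U ∣ refl 1≤U U≤β))
    where
    small : ∀ u → ∣ U ∣ ≡ u → 1 ℕ.≤ u → u ℕ.≤ β → ¬ ∣ U ∣ ℕ.≤ surplus (select ks H) U
    small (suc u′) size _ u≤β many = ℚₚ.<-irrefl refl (ℚₚ.≤-<-trans (begin
      1ℚ                                                        ≤⟨ 1≤violation u′ U H (λ e e∈ m≡1 → none (Any.map (λ { refl → m≡1 }) e∈))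
                                                                     (subst (ℕ._≤ surplus (select ks H) U) size many) ⟩
      violation u′ U H                                          ≤⟨ term≤∑ (kSubsets n (suc u′)) (λ U → 0≤violation u′ U H)
                                                                     (subst (λ u → U ∈ kSubsets n u) size (∈-kSubsets U)) ⟩
      ∑ (kSubsets n (suc u′)) (λ U → violation u′ U H)          ≤⟨ term≤∑ (downFrom β) (0≤Z₂-size H) (∈-downFrom⁺ u≤β) ⟩
      Z₂ H                                                      ∎) Z₂<1)
      where
      open ℚₚ.≤-Reasoning

  -- A single set costs at most `(t θ) ^ u`; there are at most `(B s) ^ u` of them, and `s t = 1`,
  -- so the sizes sum to a geometric series in `B θ`.
  E-Z₂ : ∀ {p} → 0ℚ ≤ p → p ≤ 1ℚ → ∀ Y B →
    (∀ u′ U → suc u′ ℕ.≤ β → ∣ U ∣ ≡ suc u′ →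
      Σˡ ks (λ e → surplusWeight (scale u′) (meet e U)) ℕ.+ Y ℕ.* suc u′ ℕ.≤ Σˡ ks (λ e → meets1 (meet e U))) →
    (∀ u′ → suc u′ ℕ.≤ β → binom n (suc u′) ℕ.≤ (B ℕ.* scale u′) ^ suc u′) →
    toℚ B * (1ℚ - p) ↑ Y + toℚ B * (1ℚ - p) ↑ Y ≤ 1ℚ →
    E p Z₂ ≤ toℚ B * (1ℚ - p) ↑ Y + toℚ B * (1ℚ - p) ↑ Y
  E-Z₂ {p} 0≤p p≤1 Y B paid few 2x≤1 = begin
    E p Z₂
      ≡⟨ E-∑ p (downFrom β) (λ u′ H → ∑ (kSubsets n (suc u′)) (λ U → violation u′ U H)) ⟩
    ∑ (downFrom β) (λ u′ → E p (λ H → ∑ (kSubsets n (suc u′)) (λ U → violation u′ U H)))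
      ≡⟨ ∑-cong (downFrom β) (λ u′ → E-∑ p (kSubsets n (suc u′)) (violation u′)) ⟩
    ∑ (downFrom β) (λ u′ → ∑ (kSubsets n (suc u′)) (λ U → E p (violation u′ U)))
      ≤⟨ ∑-mono (downFrom β) (λ u′ u′∈ → per-size u′ (∈-downFrom⁻ u′∈)) ⟩
    ∑ (downFrom β) (λ u′ → x ↑ suc u′)
      ≤⟨ geometric (0≤* (0≤toℚ B) 0≤θ) 2x≤1 β ⟩
    x + x ∎
    where
    open ℚₚ.≤-Reasoning
    θ = (1ℚ - p) ↑ Y
    x = toℚ B * θ
    0≤θ : 0ℚ ≤ θ
    0≤θ = 0≤↑ (≤-toDiff p≤1) Y
    per-set : ∀ u′ U → suc u′ ℕ.≤ β → ∣ U ∣ ≡ suc u′ → E p (violation u′ U) ≤ (t u′ * θ) ↑ suc u′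
    per-set u′ U u≤β size = begin
      E p (violation u′ U)
        ≡⟨ E-*ˡ p (t u′ ↑ suc u′) (bitProduct bits) ⟩
      t u′ ↑ suc u′ * E p (bitProduct bits)
        ≡⟨ cong (t u′ ↑ suc u′ *_) (E-bitProduct p bits) ⟩
      t u′ ↑ suc u′ * ∏ (Vec.map (mean p) bits)
        ≤⟨ *-monoˡ-≤ (0≤↑ (0≤t u′) (suc u′)) (∏-edgeBits (scale u′) U 0≤p p≤1 ks (Y ℕ.* suc u′) (paid u′ U u≤β size)) ⟩
      t u′ ↑ suc u′ * (1ℚ - p) ↑ (Y ℕ.* suc u′)
        ≡⟨ cong (t u′ ↑ suc u′ *_) (↑-* (1ℚ - p) Y (suc u′)) ⟩
      t u′ ↑ suc u′ * θ ↑ suc u′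
        ≡⟨ *-↑ (t u′) θ (suc u′) ⟨
      (t u′ * θ) ↑ suc u′ ∎
      where bits = edgeBits (scale u′) U ks
    per-size : ∀ u′ → suc u′ ℕ.≤ β → ∑ (kSubsets n (suc u′)) (λ U → E p (violation u′ U)) ≤ x ↑ suc u′
    per-size u′ u≤β = begin
      ∑ (kSubsets n (suc u′)) (λ U → E p (violation u′ U))
        ≤⟨ ∑-mono (kSubsets n (suc u′)) (λ U U∈ → per-set u′ U u≤β (∈-kSubsets⇒size n (suc u′) U∈)) ⟩
      ∑ (kSubsets n (suc u′)) (λ U → (t u′ * θ) ↑ suc u′)
        ≡⟨ ∑-const (kSubsets n (suc u′)) ((t u′ * θ) ↑ suc u′) ⟩
      toℚ (length (kSubsets n (suc u′))) * (t u′ * θ) ↑ suc u′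
        ≡⟨ cong (λ b → toℚ b * (t u′ * θ) ↑ suc u′) (length-kSubsets n (suc u′)) ⟩
      toℚ (binom n (suc u′)) * (t u′ * θ) ↑ suc u′
        ≤⟨ *-monoʳ-≤ (0≤↑ (0≤* (0≤t u′) 0≤θ) (suc u′)) (toℚ-mono (few u′ u≤β)) ⟩
      toℚ ((B ℕ.* scale u′) ^ suc u′) * (t u′ * θ) ↑ suc u′
        ≡⟨ cong (_* (t u′ * θ) ↑ suc u′) (toℚ-^ (B ℕ.* scale u′) (suc u′)) ⟩
      toℚ (B ℕ.* scale u′) ↑ suc u′ * (t u′ * θ) ↑ suc u′
        ≡⟨ *-↑ (toℚ (B ℕ.* scale u′)) (t u′ * θ) (suc u′) ⟨
      (toℚ (B ℕ.* scale u′) * (t u′ * θ)) ↑ suc u′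
        ≡⟨ cong (_↑ suc u′) cancel ⟩
      x ↑ suc u′ ∎
      where
      rearrange : ∀ b s t θ → b * s * (t * θ) ≡ s * t * (b * θ)
      rearrange = solve-∀ ringℚ
      cancel : toℚ (B ℕ.* scale u′) * (t u′ * θ) ≡ x
      cancel = trans (cong (_* (t u′ * θ)) (toℚ-* B (scale u′)))
        (trans (rearrange (toℚ B) (toℚ (scale u′)) (t u′) θ)
        (trans (cong (_* (toℚ B * θ)) (proj₁ (proj₂ (inverse u′)))) (ℚₚ.*-identityˡ x)))

-- Choice of constants

euclid : ∀ D n → 1 ℕ.≤ D → D ℕ.≤ n → ∃ λ μ → 1 ℕ.≤ μ × D ℕ.* μ ℕ.≤ n × n ℕ.≤ 2 ℕ.* D ℕ.* μ
euclid (suc d) n _ D≤n = μ , 1≤μ , subst (ℕ._≤ n) (ℕₚ.*-comm μ D) (m/n*n≤m n D) , n≤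
  where
  D = suc d
  μ = n / D
  n<D+μD : n ℕ.< D ℕ.+ μ ℕ.* D
  n<D+μD = subst (ℕ._< D ℕ.+ μ ℕ.* D) (sym (m≡m%n+[m/n]*n n D)) (ℕₚ.+-monoˡ-< (μ ℕ.* D) (m%n<n n D))
  1≤μ : 1 ℕ.≤ μ
  1≤μ with μ in eq
  ... | suc _ = ℕ.s≤s ℕ.z≤n
  ... | zero = ⊥-elim (ℕₚ.<⇒≱ (subst (λ μ → n ℕ.< D ℕ.+ μ ℕ.* D) eq n<D+μD) (ℕₚ.≤-trans (ℕₚ.≤-reflexive (ℕₚ.+-identityʳ D)) D≤n))
  n≤ : n ℕ.≤ 2 ℕ.* D ℕ.* μ
  n≤ = begin
    n                      ≤⟨ ℕₚ.<⇒≤ n<D+μD ⟩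
    D ℕ.+ μ ℕ.* D          ≡⟨ cong (ℕ._+ μ ℕ.* D) (ℕₚ.*-identityʳ D) ⟨
    D ℕ.* 1 ℕ.+ μ ℕ.* D    ≤⟨ ℕₚ.+-monoˡ-≤ (μ ℕ.* D) (ℕₚ.*-monoʳ-≤ D 1≤μ) ⟩
    D ℕ.* μ ℕ.+ μ ℕ.* D    ≡⟨ lemma D μ ⟩
    2 ℕ.* D ℕ.* μ          ∎
    where
    open ℕₚ.≤-Reasoning
    lemma : ∀ D μ → D ℕ.* μ ℕ.+ μ ℕ.* D ≡ 2 ℕ.* D ℕ.* μ
    lemma = ℕ-Ring.solve-∀

scale-bounds : ∀ β u′ → suc u′ ℕ.≤ β →
  β ℕ.≤ suc (β / suc u′) ℕ.* suc u′ × suc (β / suc u′) ℕ.* suc u′ ℕ.≤ 2 ℕ.* β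
scale-bounds β u′ u≤β =
  ℕₚ.<⇒≤ (subst (ℕ._< suc (β / suc u′) ℕ.* suc u′) (sym (m≡m%n+[m/n]*n β (suc u′)))
    (ℕₚ.+-monoˡ-< ((β / suc u′) ℕ.* suc u′) (m%n<n β (suc u′)))) ,
  ℕₚ.≤-trans (ℕₚ.+-mono-≤ u≤β (m/n*n≤m β (suc u′))) (ℕₚ.≤-reflexive (cong (β ℕ.+_) (sym (ℕₚ.+-identityʳ β))))

n≤2^n : ∀ n → n ℕ.≤ 2 ^ n
n≤2^n zero = ℕ.z≤n
n≤2^n (suc n) = ℕₚ.≤-trans (ℕₚ.+-mono-≤ (1≤2^ n) (n≤2^n n)) (ℕₚ.≤-reflexive (cong (2 ^ n ℕ.+_) (sym (ℕₚ.+-identityʳ (2 ^ n)))))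
  where
  1≤2^ : ∀ n → 1 ℕ.≤ 2 ^ n
  1≤2^ n = ℕₚ.m^n>0 2 n

-- b is large enough for the b ^ (k-1) * μ ^ (k-1) sets meeting U once to pay for those meeting U several times;
-- D μ ≤ n leaves room for k-1 blocks of size b μ outside a vertex set of size 2 k μ.
module Constants (j : ℕ) where

  k b D B h : ℕ
  k = suc (suc j)
  -- In `paid`, `4 k` comes from `s u ≤ 4 k μ` and `10 k` from `n + s u ≤ 10 k b μ`; the added one
  -- leaves the surplus `Y u`.
  b = suc (4 ℕ.* k ℕ.* (10 ℕ.* k) ^ j)
  D = 2 ℕ.* k ℕ.+ suc j ℕ.* b
  -- From `4 n ≤ 8 D μ`; likewise `h` comes from `n ^ k ≤ (2 D) ^ k μ ^ k ≤ 2 ^ h μ ^ k`.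
  B = 8 ℕ.* D
  h = 2 ℕ.* D ℕ.* k

  1≤D : 1 ℕ.≤ D
  1≤D = ℕ.s≤s ℕ.z≤n

  module Scale (n μ : ℕ) (1≤μ : 1 ℕ.≤ μ) (Dμ≤n : D ℕ.* μ ℕ.≤ n) (n≤2Dμ : n ℕ.≤ 2 ℕ.* D ℕ.* μ) where

    width β Y : ℕ
    -- There are `width` high vertices, enough for `k - 1` blocks of `μ` points; `β` is the
    -- resulting bound on the size of `B`.
    width = k ℕ.* μ
    β = width ℕ.+ width
    Y = μ ^ suc j

    3m≤n∸m : 3 ℕ.* width ℕ.≤ n ∸ width
    3m≤n∸m = ℕₚ.m+n≤o⇒m≤o∸n (3 ℕ.* width) (ℕₚ.≤-trans (ℕₚ.≤-reflexive (lemma k μ)) (ℕₚ.≤-trans (ℕₚ.*-monoˡ-≤ μ 4k≤D) Dμ≤n))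
      where
      lemma : ∀ k μ → 3 ℕ.* (k ℕ.* μ) ℕ.+ k ℕ.* μ ≡ 4 ℕ.* k ℕ.* μ
      lemma = ℕ-Ring.solve-∀
      4k≤b : 4 ℕ.* k ℕ.≤ b
      4k≤b = ℕₚ.≤-trans (ℕₚ.≤-trans (ℕₚ.≤-reflexive (sym (ℕₚ.*-identityʳ (4 ℕ.* k))))
        (ℕₚ.*-monoʳ-≤ (4 ℕ.* k) (ℕₚ.m^n>0 (10 ℕ.* k) j))) (ℕₚ.n≤1+n _)
      4k≤D : 4 ℕ.* k ℕ.≤ D
      4k≤D = ℕₚ.≤-trans 4k≤b (ℕₚ.≤-trans (ℕₚ.m≤m+n b (j ℕ.* b)) (ℕₚ.m≤n+m (suc j ℕ.* b) (2 ℕ.* k)))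

    m≤n : width ℕ.≤ n
    m≤n = ℕₚ.≤-trans (ℕₚ.≤-trans (ℕₚ.m≤m+n width _) 3m≤n∸m) (ℕₚ.m∸n≤m n width)

    n≡ : n ≡ n ∸ width ℕ.+ width
    n≡ = sym (ℕₚ.m∸n+n≡m m≤n)

    -- The factor `k ≥ 2` in `width` yields two copies of `μ ^ k`: one absorbs the binomial factor
    -- of the first union bound, the other beats `G`.
    2μ^k≤Δ : μ ^ k ℕ.+ μ ^ k ℕ.≤ width ℕ.* binom width (suc j)
    2μ^k≤Δ = begin
      μ ^ k ℕ.+ μ ^ k                                ≤⟨ ℕₚ.+-monoʳ-≤ (μ ^ k) (ℕₚ.m≤m+n (μ ^ k) (j ℕ.* μ ^ k)) ⟩
      k ℕ.* (μ ℕ.* Y)                                ≡⟨ ℕₚ.*-assoc k μ Y ⟨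
      width ℕ.* Y                                        ≤⟨ ℕₚ.*-monoʳ-≤ width (binom-lower μ (suc j)) ⟩
      width ℕ.* binom (suc j ℕ.* μ) (suc j)              ≤⟨ ℕₚ.*-monoʳ-≤ width (binom-mono (suc j) (ℕₚ.m≤n+m (suc j ℕ.* μ) μ)) ⟩
      width ℕ.* binom width (suc j)                          ∎
      where open ℕₚ.≤-Reasoning

    -- A power of two is wanted because `y` is the reciprocal of `2 ^ h`: the number of `k`-sets
    -- times `y` is then at most `μ ^ k`.
    sets≤ : length (kSubsets n k) ℕ.≤ 2 ^ h ℕ.* μ ^ k
    sets≤ = begin
      length (kSubsets n k)                ≡⟨ length-kSubsets n k ⟩
      binom n k                            ≤⟨ binom-upper n k ⟩
      n ^ k                                ≤⟨ ℕₚ.^-monoˡ-≤ k n≤2Dμ ⟩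
      (2 ℕ.* D ℕ.* μ) ^ k                  ≡⟨ *-^ (2 ℕ.* D) μ k ⟩
      (2 ℕ.* D) ^ k ℕ.* μ ^ k              ≤⟨ ℕₚ.*-monoˡ-≤ (μ ^ k) (ℕₚ.^-monoˡ-≤ k (n≤2^n (2 ℕ.* D))) ⟩
      (2 ^ (2 ℕ.* D)) ^ k ℕ.* μ ^ k        ≡⟨ cong (ℕ._* μ ^ k) (ℕₚ.^-*-assoc 2 (2 ℕ.* D) k) ⟩
      2 ^ h ℕ.* μ ^ k                      ∎
      where open ℕₚ.≤-Reasoning

    few-sets : ∀ u′ → suc u′ ℕ.≤ β → binom n (suc u′) ℕ.≤ (B ℕ.* suc (β / suc u′)) ^ suc u′
    few-sets u′ u≤β = ℕₚ.*-cancelʳ-≤ (binom n u) ((B ℕ.* s) ^ u) (u ^ u) {{ℕₚ.m^n≢0 u u}} (begin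
      binom n u ℕ.* u ^ u              ≤⟨ binom-u^u n u ⟩
      (4 ℕ.* n) ^ u                    ≤⟨ ℕₚ.^-monoˡ-≤ u 4n≤ ⟩
      (B ℕ.* s ℕ.* u) ^ u              ≡⟨ *-^ (B ℕ.* s) u u ⟩
      (B ℕ.* s) ^ u ℕ.* u ^ u          ∎)
      where
      open ℕₚ.≤-Reasoning
      u = suc u′
      s = suc (β / u)
      μ≤su : μ ℕ.≤ s ℕ.* u
      μ≤su = ℕₚ.≤-trans (ℕₚ.≤-trans (ℕₚ.m≤m+n μ _) (ℕₚ.m≤m+n width width)) (proj₁ (scale-bounds β u′ u≤β))
      lemma : ∀ D μ → 4 ℕ.* (2 ℕ.* D ℕ.* μ) ≡ 8 ℕ.* D ℕ.* μ
      lemma = ℕ-Ring.solve-∀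
      4n≤ : 4 ℕ.* n ℕ.≤ B ℕ.* s ℕ.* u
      4n≤ = begin
        4 ℕ.* n                        ≤⟨ ℕₚ.*-monoʳ-≤ 4 n≤2Dμ ⟩
        4 ℕ.* (2 ℕ.* D ℕ.* μ)          ≡⟨ lemma D μ ⟩
        B ℕ.* μ                        ≤⟨ ℕₚ.*-monoʳ-≤ B μ≤su ⟩
        B ℕ.* (s ℕ.* u)                ≡⟨ ℕₚ.*-assoc B s u ⟨
        B ℕ.* s ℕ.* u                  ∎

    -- Sets meeting `U` once have `k - 1` points outside and number at least `u (b μ) ^ (k - 1)`. A
    -- second point in `U` has weight only of order `μ`, so the weighted count of the other sets
    -- carries one power of `b` less and a large `b` wins.
    paid : ∀ u′ (U : Subset n) → suc u′ ℕ.≤ β → ∣ U ∣ ≡ suc u′ →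
      Σˡ (kSubsets n k) (λ e → surplusWeight (suc (β / suc u′)) (meet e U)) ℕ.+ Y ℕ.* suc u′
        ℕ.≤ Σˡ (kSubsets n k) (λ e → meets1 (meet e U))
    paid u′ U u≤β size = begin
      X ℕ.+ Y ℕ.* u                                            ≤⟨ ℕₚ.+-monoˡ-≤ (Y ℕ.* u) X≤ ⟩
      u ℕ.* (4k[10k]^j ℕ.* b ^ j ℕ.* Y) ℕ.+ Y ℕ.* u            ≤⟨ ℕₚ.+-monoʳ-≤ (u ℕ.* (4k[10k]^j ℕ.* b ^ j ℕ.* Y)) Yu≤ ⟩
      u ℕ.* (4k[10k]^j ℕ.* b ^ j ℕ.* Y) ℕ.+ b ^ j ℕ.* (Y ℕ.* u) ≡⟨ collect u 4k[10k]^j (b ^ j) Y ⟩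
      u ℕ.* (b ^ suc j ℕ.* Y)                                  ≡⟨ cong (u ℕ.*_) (*-^ b μ (suc j)) ⟨
      u ℕ.* (b ℕ.* μ) ^ suc j                                  ≤⟨ ℕₚ.*-monoʳ-≤ u (binom-lower (b ℕ.* μ) (suc j)) ⟩
      u ℕ.* binom (suc j ℕ.* (b ℕ.* μ)) (suc j)                ≤⟨ ℕₚ.*-monoʳ-≤ u (binom-mono (suc j) co≥) ⟩
      u ℕ.* binom (co U) (suc j)                               ≡⟨ cong (ℕ._* binom (co U) (suc j)) size ⟨
      ∣ U ∣ ℕ.* binom (co U) (suc j)                           ≡⟨ count-meets1 (suc j) U ⟨
      Σˡ (kSubsets n k) (λ e → meets1 (meet e U))              ∎
      where
      open ℕₚ.≤-Reasoning
      u = suc u′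
      s = suc (β / u)
      X = Σˡ (kSubsets n k) (λ e → surplusWeight s (meet e U))
      4k[10k]^j = 4 ℕ.* k ℕ.* (10 ℕ.* k) ^ j
      collect : ∀ u c p Y → u ℕ.* (c ℕ.* p ℕ.* Y) ℕ.+ p ℕ.* (Y ℕ.* u) ≡ u ℕ.* (suc c ℕ.* p ℕ.* Y)
      collect = ℕ-Ring.solve-∀
      Yu≤ : Y ℕ.* u ℕ.≤ b ^ j ℕ.* (Y ℕ.* u)
      Yu≤ = ℕₚ.≤-trans (ℕₚ.≤-reflexive (sym (ℕₚ.+-identityʳ (Y ℕ.* u)))) (ℕₚ.*-monoˡ-≤ (Y ℕ.* u) (ℕₚ.m^n>0 b j))
      co≥ : suc j ℕ.* (b ℕ.* μ) ℕ.≤ co U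
      co≥ = ℕₚ.+-cancelˡ-≤ β _ _ (begin
        β ℕ.+ suc j ℕ.* (b ℕ.* μ)      ≡⟨ lemma k (suc j) b μ ⟩
        D ℕ.* μ                        ≤⟨ Dμ≤n ⟩
        n                              ≡⟨ ∣∣+co U ⟨
        ∣ U ∣ ℕ.+ co U                 ≤⟨ ℕₚ.+-monoˡ-≤ (co U) (subst (ℕ._≤ β) (sym size) u≤β) ⟩
        β ℕ.+ co U                     ∎)
        where
        lemma : ∀ k j b μ → k ℕ.* μ ℕ.+ k ℕ.* μ ℕ.+ j ℕ.* (b ℕ.* μ) ≡ (2 ℕ.* k ℕ.+ j ℕ.* b) ℕ.* μ
        lemma = ℕ-Ring.solve-∀
      su≤ : s ℕ.* u ℕ.≤ 4 ℕ.* k ℕ.* μ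
      su≤ = ℕₚ.≤-trans (proj₂ (scale-bounds β u′ u≤β)) (ℕₚ.≤-reflexive (lemma k μ))
        where
        lemma : ∀ k μ → 2 ℕ.* (k ℕ.* μ ℕ.+ k ℕ.* μ) ≡ 4 ℕ.* k ℕ.* μ
        lemma = ℕ-Ring.solve-∀
      n+su≤ : n ℕ.+ s ℕ.* u ℕ.≤ 10 ℕ.* k ℕ.* b ℕ.* μ
      n+su≤ = begin
        n ℕ.+ s ℕ.* u                                            ≤⟨ ℕₚ.+-mono-≤ n≤2Dμ su≤ ⟩
        2 ℕ.* D ℕ.* μ ℕ.+ 4 ℕ.* k ℕ.* μ                          ≡⟨ lemma k (suc j) b μ ⟩
        8 ℕ.* k ℕ.* μ ℕ.* 1 ℕ.+ 2 ℕ.* b ℕ.* μ ℕ.* suc j          ≤⟨ ℕₚ.+-mono-≤ (ℕₚ.*-monoʳ-≤ (8 ℕ.* k ℕ.* μ) (ℕ.s≤s (ℕ.z≤n {4k[10k]^j})))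
                                                                      (ℕₚ.*-monoʳ-≤ (2 ℕ.* b ℕ.* μ) (ℕₚ.n≤1+n (suc j))) ⟩
        8 ℕ.* k ℕ.* μ ℕ.* b ℕ.+ 2 ℕ.* b ℕ.* μ ℕ.* k              ≡⟨ lemma′ k b μ ⟩
        10 ℕ.* k ℕ.* b ℕ.* μ                                     ∎
        where
        lemma : ∀ k j b μ → 2 ℕ.* (2 ℕ.* k ℕ.+ j ℕ.* b) ℕ.* μ ℕ.+ 4 ℕ.* k ℕ.* μ ≡ 8 ℕ.* k ℕ.* μ ℕ.* 1 ℕ.+ 2 ℕ.* b ℕ.* μ ℕ.* j
        lemma = ℕ-Ring.solve-∀
        lemma′ : ∀ k b μ → 8 ℕ.* k ℕ.* μ ℕ.* b ℕ.+ 2 ℕ.* b ℕ.* μ ℕ.* k ≡ 10 ℕ.* k ℕ.* b ℕ.* μ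
        lemma′ = ℕ-Ring.solve-∀
      X≤ : X ℕ.≤ u ℕ.* (4k[10k]^j ℕ.* b ^ j ℕ.* Y)
      -- Multiplication by `s` turns `s ^ (m - 1)` into `s ^ m`, to which `total-weight≥2` applies;
      -- one `s` cancels at the end.
      X≤ = ℕₚ.*-cancelˡ-≤ s (begin
        s ℕ.* X
          ≡⟨ Σˡ-*ˡ (kSubsets n k) s (λ e → surplusWeight s (meet e U)) ⟨
        Σˡ (kSubsets n k) (λ e → s ℕ.* surplusWeight s (meet e U))
          ≤⟨ Σˡ-mono (kSubsets n k) (λ e _ → ℕₚ.≤-reflexive (sym (weight≥2≡ s (meet e U)))) ⟩
        Σˡ (kSubsets n k) (λ e → weight≥2 s (meet e U))
          ≤⟨ total-weight≥2 s j U ⟩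
        s ℕ.* ∣ U ∣ ℕ.* (s ℕ.* ∣ U ∣) ℕ.* (n ℕ.+ s ℕ.* ∣ U ∣) ^ j
          ≡⟨ cong (λ u → s ℕ.* u ℕ.* (s ℕ.* u) ℕ.* (n ℕ.+ s ℕ.* u) ^ j) size ⟩
        s ℕ.* u ℕ.* (s ℕ.* u) ℕ.* (n ℕ.+ s ℕ.* u) ^ j
          ≤⟨ ℕₚ.*-mono-≤ (ℕₚ.*-monoʳ-≤ (s ℕ.* u) su≤) (ℕₚ.^-monoˡ-≤ j n+su≤) ⟩
        s ℕ.* u ℕ.* (4 ℕ.* k ℕ.* μ) ℕ.* (10 ℕ.* k ℕ.* b ℕ.* μ) ^ j
          ≡⟨ cong (s ℕ.* u ℕ.* (4 ℕ.* k ℕ.* μ) ℕ.*_) (trans (*-^ (10 ℕ.* k ℕ.* b) μ j) (cong (ℕ._* μ ^ j) (*-^ (10 ℕ.* k) b j))) ⟩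
        s ℕ.* u ℕ.* (4 ℕ.* k ℕ.* μ) ℕ.* ((10 ℕ.* k) ^ j ℕ.* b ^ j ℕ.* μ ^ j)
          ≡⟨ lemma s u k μ ((10 ℕ.* k) ^ j) (b ^ j) (μ ^ j) ⟩
        s ℕ.* (u ℕ.* (4k[10k]^j ℕ.* b ^ j ℕ.* Y)) ∎)
        where
        lemma : ∀ s u k μ c p w → s ℕ.* u ℕ.* (4 ℕ.* k ℕ.* μ) ℕ.* (c ℕ.* p ℕ.* w) ≡ s ℕ.* (u ℕ.* (4 ℕ.* k ℕ.* c ℕ.* p ℕ.* (μ ℕ.* w)))
        lemma = ℕ-Ring.solve-∀

-- The splitting into low and high vertices is a propositional equation, since `n ∸ m + m` does not
-- compute to `n`; matching on it here spares transports of hypergraphs.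
good⇒torsion-free : ∀ l m k n → n ≡ l ℕ.+ m → 3 ℕ.* m ℕ.≤ l → ∀ (F H : Hypergraph n (suc k)) →
  (∀ {e} → e ∈ select (kSubsets n (suc k)) F → e ∈ edges {n} {suc k} H) →
  missing n (suc k) (Spanned (select (kSubsets n (suc k)) F)) ℕ.< m ℕ.* binom m k →
  Sparse (edges {n} {suc k} H) (m ℕ.+ m) → CokerTorsionFree (M {n} {suc k} H)
good⇒torsion-free l m k .(l ℕ.+ m) refl 3m≤l F H F⊆H few sparse =
  let B , B≤ , absorbed = few-missing⇒absorbed l m k cs (Spanned (select ks F)) 3m≤l
        (spanned-InImage cs (select ks F) (λ e e∈ → InImage-generator (∈-map⁺ column (F⊆H e∈)))) few
  in torsion-free (suc k) Es (m ℕ.+ m) B (λ e e∈ → ∈-kSubsets⇒size (l ℕ.+ m) (suc k) (select-⊆ ks H e∈)) sparse B≤ absorbed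
  where
  ks = kSubsets (l ℕ.+ m) (suc k)
  Es = edges {l ℕ.+ m} {suc k} H
  cs = M {l ℕ.+ m} {suc k} H

-- Asymptotic estimates and the probability of the event.

module Bounds (j : ℕ) where

  open Constants j

  two : ℚ
  two = 1ℚ + 1ℚ

  0≤two : 0ℚ ≤ two
  0≤two = 0≤+ 0≤1 0≤1

  reciprocal : ∃ λ y → two ↑ h * y ≡ 1ℚ × 0ℚ ≤ y × y ≤ 1ℚ
  reciprocal = ∃-inverse (two ↑ h) (1≤↑ (a≤a+b 0≤1) h)

  16k² : ℚ
  16k² = (toℚ k + toℚ k + (toℚ k + toℚ k)) * (toℚ k + toℚ k + (toℚ k + toℚ k))

  1≤16k² : 1ℚ ≤ 16k²
  1≤16k² = 1≤* 1≤4k 1≤4k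
    where
    1≤4k : 1ℚ ≤ toℚ k + toℚ k + (toℚ k + toℚ k)
    1≤4k = ℚₚ.≤-trans (1≤toℚ {k} (ℕ.s≤s ℕ.z≤n)) (ℚₚ.≤-trans (a≤a+b (0≤toℚ k)) (a≤a+b (0≤+ (0≤toℚ k) (0≤toℚ k))))

  0≤16k² : 0ℚ ≤ 16k²
  0≤16k² = ℚₚ.≤-trans 0≤1 1≤16k²

  -- The exponent comes from `n ≤ 2 D μ` and makes `G ≤ L ↑ μ` with a base independent of `n`.
  L : ℚ
  L = 16k² ↑ (2 ℕ.* D ℕ.* h)

  0≤L : 0ℚ ≤ L
  0≤L = 0≤↑ 0≤16k² (2 ℕ.* D ℕ.* h)

  Cₜ : ℚ
  Cₜ = L + (toℚ B + toℚ B)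

  0≤Cₜ : 0ℚ ≤ Cₜ
  0≤Cₜ = 0≤+ 0≤L (0≤+ (0≤toℚ B) (0≤toℚ B))

  module Asymptotic (n μ : ℕ) (1≤μ : 1 ℕ.≤ μ) (Dμ≤n : D ℕ.* μ ℕ.≤ n) (n≤2Dμ : n ℕ.≤ 2 ℕ.* D ℕ.* μ) where

    open Scale n μ 1≤μ Dμ≤n n≤2Dμ

    Δ : ℕ
    Δ = width ℕ.* binom width (suc j)

    y : ℚ
    y = proj₁ reciprocal
    0≤y : 0ℚ ≤ y
    0≤y = proj₁ (proj₂ (proj₂ reciprocal))
    y≤1 : y ≤ 1ℚ
    y≤1 = proj₂ (proj₂ (proj₂ reciprocal))
    ry≡1 : two ↑ h * y ≡ 1ℚ
    ry≡1 = proj₁ (proj₂ reciprocal)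

    module S₁ = Stage1 n k (ℕ.s≤s ℕ.z≤n) Δ h y 0≤y ry≡1
    module S₂ = Stage2 n k β

    Z : Hypergraph n k → ℚ
    Z H = S₁.Z₁ H + S₂.Z₂ H

    0≤Z : ∀ H → 0ℚ ≤ Z H
    0≤Z H = 0≤+ (S₁.0≤Z₁ H) (S₂.0≤Z₂ H)

    Z<1⇒torsion-free : ∀ H → Z H < 1ℚ → CokerTorsionFree (M {n} {k} H)
    Z<1⇒torsion-free H Z<1 = good⇒torsion-free (n ∸ width) width (suc j) n n≡ 3m≤n∸m
      (greedy ks H) H (select-compatible ks (greedy ks H) H _ (greedy-compatible ks H))
      (S₁.Z₁<1⇒few H (ℚₚ.≤-<-trans (a≤a+b (S₂.0≤Z₂ H)) Z<1))
      (S₂.Z₂<1⇒sparse H (ℚₚ.≤-<-trans (a≤b+a (S₁.0≤Z₁ H)) Z<1))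
      where ks = kSubsets n k

    module _ {p} (0≤p : 0ℚ ≤ p) (p≤1 : p ≤ 1ℚ) where

      private
        q θ : ℚ
        q = 1ℚ - p
        θ = q ↑ Y
        0≤q : 0ℚ ≤ q
        0≤q = ≤-toDiff p≤1
        q≤1 : q ≤ 1ℚ
        q≤1 = a-b≤a 0≤p
        0≤θ : 0ℚ ≤ θ
        0≤θ = 0≤↑ 0≤q Y

      G≤ : S₁.G ≤ L ↑ μ
      G≤ = begin
        (16k² ↑ n) ↑ h                       ≡⟨ ↑-* 16k² n h ⟨
        16k² ↑ (n ℕ.* h)                     ≤⟨ ↑-monoʳ 1≤16k² (ℕₚ.*-monoˡ-≤ h n≤2Dμ) ⟩
        16k² ↑ (2 ℕ.* D ℕ.* μ ℕ.* h)         ≡⟨ cong (16k² ↑_) (swap (2 ℕ.* D) μ h) ⟩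
        16k² ↑ (2 ℕ.* D ℕ.* h ℕ.* μ)         ≡⟨ ↑-* 16k² (2 ℕ.* D ℕ.* h) μ ⟩
        L ↑ μ                                ∎
        where
        open ℚₚ.≤-Reasoning
        swap : ∀ a b c → a ℕ.* b ℕ.* c ≡ a ℕ.* c ℕ.* b
        swap a b c = trans (ℕₚ.*-assoc a b c) (trans (cong (a ℕ.*_) (ℕₚ.*-comm b c)) (sym (ℕₚ.*-assoc a c b)))

      -- The (1 + p y) ^ N of the union bound is absorbed by half of the factors q.
      absorb-binomial : q ↑ (μ ^ k) * (1ℚ + p * y) ↑ length (kSubsets n k) ≤ 1ℚ
      absorb-binomial = begin
        q ↑ (μ ^ k) * (1ℚ + p * y) ↑ length (kSubsets n k)
          ≤⟨ *-monoˡ-≤ (0≤↑ 0≤q (μ ^ k)) (↑-monoʳ (a≤a+b (0≤* 0≤p 0≤y)) sets≤) ⟩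
        q ↑ (μ ^ k) * (1ℚ + p * y) ↑ (2 ^ h ℕ.* μ ^ k)
          ≡⟨ cong (q ↑ (μ ^ k) *_) (↑-* (1ℚ + p * y) (2 ^ h) (μ ^ k)) ⟩
        q ↑ (μ ^ k) * ((1ℚ + p * y) ↑ (2 ^ h)) ↑ (μ ^ k)
          ≡⟨ *-↑ q ((1ℚ + p * y) ↑ (2 ^ h)) (μ ^ k) ⟨
        (q * (1ℚ + p * y) ↑ (2 ^ h)) ↑ (μ ^ k)
          ≡⟨ cong (_↑ (μ ^ k)) (ℚₚ.*-comm q ((1ℚ + p * y) ↑ (2 ^ h))) ⟩
        ((1ℚ + p * y) ↑ (2 ^ h) * q) ↑ (μ ^ k)
          ≤⟨ ↑≤1 (0≤* (0≤↑ (0≤+ 0≤1 (0≤* 0≤p 0≤y)) (2 ^ h)) 0≤q)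
               ([1+x/r]^r[1-x]≤1 {p} {p * y} (2 ^ h) (0≤* 0≤p 0≤y) (*≤1 0≤p 0≤y p≤1 y≤1) rpy≡p) (μ ^ k) ⟩
        1ℚ ∎
        where
        open ℚₚ.≤-Reasoning
        rearrange : ∀ r p y → r * (p * y) ≡ p * (r * y)
        rearrange = solve-∀ ringℚ
        toℚ-2^h : toℚ (2 ^ h) ≡ two ↑ h
        toℚ-2^h = trans (toℚ-^ 2 h) (cong (_↑ h) (toℚ-+ 1 1))
        rpy≡p : toℚ (2 ^ h) * (p * y) ≡ p
        rpy≡p = trans (rearrange (toℚ (2 ^ h)) p y) (trans (cong (λ r → p * (r * y)) toℚ-2^h) (trans (cong (p *_) ry≡1) (ℚₚ.*-identityʳ p)))

      -- After one factor `q ↑ (μ ^ k)` has absorbed the binomial, the other combines with `G` into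
      -- `(L * θ) ↑ μ` because `μ ^ k = Y μ`; this power is at most its base.
      E-Z₁≤ : L * θ ≤ 1ℚ → E p S₁.Z₁ ≤ L * θ
      E-Z₁≤ Lθ≤1 = begin
        E p S₁.Z₁                                              ≤⟨ S₁.E-Z₁ 0≤p p≤1 ⟩
        S₁.G * q ↑ Δ * P                                       ≤⟨ *-monoʳ-≤ 0≤P (*-mono-≤ S₁.0≤G (0≤↑ 0≤q Δ) G≤ (↑-antimono 0≤q q≤1 2μ^k≤Δ)) ⟩
        L ↑ μ * q ↑ (μ ^ k ℕ.+ μ ^ k) * P                      ≡⟨ cong (λ t → L ↑ μ * t * P) (↑-+ q (μ ^ k) (μ ^ k)) ⟩
        L ↑ μ * (q ↑ (μ ^ k) * q ↑ (μ ^ k)) * P                ≡⟨ rearrange (L ↑ μ) (q ↑ (μ ^ k)) P ⟩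
        q ↑ (μ ^ k) * P * (L ↑ μ * q ↑ (μ ^ k))                ≤⟨ ≤1*⇒≤ (0≤* (0≤↑ 0≤L μ) (0≤↑ 0≤q (μ ^ k))) absorb-binomial ⟩
        L ↑ μ * q ↑ (μ ^ k)                                    ≡⟨ cong (λ e → L ↑ μ * q ↑ e) (ℕₚ.*-comm μ Y) ⟩
        L ↑ μ * q ↑ (Y ℕ.* μ)                                 ≡⟨ cong (L ↑ μ *_) (↑-* q Y μ) ⟩
        L ↑ μ * θ ↑ μ                                          ≡⟨ *-↑ L θ μ ⟨
        (L * θ) ↑ μ                                            ≤⟨ ↑-antimono (0≤* 0≤L 0≤θ) Lθ≤1 1≤μ ⟩
        L * θ * 1ℚ                                             ≡⟨ ℚₚ.*-identityʳ (L * θ) ⟩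
        L * θ                                                  ∎
        where
        open ℚₚ.≤-Reasoning
        P = (1ℚ + p * y) ↑ length (kSubsets n k)
        0≤P : 0ℚ ≤ P
        0≤P = 0≤↑ (0≤+ 0≤1 (0≤* 0≤p 0≤y)) (length (kSubsets n k))
        rearrange : ∀ a b c → a * (b * b) * c ≡ b * c * (a * b)
        rearrange = solve-∀ ringℚ

      E-Z≤ : Cₜ * θ ≤ 1ℚ → E p Z ≤ Cₜ * θ
      E-Z≤ Cθ≤1 = begin
        E p Z                                            ≡⟨ E-+ p S₁.Z₁ S₂.Z₂ ⟩
        E p S₁.Z₁ + E p S₂.Z₂                            ≤⟨ ℚₚ.+-mono-≤ (E-Z₁≤ (ℚₚ.≤-trans (a≤a+b 0≤2Bθ) sum≤1))
                                                              (S₂.E-Z₂ 0≤p p≤1 Y B paid few-sets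
                                                                (ℚₚ.≤-trans (a≤b+a (0≤* 0≤L 0≤θ)) sum≤1)) ⟩
        L * θ + (toℚ B * θ + toℚ B * θ)                  ≡⟨ distribute L (toℚ B) θ ⟩
        Cₜ * θ                                           ∎
        where
        open ℚₚ.≤-Reasoning
        distribute : ∀ l b θ → l * θ + (b * θ + b * θ) ≡ (l + (b + b)) * θ
        distribute = solve-∀ ringℚ
        0≤Bθ : 0ℚ ≤ toℚ B * θ
        0≤Bθ = 0≤* (0≤toℚ B) 0≤θ
        0≤2Bθ : 0ℚ ≤ toℚ B * θ + toℚ B * θ
        0≤2Bθ = 0≤+ 0≤Bθ 0≤Bθ
        sum≤1 : L * θ + (toℚ B * θ + toℚ B * θ) ≤ 1ℚ
        sum≤1 = subst (_≤ 1ℚ) (sym (distribute L (toℚ B) θ)) Cθ≤1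

      -- The growth of `p` enters here: `Y` is at least `(n / 2 D) ^ (k - 1)`, so `p Y ≥ R`, while
      -- `θ` is at most `1 / (1 + p Y)`.
      θ-small : ∀ R → 0ℚ ≤ R → R * toℚ ((2 ℕ.* D) ^ suc j) ≤ p * toℚ (n ^ suc j) → R * θ ≤ 1ℚ
      θ-small R 0≤R large = begin
        R * θ                              ≤⟨ *-monoʳ-≤ 0≤θ R≤pY ⟩
        toℚ Y * p * θ                     ≤⟨ *-monoʳ-≤ 0≤θ (a≤b+a {toℚ Y * p} {1ℚ} 0≤1) ⟩
        (1ℚ + toℚ Y * p) * θ              ≤⟨ [1+nx][1-x]^n≤1 0≤p p≤1 Y ⟩
        1ℚ                                 ∎
        where
        open ℚₚ.≤-Reasoning
        c = toℚ ((2 ℕ.* D) ^ suc j)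
        1≤c : 1ℚ ≤ c
        1≤c = 1≤toℚ (ℕₚ.m^n>0 (2 ℕ.* D) (suc j))
        instance
          c>0 : ℚ.Positive c
          c>0 = ℚ.positive (ℚₚ.<-≤-trans (ℚₚ.positive⁻¹ 1ℚ) 1≤c)
        rearrange : ∀ p c Y → p * (c * Y) ≡ Y * p * c
        rearrange = solve-∀ ringℚ
        R≤pY : R ≤ toℚ Y * p
        R≤pY = ℚₚ.*-cancelʳ-≤-pos c (begin
          R * c                                            ≤⟨ large ⟩
          p * toℚ (n ^ suc j)                              ≤⟨ *-monoˡ-≤ 0≤p (toℚ-mono (ℕₚ.^-monoˡ-≤ (suc j) n≤2Dμ)) ⟩
          p * toℚ ((2 ℕ.* D ℕ.* μ) ^ suc j)                ≡⟨ cong (λ t → p * toℚ t) (*-^ (2 ℕ.* D) μ (suc j)) ⟩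
          p * toℚ ((2 ℕ.* D) ^ suc j ℕ.* Y)               ≡⟨ cong (p *_) (toℚ-* ((2 ℕ.* D) ^ suc j) Y) ⟩
          p * (c * toℚ Y)                                 ≡⟨ rearrange p c (toℚ Y) ⟩
          toℚ Y * p * c                                   ∎)

      -- The factor `1 + ε⁻¹` delivers two bounds at once: `Cₜ * θ ≤ 1`, under which the expectation
      -- estimates hold, and `Cₜ * θ ≤ ε`.
      probability : ∀ ε ε⁻¹ → 0ℚ ≤ ε → 0ℚ ≤ ε⁻¹ → ε * ε⁻¹ ≡ 1ℚ →
        Cₜ * (1ℚ + ε⁻¹) * toℚ ((2 ℕ.* D) ^ suc j) ≤ p * toℚ (n ^ suc j) →
        1ℚ - ε ≤ prob n k p (λ H → does (Z H ℚₚ.<? 1ℚ))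
      probability ε ε⁻¹ 0≤ε 0≤ε⁻¹ εε⁻¹≡1 large = begin
        1ℚ - ε                                       ≤⟨ ℚₚ.+-monoʳ-≤ 1ℚ (ℚₚ.neg-antimono-≤ (ℚₚ.≤-trans (E-Z≤ Cθ≤1) Cθ≤ε)) ⟩
        1ℚ - E p Z                                   ≤⟨ markov 0≤p p≤1 n k Z 0≤Z ⟩
        prob n k p (λ H → does (Z H ℚₚ.<? 1ℚ))       ∎
        where
        open ℚₚ.≤-Reasoning
        small : Cₜ * (1ℚ + ε⁻¹) * θ ≤ 1ℚ
        small = θ-small (Cₜ * (1ℚ + ε⁻¹)) (0≤* 0≤Cₜ (0≤+ 0≤1 0≤ε⁻¹)) large
        0≤Cθ : 0ℚ ≤ Cₜ * θ
        0≤Cθ = 0≤* 0≤Cₜ 0≤θ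
        expand : ∀ c e θ → c * (1ℚ + e) * θ ≡ c * θ + e * (c * θ)
        expand = solve-∀ ringℚ
        sum≤1 : Cₜ * θ + ε⁻¹ * (Cₜ * θ) ≤ 1ℚ
        sum≤1 = subst (_≤ 1ℚ) (expand Cₜ ε⁻¹ θ) small
        Cθ≤1 : Cₜ * θ ≤ 1ℚ
        Cθ≤1 = ℚₚ.≤-trans (a≤a+b (0≤* 0≤ε⁻¹ 0≤Cθ)) sum≤1
        Cθ≤ε : Cₜ * θ ≤ ε
        Cθ≤ε = begin
          Cₜ * θ                         ≡⟨ ℚₚ.*-identityˡ (Cₜ * θ) ⟨
          1ℚ * (Cₜ * θ)                  ≡⟨ cong (_* (Cₜ * θ)) εε⁻¹≡1 ⟨
          ε * ε⁻¹ * (Cₜ * θ)             ≡⟨ ℚₚ.*-assoc ε ε⁻¹ (Cₜ * θ) ⟩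
          ε * (ε⁻¹ * (Cₜ * θ))           ≤⟨ *-monoˡ-≤ 0≤ε (ℚₚ.≤-trans (a≤b+a 0≤Cθ) sum≤1) ⟩
          ε * 1ℚ                         ≡⟨ ℚₚ.*-identityʳ ε ⟩
          ε                              ∎

positive-inverse : ∀ {ε} → 0ℚ < ε → ∃ λ ε⁻¹ → 0ℚ ≤ ε⁻¹ × ε * ε⁻¹ ≡ 1ℚ
positive-inverse {ε} 0<ε = ℚ.1/ ε , ℚₚ.<⇒≤ (ℚₚ.positive⁻¹ (ℚ.1/ ε) {{ℚₚ.1/pos⇒pos ε}}) , ℚₚ.*-inverseʳ ε
  where
  instance
    ε>0 : ℚ.Positive ε
    ε>0 = ℚ.positive 0<ε
    ε≢0 : ℚ.NonZero ε
    ε≢0 = ℚₚ.pos⇒nonZero ε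

theorem1p2 : (k : ℕ) → k ≥ 3 → (p : ℕ → ℚ)
    → (∀ n → 0ℚ ≤ p n × p n ≤ 1ℚ)
    → (∀ (C : ℚ) → ∃ λ N₀ → ∀ n → n ≥ N₀ → C ≤ p n * toℚ (n ^ (k ∸ 1)))
    → ∀ (ε : ℚ) → 0ℚ < ε
    → ∃ λ N → ∀ n → n ≥ N
    → ∃ λ (f : Hypergraph n k → Bool)
    → (∀ H → f H ≡ true → CokerTorsionFree (M {n} {k} H))
    × (1ℚ - ε ≤ prob n k (p n) f)
theorem1p2 (suc zero) (ℕ.s≤s ())
theorem1p2 (suc (suc j)) _ p 0≤p≤1 large ε 0<ε =
  let ε⁻¹ , 0≤ε⁻¹ , εε⁻¹≡1 = positive-inverse 0<ε
      N₀ , large₀ = large (Cₜ * (1ℚ + ε⁻¹) * toℚ ((2 ℕ.* D) ^ suc j))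
  -- Taking `n ≥ D` makes the quotient `μ` of `n` by `D` positive.
  in N₀ ℕ.⊔ D , λ n n≥N →
    let μ , 1≤μ , Dμ≤n , n≤2Dμ = euclid D n 1≤D (ℕₚ.m⊔n≤o⇒n≤o N₀ D n≥N)
        open Asymptotic n μ 1≤μ Dμ≤n n≤2Dμ
    in (λ H → does (Z H ℚₚ.<? 1ℚ)) ,
       (λ H fH → Z<1⇒torsion-free H (from-does (Z H ℚₚ.<? 1ℚ) fH)) ,
       probability (proj₁ (0≤p≤1 n)) (proj₂ (0≤p≤1 n)) ε ε⁻¹ (ℚₚ.<⇒≤ 0<ε) 0≤ε⁻¹ εε⁻¹≡1 (large₀ n (ℕₚ.m⊔n≤o⇒m≤o N₀ D n≥N))
  where
  open Constants j
  open Bounds j
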